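{- Let $H$ be a fixed finite simple graph with $v$ vertices and $\ell>1$ edges, such that every vertex of $H$ lies on at least one edge, and let $0<p<1$. Consider the random simple graph on $n$ labeled vertices in which each of the $\binom n2$ possible edges appears independently with probability $p$. Then the expectation, variance and residual variance of the number $T_H$ of copies of $H$ are given, for $n\ge v$ (with all $O$-terms as $n\to\infty$), by $$\langle T_H\rangle_{n,p}=c_n p^\ell=\frac{1}{|S_H|}\Big[n^v-\frac{v(v-1)}{2}n^{v-1}\Big]p^\ell+O(n^{v-2}),$$ $$\mathrm{Var}(T_H)_{n,p}=\sum_{k=0}^{\ell}C_k\,(p^{2\ell-k}-p^{2\ell})=O(n^{2v-2}),$$ $$\mathrm{ResVar}(T_H)_{n,p}=\sum_{k=0}^{\ell}C_k\big(p^{2\ell-k}-p^{2\ell}-k(p^{2\ell-1}-p^{2\ell})\big)=C_2\,p^{2\ell-2}(1-p)^2+C_3\,p^{2\ell-3}(1-3p^2+2p^3)+O(n^{2v-4})=O(n^{2v-3}).$$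
   Context: $T_H$ is the number of copies of $H$ in the random graph, i.e. the number of (not necessarily induced) subgraphs isomorphic to $H$, and $T_e$ is the total number of edges. $\langle\cdot\rangle_{n,p}$, $\mathrm{Var}(\cdot)_{n,p}$ and $\mathrm{Cov}(\cdot,\cdot)_{n,p}$ denote expectation, variance and covariance in the independent-edge model. The residual variance of $T_H$ (the variance not explained by linear correlation with $T_e$) is $$\mathrm{ResVar}(T_H)_{n,p}=\mathrm{Var}(T_H)_{n,p}-\frac{\mathrm{Cov}(T_H,T_e)_{n,p}^2}{\mathrm{Var}(T_e)_{n,p}}.$$ $S_H$ is the group of symmetries (automorphism group) of $H$. $c_n=n(n-1)\cdots(n+1-v)/|S_H|$ is the number of copies of $H$ in the complete graph on the $n$ vertices. For $0\le k\le\ell$, $C_k=C_k(n)$ is the number of ordered pairs of copies of $H$ in the complete graph on the $n$ vertices (the two copies being distinguishable as first and second, and allowed to coincide) that share exactly $k$ edges; $C_k=0$ for $k>\ell$. The constants implied in the $O$-terms may depend on $H$ and $p$, but not on $n$. -}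

module Defs where

open import Level using (_⊔_) renaming (suc to lsuc)
open import Algebra.Apartness.Bundles using (HeytingField)
open import Algebra.Bundles using (CommutativeRing; Semiring)
open import Data.Fin.Base using (Fin; finToFun; funToFin)
import Data.Fin.Properties as Fin
open import Data.Fin.Subset using (Subset; inside; outside; _∈_; _⊆_; _∩_; ∁; ⊤; ∣_∣)
open import Data.Fin.Subset.Properties using (_∈?_; _⊆?_; ∈⊤)
open import Data.List.Base using (List; []; _∷_; _++_; map; filter; foldr; length; lookup; allFin; cartesianProduct; cartesianProductWith)
open import Data.List.Membership.Propositional using () renaming (_∈_ to _∈ᴸ_)
open import Data.List.Membership.Propositional.Properties using (∈-filter⁺; ∈-allFin)
open import Data.List.Relation.Unary.Any using (here; there)
open import Data.Nat.Base as ℕ using (ℕ; zero; suc; NonZero)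
import Data.Nat.Properties as ℕ
open import Data.Nat.Combinatorics using (_P_)
open import Data.Product.Base using (∃; ∃-syntax; _×_; _,_; proj₁; proj₂; uncurry)
open import Data.Product.Properties using (≡-dec)
open import Data.Sum.Base using (_⊎_; inj₁; inj₂)
open import Data.Vec.Base using ([]; _∷_)
open import Function.Base using (id)
open import Relation.Binary.Core using (Rel)
open import Relation.Binary.Structures using (IsStrictPartialOrder)
open import Relation.Binary.PropositionalEquality using (_≡_; _≗_; refl; sym; trans; subst; subst₂)
open import Relation.Nullary using (¬_; Dec; _×-dec_; _⊎-dec_; _→-dec_)
open import Relation.Nullary.Decidable using (map′)
open import Relation.Unary using (Decidable)

-- The real numbers are the intended instance.  Neither equality nor the
-- order is assumed decidable, so that constructive reals qualify as well;
-- accordingly x ≤ y is the negation of y < x, and x is invertible when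
-- it is apart from 0.

record OrderedField c ℓ₁ ℓ₂ ℓ₃ : Set (lsuc (c ⊔ ℓ₁ ⊔ ℓ₂ ⊔ ℓ₃)) where
  infix 4 _<_ _≤_
  field
    heytingField : HeytingField c ℓ₁ ℓ₂

  open HeytingField heytingField public
    renaming (refl to ≈-refl; sym to ≈-sym; trans to ≈-trans)

  field
    _<_                  : Rel Carrier ℓ₃
    isStrictPartialOrder : IsStrictPartialOrder _≈_ _<_
    #⇒<⊎>                : ∀ {x y} → x # y → x < y ⊎ y < x
    <⇒#                  : ∀ {x y} → x < y → x # y
    +-monoˡ-<            : ∀ {x y} z → x < y → x + z < y + z
    *-pos                : ∀ {x y} → 0# < x → 0# < y → 0# < x * y

  open IsStrictPartialOrder isStrictPartialOrder public
    using (<-respʳ-≈; <-respˡ-≈)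
    renaming (irrefl to <-irrefl; trans to <-trans; asym to <-asym)

  _≤_ : Rel Carrier ℓ₃
  x ≤ y = ¬ (y < x)

  commutativeRing : CommutativeRing c ℓ₁
  commutativeRing = record { isCommutativeRing = isCommutativeRing }

  open CommutativeRing commutativeRing public using (semiring; ring; +-commutativeMonoid)

  open import Algebra.Definitions.RawSemiring (Semiring.rawSemiring semiring) public
    using (_^_) renaming (_×_ to _×ℕ_)
  open import Algebra.Properties.CommutativeMonoid.Sum +-commutativeMonoid public
    using (sum⁺-syntax)

  fromℕ : ℕ → Carrier
  fromℕ n = n ×ℕ 1#

  -- #⇒invertible inverts x - 0#.
  inverse : ∀ {x} → x # 0# → Carrier
  inverse x#0 = proj₁ (#⇒invertible x#0)

  open import Algebra.Properties.Ring ring using (-1*x≈-x; -‿involutive; -0#≈0#)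

  1#0 : 1# # 0#
  1#0 = invertible⇒# (1# , eq , ≈-trans (*-comm _ _) eq)
    where
    eq : 1# * (1# - 0#) ≈ 1#
    eq = ≈-trans (*-identityˡ _) (≈-trans (+-congˡ -0#≈0#) (+-identityʳ _))

  0<1 : 0# < 1#
  0<1 with #⇒<⊎> 1#0
  ... | inj₂ 0<1 = 0<1
  ... | inj₁ 1<0 = <-respʳ-≈ (≈-trans (-1*x≈-x _) (-‿involutive 1#)) (*-pos 0<-1 0<-1)
    where
    0<-1 : 0# < - 1#
    0<-1 = <-respˡ-≈ (-‿inverseʳ 1#) (<-respʳ-≈ (+-identityˡ _) (+-monoˡ-< (- 1#) 1<0))

  0<fromℕ : ∀ n → 0# < fromℕ (suc n)
  0<fromℕ zero    = <-respʳ-≈ (≈-sym (+-identityʳ _)) 0<1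
  0<fromℕ (suc n) = <-trans (0<fromℕ n)
    (<-respˡ-≈ (+-identityˡ _) (+-monoˡ-< (fromℕ (suc n)) 0<1))

  fromℕ#0 : ∀ n .{{_ : NonZero n}} → fromℕ n # 0#
  fromℕ#0 (suc n) = #-sym (<⇒# (0<fromℕ n))

  infixl 7 _÷ℕ_
  _÷ℕ_ : Carrier → (n : ℕ) .{{_ : NonZero n}} → Carrier
  x ÷ℕ n = x * inverse (fromℕ#0 n)

-- The unordered pairs of distinct vertices, each listed once as (i , j)
-- with i < j.

pairs : ∀ n → List (Fin n × Fin n)
pairs n = filter (uncurry Fin._<?_) (cartesianProduct (allFin n) (allFin n))

EdgeSet : ℕ → Set
EdgeSet n = Subset (length (pairs n))

record Graph (n : ℕ) : Set where
  constructor graph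
  field
    edges : EdgeSet n

open Graph public

numEdges : ∀ {n} → Graph n → ℕ
numEdges G = ∣ edges G ∣

complete : ∀ n → Graph n
complete n = graph ⊤

endpoints : ∀ {n} → Fin (length (pairs n)) → Fin n × Fin n
endpoints {n} = lookup (pairs n)

Adjacent : ∀ {n} → Graph n → Fin n → Fin n → Set
Adjacent G i j = ∃[ e ] e ∈ edges G × (endpoints e ≡ (i , j) ⊎ endpoints e ≡ (j , i))

EveryVertexOnEdge : ∀ {n} → Graph n → Set
EveryVertexOnEdge G = ∀ i → ∃[ j ] Adjacent G i j

-- A subgraph of the complete graph; its edges, viewed as a graph on all of
-- Fin n, must have their endpoints among its vertices to be a subgraph.

record Subgraph (n : ℕ) : Set where
  constructor subgraph
  field
    vertices : Subset n
    graphOn  : Graph n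

open Subgraph public

IsSubgraphOf : ∀ {n} → Subgraph n → Graph n → Set
IsSubgraphOf S G =
    edges (graphOn S) ⊆ edges G
  × (∀ e → e ∈ edges (graphOn S) →
       proj₁ (endpoints e) ∈ vertices S × proj₂ (endpoints e) ∈ vertices S)

record IsIsomorphism {v n} (H : Graph v) (S : Subgraph n) (f : Fin v → Fin n) : Set where
  field
    injective  : ∀ i j → f i ≡ f j → i ≡ j
    into       : ∀ i → f i ∈ vertices S
    onto       : ∀ x → x ∈ vertices S → ∃[ i ] f i ≡ x
    preserves  : ∀ i j → Adjacent H i j → Adjacent (graphOn S) (f i) (f j)
    reflects   : ∀ i j → Adjacent (graphOn S) (f i) (f j) → Adjacent H i j

IsAutomorphism : ∀ {v} → Graph v → (Fin v → Fin v) → Set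
IsAutomorphism H = IsIsomorphism H (subgraph ⊤ H)

IsCopyIn : ∀ {v n} → Graph v → Graph n → Subgraph n → Set
IsCopyIn H G S = IsSubgraphOf S G × ∃ (IsIsomorphism H S)

adjacent? : ∀ {n} (G : Graph n) i j → Dec (Adjacent G i j)
adjacent? G i j = Fin.any? λ e → (e ∈? edges G) ×-dec
  (≡-dec Fin._≟_ Fin._≟_ _ _ ⊎-dec ≡-dec Fin._≟_ Fin._≟_ _ _)

isSubgraphOf? : ∀ {n} (S : Subgraph n) G → Dec (IsSubgraphOf S G)
isSubgraphOf? S G = (_ ⊆? _) ×-dec
  Fin.all? λ e → (e ∈? _) →-dec ((_ ∈? _) ×-dec (_ ∈? _))

isIsomorphism-resp : ∀ {v n} {H : Graph v} {S : Subgraph n} {f g} →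
  f ≗ g → IsIsomorphism H S f → IsIsomorphism H S g
isIsomorphism-resp {H = H} {S} {f} {g} f≗g iso = record
  { injective = λ i j eq → injective i j (trans (f≗g i) (trans eq (sym (f≗g j))))
  ; into      = λ i → subst (_∈ vertices S) (f≗g i) (into i)
  ; onto      = λ x x∈ → let i , eq = onto x x∈ in i , trans (sym (f≗g i)) eq
  ; preserves = λ i j a → subst₂ (Adjacent (graphOn S)) (f≗g i) (f≗g j) (preserves i j a)
  ; reflects  = λ i j a → reflects i j
      (subst₂ (Adjacent (graphOn S)) (sym (f≗g i)) (sym (f≗g j)) a)
  }
  where open IsIsomorphism iso

isIsomorphism? : ∀ {v n} (H : Graph v) (S : Subgraph n) → Decidable (IsIsomorphism H S)
isIsomorphism? H S f = map′
  (λ (a , b , c , d , e) → record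
    { injective = a ; into = b ; onto = c ; preserves = d ; reflects = e })
  (λ iso → let open IsIsomorphism iso in injective , into , onto , preserves , reflects)
  (     (Fin.all? λ i → Fin.all? λ j → (f i Fin.≟ f j) →-dec (i Fin.≟ j))
  ×-dec (Fin.all? λ i → f i ∈? vertices S)
  ×-dec (Fin.all? λ x → (x ∈? vertices S) →-dec Fin.any? λ i → f i Fin.≟ x)
  ×-dec (Fin.all? λ i → Fin.all? λ j →
           adjacent? H i j →-dec adjacent? (graphOn S) (f i) (f j))
  ×-dec (Fin.all? λ i → Fin.all? λ j →
           adjacent? (graphOn S) (f i) (f j) →-dec adjacent? H i j))

-- finToFun enumerates all functions Fin v → Fin n, each exactly once up to
-- pointwise equality.

isCopyIn? : ∀ {v n} (H : Graph v) (G : Graph n) → Decidable (IsCopyIn H G)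
isCopyIn? {v} {n} H G S = isSubgraphOf? S G ×-dec map′
  (λ (k , iso) → finToFun k , iso)
  (λ (f , iso) → funToFin f ,
     isIsomorphism-resp (λ i → sym (Fin.finToFun-funToFin f i)) iso)
  (Fin.any? λ (k : Fin (n ℕ.^ v)) → isIsomorphism? H S (finToFun k))

subsets : ∀ n → List (Subset n)
subsets zero    = [] ∷ []
subsets (suc n) = map (outside ∷_) (subsets n) ++ map (inside ∷_) (subsets n)

graphs : ∀ n → List (Graph n)
graphs n = map graph (subsets (length (pairs n)))

subgraphs : ∀ n → List (Subgraph n)
subgraphs n = cartesianProductWith subgraph (subsets n) (graphs n)

copiesIn : ∀ {v n} → Graph v → Graph n → List (Subgraph n)
copiesIn {n = n} H G = filter (isCopyIn? H G) (subgraphs n)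

numCopies : ∀ {v n} → Graph v → Graph n → ℕ
numCopies H G = length (copiesIn H G)

numSharedEdges : ∀ {n} → Subgraph n → Subgraph n → ℕ
numSharedEdges S S′ = ∣ edges (graphOn S) ∩ edges (graphOn S′) ∣

-- The pairs are ordered, and the two copies may coincide.

numPairs : ∀ {v} → Graph v → ℕ → ℕ → ℕ
numPairs H n k = length (filter (λ (S , S′) → numSharedEdges S S′ ℕ.≟ k)
  (cartesianProduct (copiesIn H (complete n)) (copiesIn H (complete n))))

automorphisms : ∀ {v} → Graph v → List (Fin (v ℕ.^ v))
automorphisms {v} H =
  filter (λ k → isIsomorphism? H (subgraph ⊤ H) (finToFun k)) (allFin (v ℕ.^ v))

∣Aut_∣ : ∀ {v} → Graph v → ℕ
∣Aut H ∣ = length (automorphisms H)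

∣Aut∣-nonZero : ∀ {v} (H : Graph v) → NonZero ∣Aut H ∣
∣Aut∣-nonZero {v} H = ∈⇒nonZero
  (∈-filter⁺ (λ k → isIsomorphism? H (subgraph ⊤ H) (finToFun k))
    (∈-allFin (funToFin {v} {v} id))
    (isIsomorphism-resp (λ i → sym (Fin.finToFun-funToFin id i)) id-iso))
  where
  id-iso : IsAutomorphism H id
  id-iso = record
    { injective = λ _ _ → id
    ; into      = λ _ → ∈⊤
    ; onto      = λ x _ → x , refl
    ; preserves = λ _ _ → id
    ; reflects  = λ _ _ → id
    }

  ∈⇒nonZero : ∀ {a} {A : Set a} {x : A} {xs} → x ∈ᴸ xs → NonZero (length xs)
  ∈⇒nonZero (here _)  = _
  ∈⇒nonZero (there _) = _

module RandomGraph {c ℓ₁ ℓ₂ ℓ₃} (F : OrderedField c ℓ₁ ℓ₂ ℓ₃) where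
  open OrderedField F

  RandomVariable : ℕ → Set c
  RandomVariable n = Graph n → Carrier

  prob : ∀ {n} → Carrier → Graph n → Carrier
  prob p G = p ^ ∣ edges G ∣ * (1# - p) ^ ∣ ∁ (edges G) ∣

  𝔼 : ∀ n → Carrier → RandomVariable n → Carrier
  𝔼 n p X = foldr _+_ 0# (map (λ G → prob p G * X G) (graphs n))

  Cov : ∀ n → Carrier → RandomVariable n → RandomVariable n → Carrier
  Cov n p X Y = 𝔼 n p λ G → (X G - 𝔼 n p X) * (Y G - 𝔼 n p Y)

  Var : ∀ n → Carrier → RandomVariable n → Carrier
  Var n p X = 𝔼 n p λ G → (X G - 𝔼 n p X) ^ 2

  T : ∀ {v} → Graph v → ∀ {n} → RandomVariable n
  T H G = fromℕ (numCopies H G)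

  Tₑ : ∀ {n} → RandomVariable n
  Tₑ G = fromℕ (numEdges G)

  ResVar : ∀ n p → Var n p Tₑ # 0# → RandomVariable n → Carrier
  ResVar n p Var#0 X = Var n p X - Cov n p X Tₑ ^ 2 * inverse Var#0

  infixl 7 _÷∣Aut_∣
  _÷∣Aut_∣ : Carrier → ∀ {v} → Graph v → Carrier
  x ÷∣Aut H ∣ = x ÷ℕ ∣Aut H ∣
    where instance _ = ∣Aut∣-nonZero H

  -- n P v is the falling factorial n (n - 1) ⋯ (n + 1 - v).

  c[_] : ∀ {v} → Graph v → ℕ → Carrier
  c[_] {v} H n = fromℕ (n P v) ÷∣Aut H ∣

  C[_] : ∀ {v} → Graph v → ℕ → ℕ → Carrier
  C[ H ] n k = fromℕ (numPairs H n k)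

  -- f n = O(n ^ d) as n → ∞, for f defined on n ≥ v.

  O[n^_] : ℕ → ∀ {v} → (∀ n → v ℕ.≤ n → Carrier) → Set (c ⊔ ℓ₃)
  O[n^ d ] {v} f = ∃[ K ] ∃[ N ] ∀ n (v≤n : v ℕ.≤ n) → N ℕ.≤ n →
    - (K * fromℕ n ^ d) ≤ f n v≤n × f n v≤n ≤ K * fromℕ n ^ d

{-# OPTIONS --safe #-}

-- T_H is the sum of the indicators of the copies of H in Kₙ, and T_e the sum of the indicators of
-- the edges.  The indicators of S and S′ have covariance p^|S ∪ S′| − p^(|S| + |S′|), so Var T_H is
-- obtained by sorting the pairs of copies by the number k of shared edges, Cov (T_H , T_e) equals
-- c ℓ (p^ℓ − p^(ℓ+1)), and Var T_e equals N (p − p²) for the number N of edges of Kₙ.  As Kₙ is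
-- edge transitive, all its edges lie in the same number c ℓ / N of copies, whence
-- Σ k C_k = (c ℓ)² / N; this turns the explained variance into Σ k C_k (p^(2ℓ−1) − p^(2ℓ)) and
-- cancels the term k = 1.  The orders of magnitude follow since copies sharing at least 1, 2 or 4
-- edges share at least 2, 3 or 4 vertices.  Copies are counted through injections of the vertices:
-- each copy is the image of exactly |Aut H| of them.

module Submission where

open import Defs
open import Level using (Level)
open import Algebra.Bundles using (CommutativeSemiring; CommutativeRing; Semiring)
import Algebra.Solver.Ring as RingSolver
open import Algebra.Solver.Ring.AlmostCommutativeRing using (fromCommutativeRing; _-Raw-AlmostCommutative⟶_)
open import Data.Bool.Base using (if_then_else_; true; false)
open import Data.Fin.Base as Fin using (Fin; zero; suc; toℕ; finToFun; funToFin)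
import Data.Fin.Permutation.Components as Fin
import Data.Fin.Properties as Fin
open import Data.Fin.Subset using (Subset; inside; outside; _∈_; _∩_; _∪_; ∁; ⊤; ⊥; ∣_∣; ⁅_⁆)
open import Data.Fin.Subset.Properties using (_∈?_; _⊆?_; ∈⊤; ⊆-antisym; x∈p∩q⁺; x∈p∩q⁻; p∩q⊆q; ∣p∩q∣≤∣p∣; x∈p∪q⁻; p⊆p∪q; q⊆p∪q; ⊥⊆; ∣⊥∣≡0; Empty-unique; x∈⁅x⁆; x∈⁅y⁆⇒x≡y; ∣⁅x⁆∣≡1)
import Data.Integer.Base as ℤ
import Data.Integer.Properties as ℤ
open import Data.List.Base using (List; []; _∷_; _++_; map; filter; foldr; length; lookup; tabulate; allFin; cartesianProduct; cartesianProductWith)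
open import Data.List.Properties using (length-++; length-map; map-tabulate; length-tabulate; filter-all)
import Data.List.Properties as List
open import Data.Unit.Base using (tt) renaming (⊤ to Unit)
open import Data.List.Membership.Propositional using () renaming (_∈_ to _∈ᴸ_)
open import Data.List.Membership.Propositional.Properties using (∈-∃++; ∈-++⁻; ∈-++⁺ˡ; ∈-++⁺ʳ; ∈-filter⁺; ∈-filter⁻; ∈-allFin; ∈-lookup; ∈-tabulate⁺; ∈-tabulate⁻; ∈-map⁺; ∈-map⁻; ∈-cartesianProductWith⁺; ∈-cartesianProduct⁺; ∈-cartesianProduct⁻)
open import Data.List.Relation.Unary.All as All using (All)
open import Data.List.Relation.Unary.Any as Any using (here; there)
open import Data.List.Relation.Unary.Any.Properties using (lookup-index)
open import Data.List.Relation.Unary.AllPairs using ([]; _∷_)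
open import Data.List.Relation.Unary.Unique.Propositional using (Unique)
import Data.List.Relation.Unary.Unique.Propositional.Properties as Unique
import Data.Maybe.Base as Maybe
open import Data.Nat.Base as ℕ using (ℕ; zero; suc; _∸_)
import Data.Nat.Properties as ℕ
open import Data.Nat.Solver using (module +-*-Solver)
open import Data.Nat.Combinatorics using (_P_)
open import Data.Nat.Combinatorics.Base using (_P′_)
open import Data.Product.Base using (∃; ∃-syntax; Σ-syntax; _×_; _,_; proj₁; proj₂; uncurry)
open import Data.Product.Properties using (,-injectiveˡ; ,-injectiveʳ; ≡-dec)
open import Data.Sum.Base using (_⊎_; inj₁; inj₂; [_,_]′; swap)
import Data.Sign.Base as Sign
open import Data.Vec.Base as Vec using (Vec; []; _∷_)
import Data.Vec.Properties as Vec
open import Function.Base using (id; _∘_)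
open import Relation.Binary.PropositionalEquality using (_≡_; _≢_; _≗_; refl; sym; trans; cong; cong₂; subst; subst₂; module ≡-Reasoning)
open import Relation.Binary.Definitions using (tri<; tri≈; tri>)
open import Relation.Nullary using (¬_; Dec; yes; no; does; contradiction; _×-dec_; _→-dec_; _⊎-dec_)
open import Relation.Nullary.Decidable using (dec-true; dec-false; dec⇒maybe)
open import Relation.Unary using (Pred; Decidable)

-- The shape of the residual variance comes from counting vertices: `w` vertices carry at most
-- `w (w - 1) / 2` edges, so two or three shared edges fit on three shared vertices, while a fourth
-- edge forces a fourth vertex. Each shared vertex costs a factor `n` against the `n ^ (2 v)` pairs
-- of vertex maps. With the terms `k = 0` and `k = 1` gone, `C_2` and `C_3` are thus at most of
-- order `n ^ (2 v - 3)`, and everything later is error. Two obstacles determine the form of the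
-- argument. Functions cannot be compared by `≡`, so embeddings are vectors, and bijections become
-- relations that are total and injective in both directions. Counts stay in ℕ, where an identity is
-- multiplied by `∣Aut H ∣` or by a power of `n` instead of being divided. Moreover the order of the
-- field is not decidable: neither trichotomy nor absolute values are available, so an O-term is a
-- pair of inequalities and all sign arguments go through apartness.

private variable
  a b c p r : Level
  A : Set a
  B : Set b
  C : Set c
  k m n v : ℕ

-- Counting in lists

module _ {A : Set a} {B : Set b} (R : A → B → Set r)
  (R-injective : ∀ {x x′ y} → R x y → R x′ y → x ≡ x′) where

  -- Match `x` with some `y` and delete that `y`; no later element can have been matched with it,
  -- since it would equal `x`. A relation rather than a function allows one relation and its
  -- converse to give both halves of a bijection.
  length-≤-by-relation : ∀ {xs ys} → Unique xs →
    (∀ {x} → x ∈ᴸ xs → ∃ λ y → y ∈ᴸ ys × R x y) → length xs ℕ.≤ length ys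
  length-≤-by-relation []                      _     = ℕ.z≤n
  length-≤-by-relation {x ∷ xs} (x∉xs ∷ xs!) total
    with y , y∈ys , Rxy ← total (here refl)
    with ys₁ , ys₂ , refl ← ∈-∃++ y∈ys = begin
    suc (length xs)            ≤⟨ ℕ.s≤s (length-≤-by-relation xs! total′) ⟩
    suc (length (ys₁ ++ ys₂))  ≡⟨ cong suc (length-++ ys₁) ⟩
    suc (length ys₁ ℕ.+ length ys₂) ≡⟨ ℕ.+-suc (length ys₁) _ ⟨
    length ys₁ ℕ.+ length (y ∷ ys₂) ≡⟨ length-++ ys₁ ⟨
    length (ys₁ ++ y ∷ ys₂)    ∎
    where
    open ℕ.≤-Reasoning
    total′ : ∀ {x′} → x′ ∈ᴸ xs → ∃ λ y′ → y′ ∈ᴸ ys₁ ++ ys₂ × R x′ y′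
    total′ x′∈xs with total (there x′∈xs)
    ... | y′ , y′∈ys , Rx′y′ with ∈-++⁻ ys₁ y′∈ys
    ...   | inj₁ y′∈ys₁         = y′ , ∈-++⁺ˡ y′∈ys₁ , Rx′y′
    ...   | inj₂ (here refl)    = contradiction (R-injective Rxy Rx′y′) (All.lookup x∉xs x′∈xs)
    ...   | inj₂ (there y′∈ys₂) = y′ , ∈-++⁺ʳ ys₁ y′∈ys₂ , Rx′y′

length-≤-by-⊆ : {xs ys : List A} → Unique xs → (∀ {x} → x ∈ᴸ xs → x ∈ᴸ ys) →
  length xs ℕ.≤ length ys
length-≤-by-⊆ xs! xs⊆ys =
  length-≤-by-relation _≡_ (λ x≡y x′≡y → trans x≡y (sym x′≡y)) xs! λ x∈xs → _ , xs⊆ys x∈xs , refl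

-- Finite sums over lists

module ListSum {c ℓ} (R : CommutativeSemiring c ℓ) where
  open CommutativeSemiring R renaming (refl to ≈-refl; sym to ≈-sym; trans to ≈-trans)
  open import Algebra.Definitions.RawSemiring rawSemiring using () renaming (_×_ to _×ℕ_)
  open import Algebra.Properties.CommutativeSemigroup +-commutativeSemigroup using (interchange)
  open import Relation.Binary.Reasoning.Setoid setoid

  ∑ : List A → (A → Carrier) → Carrier
  ∑ xs f = foldr _+_ 0# (map f xs)

  𝟙 : ∀ {p} {P : Set p} → Dec P → Carrier
  𝟙 P? = if does P? then 1# else 0#

  ∑-cong-∈ : ∀ (xs : List A) {f g} → (∀ {x} → x ∈ᴸ xs → f x ≈ g x) → ∑ xs f ≈ ∑ xs g
  ∑-cong-∈ []       _   = ≈-refl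
  ∑-cong-∈ (x ∷ xs) f≈g = +-cong (f≈g (here refl)) (∑-cong-∈ xs (f≈g ∘ there))

  ∑-cong : ∀ (xs : List A) {f g} → (∀ x → f x ≈ g x) → ∑ xs f ≈ ∑ xs g
  ∑-cong xs f≈g = ∑-cong-∈ xs λ _ → f≈g _

  ∑-zero : ∀ (xs : List A) → ∑ xs (λ _ → 0#) ≈ 0#
  ∑-zero []       = ≈-refl
  ∑-zero (x ∷ xs) = ≈-trans (+-identityˡ _) (∑-zero xs)

  ∑-const : ∀ (xs : List A) x → ∑ xs (λ _ → x) ≈ length xs ×ℕ x
  ∑-const []       x = ≈-refl
  ∑-const (_ ∷ xs) x = +-congˡ (∑-const xs x)

  ∑-+ : ∀ (xs : List A) f g → ∑ xs (λ x → f x + g x) ≈ ∑ xs f + ∑ xs g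
  ∑-+ []       f g = ≈-sym (+-identityˡ 0#)
  ∑-+ (x ∷ xs) f g = ≈-trans (+-congˡ (∑-+ xs f g)) (interchange _ _ _ _)

  ∑-*ˡ : ∀ (xs : List A) y f → ∑ xs (λ x → y * f x) ≈ y * ∑ xs f
  ∑-*ˡ []       y f = ≈-sym (zeroʳ y)
  ∑-*ˡ (x ∷ xs) y f = ≈-trans (+-congˡ (∑-*ˡ xs y f)) (≈-sym (distribˡ y _ _))

  ∑-*ʳ : ∀ (xs : List A) y f → ∑ xs (λ x → f x * y) ≈ ∑ xs f * y
  ∑-*ʳ xs y f = ≈-trans (∑-cong xs λ _ → *-comm _ _) (≈-trans (∑-*ˡ xs y f) (*-comm _ _))

  ∑-swap : ∀ (xs : List A) (ys : List B) (f : A → B → Carrier) →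
    ∑ xs (λ x → ∑ ys (f x)) ≈ ∑ ys (λ y → ∑ xs λ x → f x y)
  ∑-swap []       ys f = ≈-sym (∑-zero ys)
  ∑-swap (x ∷ xs) ys f = ≈-trans (+-congˡ (∑-swap xs ys f)) (≈-sym (∑-+ ys _ _))

  ∑-*-∑ : ∀ (xs : List A) (ys : List B) f g →
    ∑ xs f * ∑ ys g ≈ ∑ xs (λ x → ∑ ys λ y → f x * g y)
  ∑-*-∑ xs ys f g = ≈-trans (≈-sym (∑-*ʳ xs _ f)) (∑-cong xs λ x → ≈-sym (∑-*ˡ ys _ g))

  ∑-++ : ∀ (xs ys : List A) f → ∑ (xs ++ ys) f ≈ ∑ xs f + ∑ ys f
  ∑-++ []       ys f = ≈-sym (+-identityˡ _)
  ∑-++ (x ∷ xs) ys f = ≈-trans (+-congˡ (∑-++ xs ys f)) (≈-sym (+-assoc _ _ _))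

  ∑-map : ∀ (h : A → B) xs f → ∑ (map h xs) f ≈ ∑ xs (f ∘ h)
  ∑-map h []       f = ≈-refl
  ∑-map h (x ∷ xs) f = +-congˡ (∑-map h xs f)

  ∑-cartesianProductWith : ∀ (h : A → B → C) xs ys f →
    ∑ (cartesianProductWith h xs ys) f ≈ ∑ xs (λ x → ∑ ys λ y → f (h x y))
  ∑-cartesianProductWith h []       ys f = ≈-refl
  ∑-cartesianProductWith h (x ∷ xs) ys f = ≈-trans (∑-++ (map (h x) ys) _ f)
    (+-cong (∑-map (h x) ys f) (∑-cartesianProductWith h xs ys f))

  ∑-filter : ∀ {p} {P : Pred A p} (P? : Decidable P) xs f →
    ∑ (filter P? xs) f ≈ ∑ xs (λ x → 𝟙 (P? x) * f x)
  ∑-filter P? []       f = ≈-refl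
  ∑-filter P? (x ∷ xs) f with does (P? x)
  ... | true  = +-cong (≈-sym (*-identityˡ _)) (∑-filter P? xs f)
  ... | false = ≈-trans (∑-filter P? xs f)
    (≈-sym (≈-trans (+-congʳ (zeroˡ _)) (+-identityˡ _)))

  length-filter : ∀ {p} {P : Pred A p} (P? : Decidable P) xs →
    length (filter P? xs) ×ℕ 1# ≈ ∑ xs (𝟙 ∘ P?)
  length-filter P? xs = begin
    length (filter P? xs) ×ℕ 1#   ≈⟨ ∑-const (filter P? xs) 1# ⟨
    ∑ (filter P? xs) (λ _ → 1#)   ≈⟨ ∑-filter P? xs _ ⟩
    ∑ xs (λ x → 𝟙 (P? x) * 1#)    ≈⟨ ∑-cong xs (λ _ → *-identityʳ _) ⟩
    ∑ xs (𝟙 ∘ P?)                 ∎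

  𝟙-cong : ∀ {p q} {P : Set p} {Q : Set q} (P? : Dec P) (Q? : Dec Q) →
    (P → Q) → (Q → P) → 𝟙 P? ≡ 𝟙 Q?
  𝟙-cong (yes _) (yes _) _   _   = refl
  𝟙-cong (no _)  (no _)  _   _   = refl
  𝟙-cong (yes p) (no ¬q) p⇒q _   = contradiction (p⇒q p) ¬q
  𝟙-cong (no ¬p) (yes q) _   q⇒p = contradiction (q⇒p q) ¬p

module ∑ℕ where
  open ListSum ℕ.+-*-commutativeSemiring public
  open import Algebra.Definitions.RawSemiring (CommutativeSemiring.rawSemiring ℕ.+-*-commutativeSemiring)
    using () renaming (_×_ to _×ℕ_)

  ×ℕ≡* : ∀ m n → m ×ℕ n ≡ m ℕ.* n
  ×ℕ≡* zero    n = refl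
  ×ℕ≡* (suc m) n = cong (n ℕ.+_) (×ℕ≡* m n)

  ∑-const′ : ∀ (xs : List A) n → ∑ xs (λ _ → n) ≡ length xs ℕ.* n
  ∑-const′ xs n = trans (∑-const xs n) (×ℕ≡* (length xs) n)

  length-filter′ : ∀ {p} {P : Pred A p} (P? : Decidable P) xs →
    length (filter P? xs) ≡ ∑ xs (𝟙 ∘ P?)
  length-filter′ P? xs =
    trans (sym (trans (×ℕ≡* (length (filter P? xs)) 1) (ℕ.*-identityʳ _))) (length-filter P? xs)

  ∑-mono-∈ : ∀ (xs : List A) {f g} → (∀ {x} → x ∈ᴸ xs → f x ℕ.≤ g x) → ∑ xs f ℕ.≤ ∑ xs g
  ∑-mono-∈ []       _   = ℕ.z≤n
  ∑-mono-∈ (x ∷ xs) f≤g = ℕ.+-mono-≤ (f≤g (here refl)) (∑-mono-∈ xs (f≤g ∘ there))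

  double-counting : ∀ {p} {R : A → B → Set p} (R? : ∀ x y → Dec (R x y)) xs ys →
    ∑ xs (λ x → length (filter (R? x) ys)) ≡ ∑ ys (λ y → length (filter (λ x → R? x y) xs))
  double-counting R? xs ys = trans (∑-cong xs λ x → length-filter′ (R? x) ys)
    (trans (∑-swap xs ys λ x y → 𝟙 (R? x y)) (sym (∑-cong ys λ y → length-filter′ (λ x → R? x y) xs)))

length-singleton : {x : A} {xs : List A} → Unique xs → x ∈ᴸ xs → (∀ {y} → y ∈ᴸ xs → y ≡ x) → length xs ≡ 1
length-singleton {x = x} xs! x∈xs eq = ℕ.≤-antisym
  (length-≤-by-⊆ {ys = x ∷ []} xs! (here ∘ eq))
  (length-≤-by-⊆ {xs = x ∷ []} (All.[] ∷ []) λ { (here refl) → x∈xs })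

-- Subsets, vectors and injections

module _ where
  open ∑ℕ

  elements : Subset n → List (Fin n)
  elements A = filter (_∈? A) (allFin _)

  ∣p∣≡∑ : ∀ (A : Subset n) → ∣ A ∣ ≡ ∑ (allFin n) λ x → 𝟙 (x ∈? A)
  ∣p∣≡∑         []            = refl
  ∣p∣≡∑ {suc n} (outside ∷ A) rewrite sym (map-tabulate {n = n} id Fin.suc) =
    trans (∣p∣≡∑ A) (sym (∑-map suc (allFin n) λ x → 𝟙 (x ∈? outside ∷ A)))
  ∣p∣≡∑ {suc n} (inside ∷ A)  rewrite sym (map-tabulate {n = n} id Fin.suc) =
    cong suc (trans (∣p∣≡∑ A) (sym (∑-map suc (allFin n) λ x → 𝟙 (x ∈? inside ∷ A))))

  length-elements : ∀ (A : Subset n) → length (elements A) ≡ ∣ A ∣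
  length-elements A = trans (length-filter′ (_∈? A) (allFin _)) (sym (∣p∣≡∑ A))

  length-filter-complement : ∀ {p q} {P : Pred A p} {Q : Pred A q} (P? : Decidable P) (Q? : Decidable Q) →
    (∀ {x} → P x → ¬ Q x) → (∀ {x} → ¬ P x → Q x) →
    ∀ xs → length (filter P? xs) ℕ.+ length (filter Q? xs) ≡ length xs
  length-filter-complement P? Q? P⇒¬Q ¬P⇒Q [] = refl
  length-filter-complement P? Q? P⇒¬Q ¬P⇒Q (x ∷ xs)
    with P? x | Q? x | length-filter-complement P? Q? P⇒¬Q ¬P⇒Q xs
  ... | yes Px | yes Qx | _  = contradiction Qx (P⇒¬Q Px)
  ... | yes _  | no _   | eq = cong suc eq
  ... | no _   | yes _  | eq = trans (ℕ.+-suc _ _) (cong suc eq)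
  ... | no ¬Px | no ¬Qx | _  = contradiction (¬P⇒Q ¬Px) ¬Qx

  -- Vectors represent maps out of `Fin k` because pointwise equal vectors are equal, which makes a
  -- duplicate-free enumeration meaningful.
  vecs : List A → ∀ k → List (Vec A k)
  vecs xs zero    = [] ∷ []
  vecs xs (suc k) = cartesianProductWith _∷_ xs (vecs xs k)

  vecs-unique : ∀ {xs : List A} → Unique xs → ∀ k → Unique (vecs xs k)
  vecs-unique xs! zero    = All.[] ∷ []
  vecs-unique xs! (suc k) =
    Unique.cartesianProductWith⁺ _∷_ Vec.∷-injective xs! (vecs-unique xs! k)

  ∈-vecs : ∀ {xs : List A} → (∀ x → x ∈ᴸ xs) → ∀ (f : Vec A k) → f ∈ᴸ vecs xs k
  ∈-vecs all∈ []      = here refl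
  ∈-vecs all∈ (x ∷ f) = ∈-cartesianProductWith⁺ _∷_ (all∈ x) (∈-vecs all∈ f)

  length-vecs : ∀ (xs : List A) k → length (vecs xs k) ≡ length xs ℕ.^ k
  length-vecs xs zero    = refl
  length-vecs xs (suc k) = begin
    length (vecs xs (suc k))                  ≡⟨ ℕ.*-identityʳ _ ⟨
    length (vecs xs (suc k)) ℕ.* 1            ≡⟨ ∑-const′ (vecs xs (suc k)) 1 ⟨
    ∑ (vecs xs (suc k)) (λ _ → 1)             ≡⟨ ∑-cartesianProductWith _∷_ xs (vecs xs k) (λ _ → 1) ⟩
    ∑ xs (λ _ → ∑ (vecs xs k) λ _ → 1)        ≡⟨ ∑-const′ xs _ ⟩
    length xs ℕ.* ∑ (vecs xs k) (λ _ → 1)     ≡⟨ cong (length xs ℕ.*_) (∑-const′ (vecs xs k) 1) ⟩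
    length xs ℕ.* (length (vecs xs k) ℕ.* 1)  ≡⟨ cong (length xs ℕ.*_) (ℕ.*-identityʳ _) ⟩
    length xs ℕ.* length (vecs xs k)          ≡⟨ cong (length xs ℕ.*_) (length-vecs xs k) ⟩
    length xs ℕ.^ suc k                       ∎
    where open ≡-Reasoning

  values : Vec A k → List A
  values f = tabulate (Vec.lookup f)

  module _ {p} {P : Pred A p} (P? : Decidable P) (xs : List A) where

    private
      hits : Vec A k → ℕ
      hits f = length (filter P? (values f))

      count : ∀ m k → ℕ
      count m k = ∑ (vecs xs k) λ f → 𝟙 (m ℕ.≤? hits f)

      N ∣P∣ : ℕ
      N = length xs
      ∣P∣ = length (filter P? xs)

      -- Split on the first entry: if it satisfies `P`, only `m` further hits are needed. The second
      -- summand admits all `N` first entries, so that no complement of `P` has to be counted.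
      count-step : ∀ m k → count (suc m) (suc k) ℕ.≤ ∣P∣ ℕ.* count m k ℕ.+ N ℕ.* count (suc m) k
      count-step m k = begin
        count (suc m) (suc k)
          ≡⟨ ∑-cartesianProductWith _∷_ xs (vecs xs k) (λ f → 𝟙 (suc m ℕ.≤? hits f)) ⟩
        ∑ xs (λ x → ∑ (vecs xs k) λ f → 𝟙 (suc m ℕ.≤? hits (x ∷ f)))
          ≤⟨ ∑-mono-∈ xs (λ {x} _ → first-value x) ⟩
        ∑ xs (λ x → 𝟙 (P? x) ℕ.* count m k ℕ.+ count (suc m) k)
          ≡⟨ ∑-+ xs _ _ ⟩
        ∑ xs (λ x → 𝟙 (P? x) ℕ.* count m k) ℕ.+ ∑ xs (λ _ → count (suc m) k)
          ≡⟨ cong₂ ℕ._+_ (∑-*ʳ xs (count m k) (𝟙 ∘ P?)) (∑-const′ xs _) ⟩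
        ∑ xs (𝟙 ∘ P?) ℕ.* count m k ℕ.+ N ℕ.* count (suc m) k
          ≡⟨ cong (λ z → z ℕ.* count m k ℕ.+ N ℕ.* count (suc m) k) (length-filter′ P? xs) ⟨
        ∣P∣ ℕ.* count m k ℕ.+ N ℕ.* count (suc m) k ∎
        where
        open ℕ.≤-Reasoning
        first-value : ∀ x → ∑ (vecs xs k) (λ f → 𝟙 (suc m ℕ.≤? hits (x ∷ f))) ℕ.≤
                            𝟙 (P? x) ℕ.* count m k ℕ.+ count (suc m) k
        first-value x with does (P? x)
        ... | false = ℕ.≤-refl
        ... | true  = ℕ.≤-trans (ℕ.≤-reflexive (trans
          (∑-cong (vecs xs k) λ f → 𝟙-cong (suc m ℕ.≤? suc (hits f)) (m ℕ.≤? hits f) ℕ.s≤s⁻¹ ℕ.s≤s)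
          (sym (ℕ.+-identityʳ _)))) (ℕ.m≤m+n _ _)

      count-zero : ∀ k → count 0 k ≡ N ℕ.^ k
      count-zero k = trans (∑-const′ (vecs xs k) 1)
        (trans (ℕ.*-identityʳ _) (length-vecs xs k))

      -- The constant is made for the induction: the two summands of `count-step` contribute `∣P∣`
      -- and `1` to one further factor `suc ∣P∣`, in place of binomial coefficients. The power
      -- `N ^ m` stays on the left so that `m > k` causes no truncated exponent.
      count-bound : ∀ m k → count m k ℕ.* N ℕ.^ m ℕ.≤ suc ∣P∣ ℕ.^ k ℕ.* N ℕ.^ k
      count-bound zero    k       = begin
        count 0 k ℕ.* 1          ≡⟨ trans (ℕ.*-identityʳ _) (count-zero k) ⟩
        N ℕ.^ k                  ≤⟨ ℕ.m≤n*m (N ℕ.^ k) (suc ∣P∣ ℕ.^ k) {{ℕ.m^n≢0 (suc ∣P∣) k}} ⟩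
        suc ∣P∣ ℕ.^ k ℕ.* N ℕ.^ k  ∎
        where open ℕ.≤-Reasoning
      count-bound (suc m) zero    = ℕ.z≤n
      count-bound (suc m) (suc k) = begin
        count (suc m) (suc k) ℕ.* N ℕ.^ suc m
          ≤⟨ ℕ.*-monoˡ-≤ (N ℕ.^ suc m) (count-step m k) ⟩
        (∣P∣ ℕ.* count m k ℕ.+ N ℕ.* count (suc m) k) ℕ.* N ℕ.^ suc m
          ≡⟨ solve 5 (λ b F G N Y → (b :* F :+ N :* G) :* (N :* Y) := b :* N :* (F :* Y) :+ N :* (G :* (N :* Y)))
               refl ∣P∣ (count m k) (count (suc m) k) N (N ℕ.^ m) ⟩
        ∣P∣ ℕ.* N ℕ.* (count m k ℕ.* N ℕ.^ m) ℕ.+ N ℕ.* (count (suc m) k ℕ.* N ℕ.^ suc m)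
          ≤⟨ ℕ.+-mono-≤ (ℕ.*-monoʳ-≤ (∣P∣ ℕ.* N) (count-bound m k)) (ℕ.*-monoʳ-≤ N (count-bound (suc m) k)) ⟩
        ∣P∣ ℕ.* N ℕ.* (suc ∣P∣ ℕ.^ k ℕ.* N ℕ.^ k) ℕ.+ N ℕ.* (suc ∣P∣ ℕ.^ k ℕ.* N ℕ.^ k)
          ≡⟨ solve 4 (λ b N X Y → b :* N :* (X :* Y) :+ N :* (X :* Y) := (con 1 :+ b) :* X :* (N :* Y))
               refl ∣P∣ N (suc ∣P∣ ℕ.^ k) (N ℕ.^ k) ⟩
        suc ∣P∣ ℕ.^ suc k ℕ.* N ℕ.^ suc k ∎
        where
        open ℕ.≤-Reasoning
        open +-*-Solver

    vecs-with-hits-bound : ∀ m k →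
      length (filter (λ f → m ℕ.≤? length (filter P? (values f))) (vecs xs k)) ℕ.* length xs ℕ.^ m ℕ.≤
      suc (length (filter P? xs)) ℕ.^ k ℕ.* length xs ℕ.^ k
    vecs-with-hits-bound m k = subst (λ z → z ℕ.* N ℕ.^ m ℕ.≤ suc ∣P∣ ℕ.^ k ℕ.* N ℕ.^ k)
      (sym (length-filter′ (λ f → m ℕ.≤? hits f) (vecs xs k))) (count-bound m k)

  Injective : Vec (Fin n) k → Set
  Injective f = ∀ i j → Vec.lookup f i ≡ Vec.lookup f j → i ≡ j

  injective? : Decidable (Injective {n} {k})
  injective? f = Fin.all? λ i → Fin.all? λ j → (Vec.lookup f i Fin.≟ Vec.lookup f j) →-dec (i Fin.≟ j)

  values-unique : ∀ {f : Vec (Fin n) k} → Injective f → Unique (values f)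
  values-unique f-inj = Unique.tabulate⁺ (f-inj _ _)

  injective-tail : ∀ {x} {f : Vec (Fin n) k} → Injective (x ∷ f) → Injective f
  injective-tail inj i j eq = Fin.suc-injective (inj (suc i) (suc j) eq)

  injective-∷ : ∀ {x} {f : Vec (Fin n) k} → Injective f → (∀ i → Vec.lookup f i ≢ x) → Injective (x ∷ f)
  injective-∷ f-inj x∉f zero    zero    _  = refl
  injective-∷ f-inj x∉f zero    (suc j) eq = contradiction (sym eq) (x∉f j)
  injective-∷ f-inj x∉f (suc i) zero    eq = contradiction eq (x∉f i)
  injective-∷ f-inj x∉f (suc i) (suc j) eq = cong suc (f-inj i j eq)

  injections : ∀ n k → List (Vec (Fin n) k)
  injections n k = filter injective? (vecs (allFin n) k)

  injections-unique : ∀ n k → Unique (injections n k)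
  injections-unique n k = Unique.filter⁺ injective? (vecs-unique (Unique.allFin⁺ n) k)

  ∈-injections : ∀ {f : Vec (Fin n) k} → Injective f → f ∈ᴸ injections n k
  ∈-injections {f = f} = ∈-filter⁺ injective? (∈-vecs ∈-allFin f)

  injections⇒injective : ∀ {f} → f ∈ᴸ injections n k → Injective f
  injections⇒injective {n = n} {k} f∈ = proj₂ (∈-filter⁻ injective? {xs = vecs (allFin n) k} f∈)

  -- The `k` distinct values of `f` and the elements that extend `f` injectively partition `Fin n`.
  number-of-extensions : ∀ {f : Vec (Fin n) k} → Injective f →
    length (filter (λ x → injective? (x ∷ f)) (allFin n)) ≡ n ∸ k
  number-of-extensions {n} {k} {f} f-inj = begin
    E                  ≡⟨ ℕ.m+n∸m≡n V E ⟨
    V ℕ.+ E ∸ V        ≡⟨ cong₂ _∸_ (trans partition (length-tabulate {n = n} id)) V≡k ⟩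
    n ∸ k              ∎
    where
    open ≡-Reasoning
    hit? : ∀ x → Dec (∃ λ i → Vec.lookup f i ≡ x)
    hit? x = Fin.any? λ i → Vec.lookup f i Fin.≟ x
    V E : ℕ
    V = length (filter hit? (allFin n))
    E = length (filter (λ x → injective? (x ∷ f)) (allFin n))
    partition : V ℕ.+ E ≡ length (allFin n)
    partition = length-filter-complement hit? (λ x → injective? (x ∷ f))
      (λ (i , fi≡x) inj → Fin.0≢1+n (inj zero (suc i) (sym fi≡x)))
      (λ ∄i → injective-∷ f-inj λ i fi≡x → ∄i (i , fi≡x)) (allFin n)
    V≡k : V ≡ k
    V≡k = trans (ℕ.≤-antisym
      (length-≤-by-⊆ {ys = values f} (Unique.filter⁺ hit? (Unique.allFin⁺ n))
        λ x∈ → let i , fi≡x = proj₂ (∈-filter⁻ hit? {xs = allFin n} x∈)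
               in subst (_∈ᴸ values f) fi≡x (∈-tabulate⁺ i))
      (length-≤-by-⊆ (values-unique {f = f} f-inj)
        λ {x} x∈ → let i , x≡fi = ∈-tabulate⁻ x∈
                   in ∈-filter⁺ hit? (∈-allFin x) (i , sym x≡fi)))
      (length-tabulate (Vec.lookup f))

  length-injections : ∀ n k → length (injections n k) ≡ n P′ k
  length-injections n zero    = refl
  length-injections n (suc k) = begin
    length (injections n (suc k))
      ≡⟨ length-filter′ injective? (vecs (allFin n) (suc k)) ⟩
    ∑ (vecs (allFin n) (suc k)) (𝟙 ∘ injective?)
      ≡⟨ ∑-cartesianProductWith _∷_ (allFin n) (vecs (allFin n) k) _ ⟩
    ∑ (allFin n) (λ x → ∑ (vecs (allFin n) k) λ f → 𝟙 (injective? (x ∷ f)))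
      -- With the tail `f` fixed first, the number of admissible heads is the same for every
      -- injective `f`.
      ≡⟨ ∑-swap (allFin n) (vecs (allFin n) k) (λ x f → 𝟙 (injective? (x ∷ f))) ⟩
    ∑ (vecs (allFin n) k) (λ f → ∑ (allFin n) λ x → 𝟙 (injective? (x ∷ f)))
      ≡⟨ ∑-cong (vecs (allFin n) k) extensions ⟩
    ∑ (vecs (allFin n) k) (λ f → (n ∸ k) ℕ.* 𝟙 (injective? f))
      ≡⟨ ∑-*ˡ (vecs (allFin n) k) (n ∸ k) (𝟙 ∘ injective?) ⟩
    (n ∸ k) ℕ.* ∑ (vecs (allFin n) k) (𝟙 ∘ injective?)
      ≡⟨ cong ((n ∸ k) ℕ.*_) (length-filter′ injective? (vecs (allFin n) k)) ⟨
    (n ∸ k) ℕ.* length (injections n k)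
      ≡⟨ cong ((n ∸ k) ℕ.*_) (length-injections n k) ⟩
    n P′ suc k ∎
    where
    open ≡-Reasoning
    extensions : ∀ f → ∑ (allFin n) (λ x → 𝟙 (injective? (x ∷ f))) ≡ (n ∸ k) ℕ.* 𝟙 (injective? f)
    extensions f = by-cases (injective? f)
      where
      by-cases : (d : Dec (Injective f)) → ∑ (allFin n) (λ x → 𝟙 (injective? (x ∷ f))) ≡ (n ∸ k) ℕ.* 𝟙 d
      by-cases (yes f-inj) = trans (sym (length-filter′ (λ x → injective? (x ∷ f)) (allFin n)))
        (trans (number-of-extensions f-inj) (sym (ℕ.*-identityʳ _)))
      by-cases (no ¬f-inj) = trans
        (∑-cong (allFin n) λ x → 𝟙-cong (injective? (x ∷ f)) (no id) (λ inj → ¬f-inj (injective-tail inj)) λ ())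
        (trans (∑-zero (allFin n)) (sym (ℕ.*-zeroʳ (n ∸ k))))

-- Copies as images of injections

comprehension : ∀ {P : Pred (Fin n) p} → Decidable P → Subset n
comprehension P? = Vec.tabulate λ x → does (P? x)

∈-comprehension⁺ : ∀ {P : Pred (Fin n) p} (P? : Decidable P) {x} → P x → x ∈ comprehension P?
∈-comprehension⁺ P? {x} Px =
  Vec.lookup⇒[]= x _ (trans (Vec.lookup∘tabulate _ x) (dec-true (P? x) Px))

∈-comprehension⁻ : ∀ {P : Pred (Fin n) p} (P? : Decidable P) {x} → x ∈ comprehension P? → P x
∈-comprehension⁻ P? {x} x∈
  with P? x | trans (sym (Vec.lookup∘tabulate _ x)) (Vec.[]=⇒lookup x∈)
... | yes Px | _ = Px

lookup-injective : ∀ {xs : List A} → Unique xs → ∀ i j → lookup xs i ≡ lookup xs j → i ≡ j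
lookup-injective (_    ∷ _)   zero    zero    _  = refl
lookup-injective (x∉xs ∷ _)   zero    (suc j) eq = contradiction eq (All.lookup x∉xs (∈-lookup j))
lookup-injective (x∉xs ∷ _)   (suc i) zero    eq = contradiction (sym eq) (All.lookup x∉xs (∈-lookup i))
lookup-injective (_    ∷ xs!) (suc i) (suc j) eq = cong suc (lookup-injective xs! i j eq)

Vec-ext : {f g : Vec A n} → Vec.lookup f ≗ Vec.lookup g → f ≡ g
Vec-ext f≗g =
  trans (sym (Vec.tabulate∘lookup _)) (trans (Vec.tabulate-cong f≗g) (Vec.tabulate∘lookup _))

funToFin-cong : {f g : Fin m → Fin n} → f ≗ g → funToFin f ≡ funToFin g
funToFin-cong {zero}  f≗g = refl
funToFin-cong {suc m} f≗g = cong₂ Fin.combine (f≗g zero) (funToFin-cong (f≗g ∘ suc))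

finToFun-injective : ∀ {m n} {k l : Fin (n ℕ.^ m)} → finToFun {n} {m} k ≗ finToFun l → k ≡ l
finToFun-injective {m} {n} k≗l = trans (sym (Fin.funToFin-finToFin {m} {n} _))
  (trans (funToFin-cong k≗l) (Fin.funToFin-finToFin {m} {n} _))

subsets-unique : ∀ n → Unique (subsets n)
subsets-unique zero    = All.[] ∷ []
subsets-unique (suc n) = Unique.++⁺
  (Unique.map⁺ Vec.∷-injectiveʳ (subsets-unique n)) (Unique.map⁺ Vec.∷-injectiveʳ (subsets-unique n))
  λ (p∈out , p∈in) → case-disjoint (∈-map⁻ (outside ∷_) p∈out) (∈-map⁻ (inside ∷_) p∈in)
  where
  case-disjoint : ∀ {p} → ∃ (λ q → q ∈ᴸ subsets n × p ≡ outside ∷ q) →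
    ¬ ∃ (λ q → q ∈ᴸ subsets n × p ≡ inside ∷ q)
  case-disjoint (_ , _ , refl) (_ , _ , ())

∈-subsets : ∀ (p : Subset n) → p ∈ᴸ subsets n
∈-subsets []            = here refl
∈-subsets (outside ∷ p) = ∈-++⁺ˡ (∈-map⁺ (outside ∷_) (∈-subsets p))
∈-subsets (inside ∷ p)  = ∈-++⁺ʳ (map (outside ∷_) (subsets _)) (∈-map⁺ (inside ∷_) (∈-subsets p))

subgraphs-unique : ∀ n → Unique (subgraphs n)
subgraphs-unique n = Unique.cartesianProductWith⁺ subgraph (λ { refl → refl , refl })
  (subsets-unique n) (Unique.map⁺ (cong edges) (subsets-unique _))

∈-subgraphs : ∀ (S : Subgraph n) → S ∈ᴸ subgraphs n
∈-subgraphs S = ∈-cartesianProductWith⁺ subgraph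
  (∈-subsets (vertices S)) (∈-map⁺ graph (∈-subsets (edges (graphOn S))))

-- Edges, the vertices they join, and images of graphs

Edge : ℕ → Set
Edge n = Fin (length (pairs n))

Joins : Edge n → Fin n → Fin n → Set
Joins e i j = endpoints e ≡ (i , j) ⊎ endpoints e ≡ (j , i)

joins? : ∀ (e : Edge n) (i j : Fin n) → Dec (Joins e i j)
joins? e i j = ≡-dec Fin._≟_ Fin._≟_ _ _ ⊎-dec ≡-dec Fin._≟_ Fin._≟_ _ _

endpoints-< : ∀ (e : Edge n) → proj₁ (endpoints {n} e) Fin.< proj₂ (endpoints {n} e)
endpoints-< {n} e = proj₂ (∈-filter⁻ (uncurry Fin._<?_)
  {xs = cartesianProduct (allFin n) (allFin n)} (∈-lookup e))

endpoints-injective : ∀ {e e′ : Edge n} → endpoints {n} e ≡ endpoints e′ → e ≡ e′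
endpoints-injective {n} = lookup-injective (Unique.filter⁺ (uncurry Fin._<?_)
  (Unique.cartesianProduct⁺ (Unique.allFin⁺ n) (Unique.allFin⁺ n))) _ _

endpoints⇒< : ∀ {e : Edge n} {i j : Fin n} → endpoints e ≡ (i , j) → i Fin.< j
endpoints⇒< {n} {e} eq = subst (uncurry Fin._<_) eq (endpoints-< {n} e)

joins-≢ : ∀ {e : Edge n} {i j : Fin n} → Joins e i j → i ≢ j
joins-≢ (inj₁ eq) refl = Fin.<-irrefl refl (endpoints⇒< eq)
joins-≢ (inj₂ eq) refl = Fin.<-irrefl refl (endpoints⇒< eq)

-- Every pair is listed with its smaller end first, so two edges read in opposite orders would give
-- both `i < j` and `j < i`.
joins-unique : ∀ {e e′ : Edge n} {i j : Fin n} → Joins e i j → Joins e′ i j → e ≡ e′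
joins-unique (inj₁ p) (inj₁ q) = endpoints-injective (trans p (sym q))
joins-unique (inj₁ p) (inj₂ q) = contradiction (endpoints⇒< q) (Fin.<-asym (endpoints⇒< p))
joins-unique (inj₂ p) (inj₁ q) = contradiction (endpoints⇒< q) (Fin.<-asym (endpoints⇒< p))
joins-unique (inj₂ p) (inj₂ q) = endpoints-injective (trans p (sym q))

joins-ends : ∀ {e : Edge n} {i j k l : Fin n} → Joins e i j → Joins e k l →
  (i ≡ k × j ≡ l) ⊎ (i ≡ l × j ≡ k)
joins-ends (inj₁ p) (inj₁ q) = let eq = trans (sym p) q in inj₁ (,-injectiveˡ eq , ,-injectiveʳ eq)
joins-ends (inj₁ p) (inj₂ q) = let eq = trans (sym p) q in inj₂ (,-injectiveˡ eq , ,-injectiveʳ eq)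
joins-ends (inj₂ p) (inj₁ q) = let eq = trans (sym p) q in inj₂ (,-injectiveʳ eq , ,-injectiveˡ eq)
joins-ends (inj₂ p) (inj₂ q) = let eq = trans (sym p) q in inj₁ (,-injectiveʳ eq , ,-injectiveˡ eq)

edge-between : ∀ {i j : Fin n} → i ≢ j → ∃ λ (e : Edge n) → Joins e i j
edge-between {n} {i} {j} i≢j with Fin.<-cmp i j
... | tri≈ _ i≡j _ = contradiction i≡j i≢j
... | tri< i<j _ _ = let ij∈ = ∈-filter⁺ (uncurry Fin._<?_) (∈-cartesianProduct⁺ (∈-allFin i) (∈-allFin j)) i<j
                     in Any.index ij∈ , inj₁ (sym (lookup-index ij∈))
... | tri> _ _ j<i = let ji∈ = ∈-filter⁺ (uncurry Fin._<?_) (∈-cartesianProduct⁺ (∈-allFin j) (∈-allFin i)) j<i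
                     in Any.index ji∈ , inj₂ (sym (lookup-index ji∈))

adjacent-sym : ∀ {G : Graph n} {i j} → Adjacent G i j → Adjacent G j i
adjacent-sym (e , e∈ , joins) = e , e∈ , swap joins

module _ (H : Graph v) (f : Vec (Fin n) v) where

  IsImageVertex : Pred (Fin n) _
  IsImageVertex x = ∃[ i ] Vec.lookup f i ≡ x

  IsImageEdge : Pred (Edge n) _
  IsImageEdge e = ∃[ i ] ∃[ j ] Adjacent H i j × Joins {n} e (Vec.lookup f i) (Vec.lookup f j)

  isImageVertex? : Decidable IsImageVertex
  isImageVertex? x = Fin.any? λ i → Vec.lookup f i Fin.≟ x

  isImageEdge? : Decidable IsImageEdge
  isImageEdge? e = Fin.any? λ i → Fin.any? λ j →
    adjacent? H i j ×-dec joins? {n} e (Vec.lookup f i) (Vec.lookup f j)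

  -- Defined on plain vectors, so that a test of subgraphs composed with it is a test of vectors.
  image : Subgraph n
  image = subgraph (comprehension isImageVertex?) (graph (comprehension isImageEdge?))

module _ (H : Graph v) (f : Vec (Fin n) v) where

  ∈-image-edges⁺ : ∀ {e i j} → Adjacent H i j → Joins {n} e (Vec.lookup f i) (Vec.lookup f j) →
    e ∈ edges (graphOn (image H f))
  ∈-image-edges⁺ adj joins = ∈-comprehension⁺ (isImageEdge? H f) (_ , _ , adj , joins)

  ∈-image-edges⁻ : ∀ {e} → e ∈ edges (graphOn (image H f)) → IsImageEdge H f e
  ∈-image-edges⁻ = ∈-comprehension⁻ (isImageEdge? H f)

  ∈-image-vertices⁺ : ∀ i → Vec.lookup f i ∈ vertices (image H f)
  ∈-image-vertices⁺ i = ∈-comprehension⁺ (isImageVertex? H f) (i , refl)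

  ∈-image-vertices⁻ : ∀ {x} → x ∈ vertices (image H f) → IsImageVertex H f x
  ∈-image-vertices⁻ = ∈-comprehension⁻ (isImageVertex? H f)

  image-isSubgraph : IsSubgraphOf (image H f) (complete n)
  image-isSubgraph = (λ _ → ∈⊤) , λ e e∈ → ends e (∈-image-edges⁻ e∈)
    where
    ends : ∀ e → IsImageEdge H f e →
      proj₁ (endpoints e) ∈ vertices (image H f) × proj₂ (endpoints e) ∈ vertices (image H f)
    ends e (i , j , _ , inj₁ eq) rewrite eq = ∈-image-vertices⁺ i , ∈-image-vertices⁺ j
    ends e (i , j , _ , inj₂ eq) rewrite eq = ∈-image-vertices⁺ j , ∈-image-vertices⁺ i

  injective⇒isomorphism : Injective f → IsIsomorphism H (image H f) (Vec.lookup f)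
  injective⇒isomorphism f-inj = record
    { injective = f-inj
    ; into      = ∈-image-vertices⁺
    ; onto      = λ _ → ∈-image-vertices⁻
    ; preserves = preserves
    ; reflects  = reflects
    }
    where
    preserves : ∀ i j → Adjacent H i j → Adjacent (graphOn (image H f)) (Vec.lookup f i) (Vec.lookup f j)
    preserves i j adj@(_ , _ , joins) =
      -- Adjacent vertices are distinct, hence so are their images, and some edge of the complete
      -- graph joins these.
      let e , e-joins = edge-between λ eq → joins-≢ joins (f-inj i j eq)
      in e , ∈-image-edges⁺ adj e-joins , e-joins

    reflects : ∀ i j → Adjacent (graphOn (image H f)) (Vec.lookup f i) (Vec.lookup f j) → Adjacent H i j
    reflects i j (e , e∈ , joins) =
      let k , l , adj , joins′ = ∈-image-edges⁻ e∈ in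
      -- The edge may have been put into the image by another pair `k`, `l`; injectivity identifies
      -- it with `i`, `j` in one of the two orders.
      [ (λ (p , q) → subst₂ (Adjacent H) (sym (f-inj i k p)) (sym (f-inj j l q)) adj)
      , (λ (p , q) → adjacent-sym {G = H} (subst₂ (Adjacent H) (sym (f-inj j k q)) (sym (f-inj i l p)) adj))
      ]′ (joins-ends {n} {e} joins joins′)

module _ {H : Graph v} {S : Subgraph n} (S⊆Kₙ : IsSubgraphOf S (complete n)) where

  -- Being a subgraph places the ends of `e` among the vertices of `S`, where `onto` gives preimages
  -- and `reflects` makes them adjacent.
  edge-of-isomorphic : ∀ {f e} → IsIsomorphism H S f → e ∈ edges (graphOn S) →
    ∃[ i ] ∃[ j ] Adjacent H i j × endpoints {n} e ≡ (f i , f j)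
  edge-of-isomorphic {f} {e} iso e∈ =
    let open IsIsomorphism iso
        x∈ , y∈  = proj₂ S⊆Kₙ e e∈
        i , fi≡x = onto _ x∈
        j , fj≡y = onto _ y∈
        eq       = cong₂ _,_ (sym fi≡x) (sym fj≡y)
    in i , j , reflects i j (e , e∈ , inj₁ eq) , eq

  -- The map alone determines its target, as `onto` and `reflects` leave no vertex or edge outside
  -- the image. Each injection therefore belongs to a single copy.
  isomorphism⇒image : ∀ f → IsIsomorphism H S (Vec.lookup f) → S ≡ image H f
  isomorphism⇒image f iso = cong₂ (λ V E → subgraph V (graph E))
    (⊆-antisym
      (λ {x} x∈ → let i , fi≡x = onto x x∈ in subst (_∈ vertices (image H f)) fi≡x (∈-image-vertices⁺ H f i))
      (λ {x} x∈ → let i , fi≡x = ∈-image-vertices⁻ H f x∈ in subst (_∈ vertices S) fi≡x (into i)))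
    (⊆-antisym
      (λ e∈ → let i , j , adj , eq = edge-of-isomorphic iso e∈ in ∈-image-edges⁺ H f adj (inj₁ eq))
      (λ e∈ → let i , j , adj , joins = ∈-image-edges⁻ H f e∈
                  e′ , e′∈ , joins′ = preserves i j adj
              in subst (_∈ edges (graphOn S)) (joins-unique joins′ joins) e′∈))
    where open IsIsomorphism iso

  -- `Maps` is a bijection written as a relation: `f` is injective on ends, and at most one edge
  -- joins two given vertices.
  numEdges-isomorphic : ∀ {f} → IsIsomorphism H S f → numEdges (graphOn S) ≡ numEdges H
  numEdges-isomorphic {f} iso = trans (sym (length-elements (edges (graphOn S)))) (trans (ℕ.≤-antisym
    (length-≤-by-relation (λ e′ e → Maps e e′) joins-unique (Unique.filter⁺ (_∈? edges (graphOn S)) (Unique.allFin⁺ _)) to-H)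
    (length-≤-by-relation Maps Maps-injective (Unique.filter⁺ (_∈? edges H) (Unique.allFin⁺ _)) from-H))
    (length-elements (edges H)))
    where
    open IsIsomorphism iso
    Maps : Edge v → Edge n → Set
    Maps e e′ = Joins e′ (f (proj₁ (endpoints e))) (f (proj₂ (endpoints e)))

    Maps-injective : ∀ {e ē e′} → Maps e e′ → Maps ē e′ → e ≡ ē
    Maps-injective {e} {ē} {e′} r r̄ =
      [ (λ (p , q) → endpoints-injective (cong₂ _,_ (injective _ _ p) (injective _ _ q)))
      , (λ (p , q) → joins-unique {i = proj₁ (endpoints e)} (inj₁ refl)
                       (inj₂ (cong₂ _,_ (sym (injective _ _ q)) (sym (injective _ _ p)))))
      ]′ (joins-ends {n} {e′} r r̄)

    from-H : ∀ {e} → e ∈ᴸ elements (edges H) → ∃ λ e′ → e′ ∈ᴸ elements (edges (graphOn S)) × Maps e e′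
    from-H {e} e∈ =
      let e′ , e′∈ , joins = preserves _ _ (e , proj₂ (∈-filter⁻ (_∈? edges H) {xs = allFin _} e∈) , inj₁ refl)
      in e′ , ∈-filter⁺ (_∈? edges (graphOn S)) (∈-allFin e′) e′∈ , joins

    to-H : ∀ {e′} → e′ ∈ᴸ elements (edges (graphOn S)) → ∃ λ e → e ∈ᴸ elements (edges H) × Maps e e′
    to-H {e′} e′∈ =
      let i , j , (e , e∈ , joins) , eq = edge-of-isomorphic iso
            (proj₂ (∈-filter⁻ (_∈? edges (graphOn S)) {xs = allFin _} e′∈))
      in e , ∈-filter⁺ (_∈? edges H) (∈-allFin e) e∈ , maps eq joins
      where
      maps : ∀ {e i j} → endpoints e′ ≡ (f i , f j) → Joins e i j → Maps e e′
      maps eq (inj₁ refl) = inj₁ eq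
      maps eq (inj₂ refl) = inj₂ eq

isomorphism-∘-automorphism : ∀ {H : Graph v} {S : Subgraph n} {f σ} →
  IsIsomorphism H S f → IsAutomorphism H σ → IsIsomorphism H S (f ∘ σ)
isomorphism-∘-automorphism {f = f} {σ} iso aut = record
  { injective = λ i j eq → σ.injective i j (f.injective _ _ eq)
  ; into      = λ i → f.into (σ i)
  ; onto      = λ x x∈ → let j , fj≡x = f.onto x x∈
                             i , σi≡j = σ.onto j ∈⊤
                         in i , trans (cong f σi≡j) fj≡x
  ; preserves = λ i j adj → f.preserves _ _ (σ.preserves i j adj)
  ; reflects  = λ i j adj → σ.reflects i j (f.reflects _ _ adj)
  }
  where
  module f = IsIsomorphism iso
  module σ = IsIsomorphism aut

-- The automorphism is `f⁻¹ ∘ g`, the inverse being read off from `onto`.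
isomorphisms-differ-by-automorphism : ∀ {H : Graph v} {S : Subgraph n} {f g} →
  IsIsomorphism H S f → IsIsomorphism H S g → ∃ λ σ → IsAutomorphism H σ × g ≗ f ∘ σ
isomorphisms-differ-by-automorphism {H = H} {S} {f} {g} iso-f iso-g = σ , record
  { injective = λ i j eq → g.injective i j (trans (g≗fσ i) (trans (cong f eq) (sym (g≗fσ j))))
  ; into      = λ _ → ∈⊤
  ; onto      = λ x _ → let i , gi≡fx = g.onto (f x) (f.into x)
                        in i , f.injective _ _ (trans (sym (g≗fσ i)) gi≡fx)
  ; preserves = λ i j adj → f.reflects _ _
      (subst₂ (Adjacent (graphOn S)) (g≗fσ i) (g≗fσ j) (g.preserves i j adj))
  ; reflects  = λ i j adj → g.reflects i j
      (subst₂ (Adjacent (graphOn S)) (sym (g≗fσ i)) (sym (g≗fσ j)) (f.preserves _ _ adj))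
  } , g≗fσ
  where
  module f = IsIsomorphism iso-f
  module g = IsIsomorphism iso-g
  σ : Fin _ → Fin _
  σ i = proj₁ (f.onto (g i) (g.into i))
  g≗fσ : g ≗ f ∘ σ
  g≗fσ i = sym (proj₂ (f.onto (g i) (g.into i)))

module _ {H : Graph v} where

  copies : ∀ n → List (Subgraph n)
  copies n = copiesIn H (complete n)

  ∈-copies⁻ : ∀ {S} → S ∈ᴸ copies n → IsCopyIn H (complete n) S
  ∈-copies⁻ {n} S∈ = proj₂ (∈-filter⁻ (isCopyIn? H (complete n)) {xs = subgraphs n} S∈)

  module _ {Q : Pred (Subgraph n) p} (Q? : Decidable Q) where

    private
      Qcopies : List (Subgraph n)
      Qcopies = filter Q? (copies n)

      Qinjections : List (Vec (Fin n) v)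
      Qinjections = filter (Q? ∘ image H) (injections n v)

      IsIso? : ∀ S (f : Vec (Fin n) v) → Dec (IsIsomorphism H S (Vec.lookup f))
      IsIso? S f = isIsomorphism? H S (Vec.lookup f)

      -- For one fixed isomorphism `f₀`, composition with `f₀` is a bijection from the automorphisms
      -- to the isomorphisms onto `S`. The relation passes through `finToFun` because automorphisms
      -- are listed by their codes.
      isomorphisms-onto-copy : ∀ {S} → S ∈ᴸ Qcopies → length (filter (IsIso? S) Qinjections) ≡ ∣Aut H ∣
      isomorphisms-onto-copy {S} S∈ = ℕ.≤-antisym
        (length-≤-by-relation (λ f σ → Vec.lookup f ≗ f₀ ∘ finToFun σ)
          (λ r r′ → Vec-ext λ i → trans (r i) (sym (r′ i)))
          (Unique.filter⁺ (IsIso? S) (Unique.filter⁺ (Q? ∘ image H) (injections-unique n v))) to-aut)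
        (length-≤-by-relation (λ σ f → Vec.lookup f ≗ f₀ ∘ finToFun σ)
          (λ r r′ → finToFun-injective λ i → f₀.injective _ _ (trans (sym (r i)) (r′ i)))
          (Unique.filter⁺ Aut? (Unique.allFin⁺ _)) from-aut)
        where
        S-copy : IsCopyIn H (complete n) S
        S-copy = ∈-copies⁻ (proj₁ (∈-filter⁻ Q? {xs = copies n} S∈))
        f₀ : Fin v → Fin n
        f₀ = proj₁ (proj₂ S-copy)
        module f₀ = IsIsomorphism (proj₂ (proj₂ S-copy))
        Aut? : Decidable λ σ → IsAutomorphism H (finToFun σ)
        Aut? σ = isIsomorphism? H (subgraph ⊤ H) (finToFun σ)

        to-aut : ∀ {f} → f ∈ᴸ filter (IsIso? S) Qinjections →
          ∃ λ σ → σ ∈ᴸ automorphisms H × Vec.lookup f ≗ f₀ ∘ finToFun σ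
        to-aut f∈ =
          let σ , aut , f≗f₀σ = isomorphisms-differ-by-automorphism (proj₂ (proj₂ S-copy))
                                  (proj₂ (∈-filter⁻ (IsIso? S) {xs = Qinjections} f∈))
              code = Fin.finToFun-funToFin σ
          in funToFin σ ,
             ∈-filter⁺ Aut? (∈-allFin _) (isIsomorphism-resp (sym ∘ code) aut) ,
             λ i → trans (f≗f₀σ i) (cong f₀ (sym (code i)))

        from-aut : ∀ {σ} → σ ∈ᴸ automorphisms H →
          ∃ λ f → f ∈ᴸ filter (IsIso? S) Qinjections × Vec.lookup f ≗ f₀ ∘ finToFun σ
        from-aut {σ} σ∈ = f , ∈-filter⁺ (IsIso? S) f∈ iso , f≗
          where
          f : Vec (Fin n) v
          f = Vec.tabulate (f₀ ∘ finToFun σ)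
          f≗ : Vec.lookup f ≗ f₀ ∘ finToFun σ
          f≗ = Vec.lookup∘tabulate _
          iso : IsIsomorphism H S (Vec.lookup f)
          iso = isIsomorphism-resp (sym ∘ f≗) (isomorphism-∘-automorphism (proj₂ (proj₂ S-copy))
            (proj₂ (∈-filter⁻ Aut? {xs = allFin _} σ∈)))
          f∈ : f ∈ᴸ Qinjections
          f∈ = ∈-filter⁺ (Q? ∘ image H) (∈-injections (IsIsomorphism.injective iso))
            (subst Q (isomorphism⇒image (proj₁ S-copy) f iso) (proj₂ (∈-filter⁻ Q? {xs = copies n} S∈)))

      copies-of-injection : ∀ {f} → f ∈ᴸ Qinjections →
        length (filter (λ S → IsIso? S f) Qcopies) ≡ 1
      copies-of-injection {f} f∈ = length-singleton
        (Unique.filter⁺ (λ S → IsIso? S f) (Unique.filter⁺ Q? (Unique.filter⁺ (isCopyIn? H (complete n)) (subgraphs-unique n))))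
        (∈-filter⁺ (λ S → IsIso? S f) (∈-filter⁺ Q? (∈-filter⁺ (isCopyIn? H (complete n)) (∈-subgraphs _)
          (image-isSubgraph H f , Vec.lookup f , iso)) Q-image) iso)
        λ S∈ → let S∈Q , iso′ = ∈-filter⁻ (λ S → IsIso? S f) {xs = Qcopies} S∈
               in isomorphism⇒image (proj₁ (∈-copies⁻ (proj₁ (∈-filter⁻ Q? {xs = copies n} S∈Q)))) f iso′
        where
        Q-image : Q (image H f)
        Q-image = proj₂ (∈-filter⁻ (Q? ∘ image H) {xs = injections n v} f∈)
        iso : IsIsomorphism H (image H f) (Vec.lookup f)
        iso = injective⇒isomorphism H f (injections⇒injective
          (proj₁ (∈-filter⁻ (Q? ∘ image H) {xs = injections n v} f∈)))

    -- Pairs of a copy and an isomorphism onto it are counted in two ways. The property `Q` is left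
    -- general because the identity serves for all copies, for those through a given edge and for
    -- those sharing `k` edges with a fixed copy.
    copies-*-automorphisms : length Qcopies ℕ.* ∣Aut H ∣ ≡ length Qinjections
    copies-*-automorphisms = begin
      length Qcopies ℕ.* ∣Aut H ∣                                          ≡⟨ ∑-const′ Qcopies _ ⟨
      ∑ Qcopies (λ _ → ∣Aut H ∣)                                           ≡⟨ ∑-cong-∈ Qcopies isomorphisms-onto-copy ⟨
      ∑ Qcopies (λ S → length (filter (IsIso? S) Qinjections))             ≡⟨ double-counting IsIso? Qcopies Qinjections ⟩
      ∑ Qinjections (λ f → length (filter (λ S → IsIso? S f) Qcopies))     ≡⟨ ∑-cong-∈ Qinjections copies-of-injection ⟩
      ∑ Qinjections (λ _ → 1)                                              ≡⟨ ∑-const′ Qinjections 1 ⟩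
      length Qinjections ℕ.* 1                                             ≡⟨ ℕ.*-identityʳ _ ⟩
      length Qinjections                                                   ∎
      where
      open ≡-Reasoning
      open ∑ℕ

-- Edge transitivity and overlapping copies

transpose-matchˡ : ∀ (i j : Fin n) → Fin.transpose i j i ≡ j
transpose-matchˡ i j rewrite dec-true (i Fin.≟ i) refl = refl

transpose-other : ∀ {i j k : Fin n} → k ≢ i → k ≢ j → Fin.transpose i j k ≡ k
transpose-other {i = i} {j} {k} k≢i k≢j
  rewrite dec-false (k Fin.≟ i) k≢i | dec-false (k Fin.≟ j) k≢j = refl

transpose-injective : ∀ {i j x y : Fin n} → Fin.transpose i j x ≡ Fin.transpose i j y → x ≡ y
transpose-injective {i = i} {j} eq = trans (sym (Fin.transpose-inverse j i))
  (trans (cong (Fin.transpose j i) eq) (Fin.transpose-inverse j i))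

-- After `τ` has sent `a` to `a′`, exchanging `τ b` with `b′` leaves `a′` in place, since `a′`
-- differs from both.
two-point-transitive : ∀ {a b a′ b′ : Fin n} → a ≢ b → a′ ≢ b′ →
  ∃ λ π → (∀ {x y} → π x ≡ π y → x ≡ y) × π a ≡ a′ × π b ≡ b′
two-point-transitive {a = a} {b} {a′} {b′} a≢b a′≢b′ =
  Fin.transpose (τ b) b′ ∘ τ ,
  transpose-injective ∘ transpose-injective ,
  trans (cong (Fin.transpose (τ b) b′) τa≡a′) (transpose-other a′≢τb a′≢b′) ,
  transpose-matchˡ (τ b) b′
  where
  τ : Fin _ → Fin _
  τ = Fin.transpose a a′
  τa≡a′ : τ a ≡ a′
  τa≡a′ = transpose-matchˡ a a′
  a′≢τb : a′ ≢ τ b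
  a′≢τb a′≡τb = a≢b (transpose-injective (trans τa≡a′ a′≡τb))

module _ {H : Graph v} where

  private
    through? : ∀ e (S : Subgraph n) → Dec (e ∈ edges (graphOn S))
    through? e S = e ∈? edges (graphOn S)

    injections-through : Edge n → List (Vec (Fin n) v)
    injections-through {n} e = filter (through? e ∘ image H) (injections n v)

    -- Composition with an injective vertex map that carries the ends of `e` to those of `e′`.
    -- Exchanging the two edges gives the reverse inequality.
    injections-through-≤ : ∀ (e e′ : Edge n) → length (injections-through e) ℕ.≤ length (injections-through e′)
    injections-through-≤ {n} e e′ = moved (two-point-transitive
      (joins-≢ {n} {e} (inj₁ refl)) (joins-≢ {n} {e′} (inj₁ refl)))
      where
      moved : ∃ (λ π → (∀ {x y} → π x ≡ π y → x ≡ y) ×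
        π (proj₁ (endpoints {n} e)) ≡ proj₁ (endpoints {n} e′) × π (proj₂ (endpoints {n} e)) ≡ proj₂ (endpoints {n} e′)) →
        length (injections-through e) ℕ.≤ length (injections-through e′)
      moved (π , π-inj , πa≡a′ , πb≡b′) = length-≤-by-relation (λ f g → Vec.map π f ≡ g)
        (λ {f} {f′} πf≡g πf′≡g → Vec-ext λ i → π-inj (trans (sym (Vec.lookup-map i π f))
          (trans (cong (λ h → Vec.lookup h i) (trans πf≡g (sym πf′≡g))) (Vec.lookup-map i π f′))))
        (Unique.filter⁺ (through? e ∘ image H) (injections-unique n v))
        λ f∈ → _ , move f∈ , refl
        where
        π-joins : ∀ {x y} → Joins {n} e x y → Joins {n} e′ (π x) (π y)
        π-joins (inj₁ refl) = inj₁ (cong₂ _,_ (sym πa≡a′) (sym πb≡b′))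
        π-joins (inj₂ refl) = inj₂ (cong₂ _,_ (sym πa≡a′) (sym πb≡b′))

        move : ∀ {f} → f ∈ᴸ injections-through e → Vec.map π f ∈ᴸ injections-through e′
        move {f} f∈ =
          let f∈inj , e∈ = ∈-filter⁻ (through? e ∘ image H) {xs = injections n v} f∈
              f-inj = injections⇒injective f∈inj
              i , j , adj , joins = ∈-image-edges⁻ H f e∈
          in ∈-filter⁺ (through? e′ ∘ image H)
               (∈-injections λ k l eq → f-inj k l (π-inj
                 (trans (sym (Vec.lookup-map k π f)) (trans eq (Vec.lookup-map l π f)))))
               (∈-image-edges⁺ H (Vec.map π f) adj (subst₂ (Joins {n} e′)
                 (sym (Vec.lookup-map i π f)) (sym (Vec.lookup-map j π f)) (π-joins joins)))

  -- Vertex maps act on injections by mere composition, so the comparison is made there and the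
  -- factor `∣Aut H ∣` is cancelled.
  copies-through-const : ∀ (e e′ : Edge n) →
    length (filter (through? e) (copies {H = H} n)) ≡ length (filter (through? e′) (copies {H = H} n))
  copies-through-const {n} e e′ = ℕ.*-cancelʳ-≡ _ _ ∣Aut H ∣ {{∣Aut∣-nonZero H}} (trans
    (copies-*-automorphisms {H = H} {n = n} (through? e))
    (trans (ℕ.≤-antisym (injections-through-≤ {n} e e′) (injections-through-≤ {n} e′ e))
           (sym (copies-*-automorphisms {H = H} {n = n} (through? e′)))))

length-cartesianProduct : ∀ (xs : List A) (ys : List B) →
  length (cartesianProduct xs ys) ≡ length xs ℕ.* length ys
length-cartesianProduct xs ys = begin
  length (cartesianProduct xs ys)               ≡⟨ ℕ.*-identityʳ _ ⟨
  length (cartesianProduct xs ys) ℕ.* 1         ≡⟨ ∑-const′ (cartesianProduct xs ys) 1 ⟨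
  ∑ (cartesianProduct xs ys) (λ _ → 1)          ≡⟨ ∑-cartesianProductWith _,_ xs ys (λ _ → 1) ⟩
  ∑ xs (λ _ → ∑ ys λ _ → 1)                     ≡⟨ ∑-const′ xs _ ⟩
  length xs ℕ.* ∑ ys (λ _ → 1)                  ≡⟨ cong (length xs ℕ.*_) (trans (∑-const′ ys 1) (ℕ.*-identityʳ _)) ⟩
  length xs ℕ.* length ys                       ∎
  where
  open ≡-Reasoning
  open ∑ℕ

-- An edge with both ends in ws occurs in ws × ws in both orders, and the diagonal is left over.
edges-within-bound : ∀ (E : EdgeSet n) {ws} → Unique ws →
  (∀ {e} → e ∈ E → proj₁ (endpoints {n} e) ∈ᴸ ws × proj₂ (endpoints {n} e) ∈ᴸ ws) →
  2 ℕ.* ∣ E ∣ ℕ.+ length ws ℕ.≤ length ws ℕ.* length ws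
edges-within-bound {n} E {ws} ws! within = begin
  2 ℕ.* ∣ E ∣ ℕ.+ length ws
    ≡⟨ cong (ℕ._+ length ws) (cong (∣ E ∣ ℕ.+_) (ℕ.+-identityʳ ∣ E ∣)) ⟩
  ∣ E ∣ ℕ.+ ∣ E ∣ ℕ.+ length ws
    ≡⟨ ℕ.+-assoc ∣ E ∣ ∣ E ∣ (length ws) ⟩
  ∣ E ∣ ℕ.+ (∣ E ∣ ℕ.+ length ws)
    ≡⟨ cong₂ ℕ._+_ (length-mapped (endpoints {n})) (cong₂ ℕ._+_ (length-mapped flipped) (sym (length-map diagonal ws))) ⟩
  length up ℕ.+ (length down ℕ.+ length diag)
    ≡⟨ cong (length up ℕ.+_) (length-++ down) ⟨
  length up ℕ.+ length (down ++ diag)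
    ≡⟨ length-++ up ⟨
  length (up ++ down ++ diag)
    ≤⟨ length-≤-by-⊆ unique ⊆ws×ws ⟩
  length (cartesianProduct ws ws)
    ≡⟨ length-cartesianProduct ws ws ⟩
  length ws ℕ.* length ws ∎
  where
  open ℕ.≤-Reasoning
  flipped : Edge n → Fin n × Fin n
  flipped e = proj₂ (endpoints {n} e) , proj₁ (endpoints {n} e)

  diagonal : Fin n → Fin n × Fin n
  diagonal w = w , w

  up down diag : List (Fin n × Fin n)
  up   = map (endpoints {n}) (elements E)
  down = map flipped (elements E)
  diag = map diagonal ws

  length-mapped : ∀ (h : Edge n → Fin n × Fin n) → ∣ E ∣ ≡ length (map h (elements E))
  length-mapped h = sym (trans (length-map h (elements E)) (length-elements E))

  elements! : Unique (elements E)
  elements! = Unique.filter⁺ (_∈? E) (Unique.allFin⁺ _)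

  up⇒< : ∀ {x y} → (x , y) ∈ᴸ up → x Fin.< y
  up⇒< xy∈ with _ , _ , refl ← ∈-map⁻ (endpoints {n}) xy∈ = endpoints-< {n} _

  down⇒> : ∀ {x y} → (x , y) ∈ᴸ down → y Fin.< x
  down⇒> xy∈ with _ , _ , refl ← ∈-map⁻ flipped xy∈ = endpoints-< {n} _

  diag⇒≡ : ∀ {x y} → (x , y) ∈ᴸ diag → x ≡ y
  diag⇒≡ xy∈ with _ , _ , refl ← ∈-map⁻ diagonal xy∈ = refl

  unique : Unique (up ++ down ++ diag)
  unique = Unique.++⁺ (Unique.map⁺ (endpoints-injective {n}) elements!)
    (Unique.++⁺ (Unique.map⁺ (λ eq → endpoints-injective {n} (cong₂ _,_ (,-injectiveʳ eq) (,-injectiveˡ eq))) elements!)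
      (Unique.map⁺ ,-injectiveˡ ws!)
      λ (∈down , ∈diag) → Fin.<-irrefl (sym (diag⇒≡ ∈diag)) (down⇒> ∈down))
    λ (∈up , ∈rest) → [ (λ ∈down → Fin.<-asym (up⇒< ∈up) (down⇒> ∈down))
                      , (λ ∈diag → Fin.<-irrefl (diag⇒≡ ∈diag) (up⇒< ∈up)) ]′ (∈-++⁻ down ∈rest)

  ∈E : ∀ {e} → e ∈ᴸ elements E → e ∈ E
  ∈E e∈ = proj₂ (∈-filter⁻ (_∈? E) {xs = allFin _} e∈)

  up⊆ : ∀ {p} → p ∈ᴸ up → p ∈ᴸ cartesianProduct ws ws
  up⊆ p∈ with _ , e∈ , refl ← ∈-map⁻ (endpoints {n}) p∈ =
    ∈-cartesianProduct⁺ (proj₁ (within (∈E e∈))) (proj₂ (within (∈E e∈)))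

  down⊆ : ∀ {p} → p ∈ᴸ down → p ∈ᴸ cartesianProduct ws ws
  down⊆ p∈ with _ , e∈ , refl ← ∈-map⁻ flipped p∈ =
    ∈-cartesianProduct⁺ (proj₂ (within (∈E e∈))) (proj₁ (within (∈E e∈)))

  diag⊆ : ∀ {p} → p ∈ᴸ diag → p ∈ᴸ cartesianProduct ws ws
  diag⊆ p∈ with _ , w∈ , refl ← ∈-map⁻ diagonal p∈ = ∈-cartesianProduct⁺ w∈ w∈

  ⊆ws×ws : ∀ {p} → p ∈ᴸ up ++ down ++ diag → p ∈ᴸ cartesianProduct ws ws
  ⊆ws×ws p∈ = [ up⊆ , (λ p∈rest → [ down⊆ , diag⊆ ]′ (∈-++⁻ down p∈rest)) ]′ (∈-++⁻ up p∈)

-- The first hypothesis is `2 k ≤ w (w - 1)` without subtraction, and `m (m + 1)` is twice the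
-- number of edges of a complete graph on `m + 1` vertices. So `w ≤ m + 1` would leave too little
-- room.
many-edges⇒many-vertices : ∀ {k w m} → 2 ℕ.* k ℕ.+ w ℕ.≤ w ℕ.* w → m ℕ.* suc m ℕ.< 2 ℕ.* k → suc (suc m) ℕ.≤ w
many-edges⇒many-vertices {k} {w} {m} bound m[m+1]<2k with suc (suc m) ℕ.≤? w
... | yes m+2≤w = m+2≤w
... | no  m+2≰w = contradiction m[m+1]<2k (ℕ.≤⇒≯ (few (ℕ.s≤s⁻¹ (ℕ.≰⇒> m+2≰w)) bound))
  where
  few : ∀ {w} → w ℕ.≤ suc m → 2 ℕ.* k ℕ.+ w ℕ.≤ w ℕ.* w → 2 ℕ.* k ℕ.≤ m ℕ.* suc m
  few {zero}  _     bound = ℕ.≤-trans (ℕ.m≤m+n _ 0) (ℕ.≤-trans bound ℕ.z≤n)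
  few {suc w} w≤m+1 bound = ℕ.≤-trans
    (ℕ.+-cancelʳ-≤ (suc w) _ _ (ℕ.≤-trans bound (ℕ.≤-reflexive (ℕ.+-comm (suc w) (w ℕ.* suc w)))))
    (ℕ.*-mono-≤ (ℕ.s≤s⁻¹ w≤m+1) w≤m+1)

-- The case `m = 0`, with all vertices of `H` as the vertex list. It ensures that exponents such as
-- `v ∸ 2` and `2 v ∸ 4` are genuine differences and that the complete graph has an edge.
2≤order : ∀ (H : Graph v) → 1 ℕ.< numEdges H → 2 ℕ.≤ v
2≤order {v} H 1<ℓ = many-edges⇒many-vertices {numEdges H} {v} {0}
  (subst (λ z → 2 ℕ.* numEdges H ℕ.+ z ℕ.≤ z ℕ.* z) (length-tabulate {n = v} id)
    (edges-within-bound {v} (edges H) (Unique.allFin⁺ v) λ _ → ∈-allFin _ , ∈-allFin _))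
  (ℕ.≤-trans (ℕ.<⇒≤ 1<ℓ) (ℕ.m≤m+n _ _))

-- Copies that share many edges

module _ {H : Graph v} {S : Subgraph n} (S-copy : IsCopyIn H (complete n) S) where

  private
    f₀ : Fin v → Fin n
    f₀ = proj₁ (proj₂ S-copy)

  copy-order-≤ : length (elements (vertices S)) ℕ.≤ v
  copy-order-≤ = ℕ.≤-trans (length-≤-by-⊆ {ys = tabulate f₀} (Unique.filter⁺ (_∈? vertices S) (Unique.allFin⁺ n))
    λ x∈ → let i , fi≡x = IsIsomorphism.onto (proj₂ (proj₂ S-copy)) _ (proj₂ (∈-filter⁻ (_∈? vertices S) {xs = allFin n} x∈))
           in subst (_∈ᴸ tabulate f₀) fi≡x (∈-tabulate⁺ i))
    (ℕ.≤-reflexive (length-tabulate f₀))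

  -- A shared edge has its ends in both copies, that is, among the values of `g` that lie in `S`.
  shared-edges-bound : ∀ {g} → Injective g →
    let w = length (filter (_∈? vertices S) (values g)) in
    2 ℕ.* numSharedEdges S (image H g) ℕ.+ w ℕ.≤ w ℕ.* w
  shared-edges-bound {g} g-inj = edges-within-bound {n} _ (Unique.filter⁺ (_∈? vertices S) (values-unique {f = g} g-inj))
    λ e∈ → let e∈S , e∈g = x∈p∩q⁻ _ _ e∈
               x∈ , y∈   = proj₂ (proj₁ S-copy) _ e∈S
               x∈g , y∈g = proj₂ (image-isSubgraph H g) _ e∈g
           in in-both x∈ x∈g , in-both y∈ y∈g
    where
    in-both : ∀ {x} → x ∈ vertices S → x ∈ vertices (image H g) → x ∈ᴸ filter (_∈? vertices S) (values g)
    in-both x∈S x∈g = ∈-filter⁺ (_∈? vertices S)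
      (let i , gi≡x = ∈-image-vertices⁻ H g x∈g in subst (_∈ᴸ values g) gi≡x (∈-tabulate⁺ i)) x∈S

  -- Copies sharing more than m (m + 1) / 2 edges share at least m + 2 vertices, so m + 2 values of
  -- an embedding of the second copy are confined to the first one.
  copies-sharing-bound : ∀ {k m} → m ℕ.* suc m ℕ.< 2 ℕ.* k →
    length (filter (λ S′ → numSharedEdges S S′ ℕ.≟ k) (copies {H = H} n)) ℕ.* n ℕ.^ (2 ℕ.+ m) ℕ.≤ suc v ℕ.^ v ℕ.* n ℕ.^ v
  copies-sharing-bound {k} {m} m[m+1]<2k = begin
    length (filter sharing? (copies n)) ℕ.* n ℕ.^ (2 ℕ.+ m)
      ≤⟨ ℕ.*-monoˡ-≤ (n ℕ.^ (2 ℕ.+ m)) (ℕ.m≤m*n (length (filter sharing? (copies {H = H} n))) ∣Aut H ∣ {{∣Aut∣-nonZero H}}) ⟩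
    length (filter sharing? (copies n)) ℕ.* ∣Aut H ∣ ℕ.* n ℕ.^ (2 ℕ.+ m)
      ≡⟨ cong (ℕ._* n ℕ.^ (2 ℕ.+ m)) (copies-*-automorphisms {H = H} sharing?) ⟩
    length (filter (sharing? ∘ image H) (injections n v)) ℕ.* n ℕ.^ (2 ℕ.+ m)
      ≤⟨ ℕ.*-monoˡ-≤ (n ℕ.^ (2 ℕ.+ m)) (length-≤-by-⊆ (Unique.filter⁺ (sharing? ∘ image H) (injections-unique n v)) sharing⊆hitting) ⟩
    length (filter hitting? (vecs (allFin n) v)) ℕ.* n ℕ.^ (2 ℕ.+ m)
      ≡⟨ cong (λ z → length (filter hitting? (vecs (allFin n) v)) ℕ.* z ℕ.^ (2 ℕ.+ m)) (length-tabulate {n = n} id) ⟨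
    length (filter hitting? (vecs (allFin n) v)) ℕ.* length (allFin n) ℕ.^ (2 ℕ.+ m)
      ≤⟨ vecs-with-hits-bound (_∈? vertices S) (allFin n) (2 ℕ.+ m) v ⟩
    suc (length (elements (vertices S))) ℕ.^ v ℕ.* length (allFin n) ℕ.^ v
      ≤⟨ ℕ.*-mono-≤ (ℕ.^-monoˡ-≤ v (ℕ.s≤s copy-order-≤)) (ℕ.≤-reflexive (cong (ℕ._^ v) (length-tabulate {n = n} id))) ⟩
    suc v ℕ.^ v ℕ.* n ℕ.^ v ∎
    where
    open ℕ.≤-Reasoning
    sharing? : ∀ S′ → Dec (numSharedEdges S S′ ≡ k)
    sharing? S′ = numSharedEdges S S′ ℕ.≟ k
    hitting? : ∀ (g : Vec (Fin n) v) → Dec (2 ℕ.+ m ℕ.≤ length (filter (_∈? vertices S) (values g)))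
    hitting? g = 2 ℕ.+ m ℕ.≤? length (filter (_∈? vertices S) (values g))
    sharing⊆hitting : ∀ {g} → g ∈ᴸ filter (sharing? ∘ image H) (injections n v) → g ∈ᴸ filter hitting? (vecs (allFin n) v)
    sharing⊆hitting {g} g∈ =
      let g∈inj , shared≡k = ∈-filter⁻ (sharing? ∘ image H) {xs = injections n v} g∈
      in ∈-filter⁺ hitting? (∈-vecs ∈-allFin g)
           (many-edges⇒many-vertices {k} (subst (λ z → 2 ℕ.* z ℕ.+ _ ℕ.≤ _) shared≡k
             (shared-edges-bound {g} (injections⇒injective g∈inj))) m[m+1]<2k)

module _ (H : Graph v) where

  numCopies-*-automorphisms : ∀ n → numCopies H (complete n) ℕ.* ∣Aut H ∣ ≡ n P′ v
  numCopies-*-automorphisms n = begin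
    length (copies {H = H} n) ℕ.* ∣Aut H ∣
      ≡⟨ cong (λ xs → length xs ℕ.* ∣Aut H ∣) (filter-all all? {copies {H = H} n} (All.universal (λ _ → _) _)) ⟨
    -- The general count of copies is applied to the property that always holds.
    length (filter all? (copies {H = H} n)) ℕ.* ∣Aut H ∣
      ≡⟨ copies-*-automorphisms {H = H} {n = n} all? ⟩
    length (filter (all? ∘ image H) (injections n v))
      ≡⟨ cong length (filter-all (all? ∘ image H) {injections n v} (All.universal (λ _ → _) _)) ⟩
    length (injections n v)
      ≡⟨ length-injections n v ⟩
    n P′ v ∎
    where
    open ≡-Reasoning
    all? : Decidable {A = Subgraph n} λ _ → Unit
    all? _ = yes _

  numCopies-≤ : ∀ n → numCopies H (complete n) ℕ.≤ n ℕ.^ v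
  numCopies-≤ n = begin
    numCopies H (complete n)                    ≤⟨ ℕ.m≤m*n (numCopies H (complete n)) ∣Aut H ∣ {{∣Aut∣-nonZero H}} ⟩
    numCopies H (complete n) ℕ.* ∣Aut H ∣       ≡⟨ numCopies-*-automorphisms n ⟩
    n P′ v                                      ≡⟨ length-injections n v ⟨
    length (injections n v)                     ≤⟨ List.length-filter injective? (vecs (allFin n) v) ⟩
    length (vecs (allFin n) v)                  ≡⟨ length-vecs (allFin n) v ⟩
    length (allFin n) ℕ.^ v                     ≡⟨ cong (ℕ._^ v) (length-tabulate {n = n} id) ⟩
    n ℕ.^ v                                     ∎
    where open ℕ.≤-Reasoning

  -- There are at most `n ^ v` first copies, and the bound on second copies has the same constant
  -- for each of them.
  numPairs-bound : ∀ {k m} → m ℕ.* suc m ℕ.< 2 ℕ.* k →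
    ∀ n → numPairs H n k ℕ.* n ℕ.^ (2 ℕ.+ m) ℕ.≤ suc v ℕ.^ v ℕ.* n ℕ.^ (2 ℕ.* v)
  numPairs-bound {k} {m} m[m+1]<2k n = begin
    numPairs H n k ℕ.* nᵐ
      ≡⟨ cong (ℕ._* nᵐ) (trans (length-filter′ shared? (cartesianProduct cs cs)) (∑-cartesianProductWith _,_ cs cs (𝟙 ∘ shared?))) ⟩
    ∑ cs (λ S → ∑ cs λ S′ → 𝟙 (shared? (S , S′))) ℕ.* nᵐ
      ≡⟨ cong (ℕ._* nᵐ) (∑-cong cs λ S → length-filter′ (λ S′ → shared? (S , S′)) cs) ⟨
    ∑ cs (λ S → length (filter (λ S′ → shared? (S , S′)) cs)) ℕ.* nᵐ
      ≡⟨ ∑-*ʳ cs nᵐ _ ⟨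
    ∑ cs (λ S → length (filter (λ S′ → shared? (S , S′)) cs) ℕ.* nᵐ)
      ≤⟨ ∑-mono-∈ cs (λ S∈ → copies-sharing-bound (∈-copies⁻ S∈) {m = m} m[m+1]<2k) ⟩
    ∑ cs (λ S → suc v ℕ.^ v ℕ.* n ℕ.^ v)
      ≡⟨ ∑-const′ cs _ ⟩
    numCopies H (complete n) ℕ.* (suc v ℕ.^ v ℕ.* n ℕ.^ v)
      ≤⟨ ℕ.*-monoˡ-≤ _ (numCopies-≤ n) ⟩
    n ℕ.^ v ℕ.* (suc v ℕ.^ v ℕ.* n ℕ.^ v)
      ≡⟨ solve 2 (λ x y → x :* (y :* x) := y :* (x :* x)) refl (n ℕ.^ v) (suc v ℕ.^ v) ⟩
    suc v ℕ.^ v ℕ.* (n ℕ.^ v ℕ.* n ℕ.^ v)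
      ≡⟨ cong (suc v ℕ.^ v ℕ.*_) (trans (cong (λ z → n ℕ.^ (v ℕ.+ z)) (ℕ.+-identityʳ v)) (ℕ.^-distribˡ-+-* n v v)) ⟨
    suc v ℕ.^ v ℕ.* n ℕ.^ (2 ℕ.* v) ∎
    where
    open ℕ.≤-Reasoning
    open ∑ℕ
    open +-*-Solver
    nᵐ : ℕ
    nᵐ = n ℕ.^ (2 ℕ.+ m)
    cs : List (Subgraph n)
    cs = copies {H = H} n
    shared? : ∀ (SS′ : Subgraph n × Subgraph n) → Dec (numSharedEdges (proj₁ SS′) (proj₂ SS′) ≡ k)
    shared? (S , S′) = numSharedEdges S S′ ℕ.≟ k

-- Ordered fields and O-terms

-- A ring solver has to compare coefficients, and equality in the field is not decidable; integers
-- can be compared and map to every commutative ring. Since the integer one goes to `1# + 0#`, which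
-- is only `≈` to `1#`, later equations often treat `1#` as a variable or correct it by
-- `+-identityʳ`.
module IntegerCoefficients {c ℓ} (R : CommutativeRing c ℓ) where
  open CommutativeRing R renaming (refl to ≈-refl; sym to ≈-sym; trans to ≈-trans)
  open import Algebra.Definitions.RawSemiring (Semiring.rawSemiring semiring) using () renaming (_×_ to _×ℕ_)
  open import Algebra.Properties.Semiring.Mult semiring using (×-homo-+; ×1-homo-*)
  open import Algebra.Properties.Ring ring using (-‿distribˡ-*; -‿distribʳ-*; -‿involutive; -0#≈0#; -‿+-comm)
  open import Algebra.Properties.CommutativeSemigroup +-commutativeSemigroup using (interchange)
  open import Relation.Binary.Reasoning.Setoid setoid

  fromℤ : ℤ.ℤ → Carrier
  fromℤ (ℤ.+ n)    = n ×ℕ 1#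
  fromℤ ℤ.-[1+ n ] = - (suc n ×ℕ 1#)

  private
    ⊖-homo : ∀ m n → fromℤ (m ℤ.⊖ n) ≈ m ×ℕ 1# - n ×ℕ 1#
    ⊖-homo m       zero    = ≈-sym (≈-trans (+-congˡ -0#≈0#) (+-identityʳ _))
    ⊖-homo zero    (suc n) = ≈-sym (+-identityˡ _)
    ⊖-homo (suc m) (suc n) = begin
      fromℤ (suc m ℤ.⊖ suc n)                   ≡⟨ cong fromℤ (ℤ.[1+m]⊖[1+n]≡m⊖n m n) ⟩
      fromℤ (m ℤ.⊖ n)                           ≈⟨ ⊖-homo m n ⟩
      m ×ℕ 1# - n ×ℕ 1#                         ≈⟨ +-identityˡ _ ⟨
      0# + (m ×ℕ 1# - n ×ℕ 1#)                  ≈⟨ +-congʳ (-‿inverseʳ 1#) ⟨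
      (1# - 1#) + (m ×ℕ 1# - n ×ℕ 1#)           ≈⟨ interchange _ _ _ _ ⟩
      (1# + m ×ℕ 1#) + (- 1# + - (n ×ℕ 1#))     ≈⟨ +-congˡ (-‿+-comm _ _) ⟩
      suc m ×ℕ 1# - suc n ×ℕ 1#                 ∎

    +◃-homo : ∀ n → fromℤ (Sign.+ ℤ.◃ n) ≈ n ×ℕ 1#
    +◃-homo zero    = ≈-refl
    +◃-homo (suc n) = ≈-refl

    -◃-homo : ∀ n → fromℤ (Sign.- ℤ.◃ n) ≈ - (n ×ℕ 1#)
    -◃-homo zero    = ≈-sym -0#≈0#
    -◃-homo (suc n) = ≈-refl

  fromℤ-+-homo : ∀ i j → fromℤ (i ℤ.+ j) ≈ fromℤ i + fromℤ j
  fromℤ-+-homo (ℤ.+ m)    (ℤ.+ n)    = ×-homo-+ 1# m n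
  fromℤ-+-homo (ℤ.+ m)    ℤ.-[1+ n ] = ⊖-homo m (suc n)
  fromℤ-+-homo ℤ.-[1+ m ] (ℤ.+ n)    = ≈-trans (⊖-homo n (suc m)) (+-comm _ _)
  fromℤ-+-homo ℤ.-[1+ m ] ℤ.-[1+ n ] = begin
    - (suc (suc (m ℕ.+ n)) ×ℕ 1#)        ≡⟨ cong (λ k → - (suc k ×ℕ 1#)) (ℕ.+-suc m n) ⟨
    - ((suc m ℕ.+ suc n) ×ℕ 1#)          ≈⟨ -‿cong (×-homo-+ 1# (suc m) (suc n)) ⟩
    - (suc m ×ℕ 1# + suc n ×ℕ 1#)        ≈⟨ -‿+-comm _ _ ⟨
    - (suc m ×ℕ 1#) - suc n ×ℕ 1#        ∎

  fromℤ-*-homo : ∀ i j → fromℤ (i ℤ.* j) ≈ fromℤ i * fromℤ j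
  fromℤ-*-homo (ℤ.+ m)    (ℤ.+ n)    = ≈-trans (+◃-homo (m ℕ.* n)) (×1-homo-* m n)
  fromℤ-*-homo (ℤ.+ m)    ℤ.-[1+ n ] = ≈-trans (-◃-homo (m ℕ.* suc n))
    (≈-trans (-‿cong (×1-homo-* m (suc n))) (-‿distribʳ-* _ _))
  fromℤ-*-homo ℤ.-[1+ m ] (ℤ.+ n)    = ≈-trans (-◃-homo (suc m ℕ.* n))
    (≈-trans (-‿cong (×1-homo-* (suc m) n)) (-‿distribˡ-* _ _))
  fromℤ-*-homo ℤ.-[1+ m ] ℤ.-[1+ n ] = begin
    fromℤ (Sign.+ ℤ.◃ suc m ℕ.* suc n)        ≈⟨ ×1-homo-* (suc m) (suc n) ⟩
    (suc m ×ℕ 1#) * (suc n ×ℕ 1#)             ≈⟨ -‿involutive _ ⟨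
    - - ((suc m ×ℕ 1#) * (suc n ×ℕ 1#))       ≈⟨ -‿cong (-‿distribʳ-* _ _) ⟩
    - ((suc m ×ℕ 1#) * - (suc n ×ℕ 1#))       ≈⟨ -‿distribˡ-* _ _ ⟩
    - (suc m ×ℕ 1#) * - (suc n ×ℕ 1#)         ∎

  fromℤ-‿homo : ∀ i → fromℤ (ℤ.- i) ≈ - fromℤ i
  fromℤ-‿homo (ℤ.+ zero)  = ≈-sym -0#≈0#
  fromℤ-‿homo (ℤ.+ suc n) = ≈-refl
  fromℤ-‿homo ℤ.-[1+ n ]  = ≈-sym (-‿involutive _)

  fromℤ-morphism : ℤ.+-*-rawRing -Raw-AlmostCommutative⟶ fromCommutativeRing R
  fromℤ-morphism = record
    { ⟦_⟧    = fromℤ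
    ; +-homo = fromℤ-+-homo
    ; *-homo = fromℤ-*-homo
    ; -‿homo = fromℤ-‿homo
    ; 0-homo = ≈-refl
    ; 1-homo = +-identityʳ 1#
    }

  module Solver = RingSolver ℤ.+-*-rawRing (fromCommutativeRing R) fromℤ-morphism
    (λ i j → Maybe.map (λ i≡j → reflexive (cong fromℤ i≡j)) (dec⇒maybe (i ℤ.≟ j)))

module OrderedFieldProperties {c ℓ₁ ℓ₂ ℓ₃} (F : OrderedField c ℓ₁ ℓ₂ ℓ₃) where
  open OrderedField F hiding (zero)
  open RandomGraph F using (O[n^_])
  open IntegerCoefficients commutativeRing using (module Solver)
  open Solver using (solve; con; _:+_; _:*_; _:-_; :-_; _:=_)
  open import Algebra.Properties.Semiring.Mult semiring using (×-homo-+; ×1-homo-*)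
  open import Relation.Binary.Reasoning.Setoid setoid

  #-congˡ : ∀ {x y z} → x ≈ y → x # z → y # z
  #-congˡ x≈y x#z with #-cotrans x#z _
  ... | inj₁ x#y = contradiction x#y (#-irrefl x≈y)
  ... | inj₂ y#z = y#z

  -- Takes the place of trichotomy. Cotransitivity of apartness separates `z` from `x` or from `y`,
  -- and if it lies on the far side, transitivity yields the other alternative. The negatively
  -- defined `≤` is transitive for this reason.
  <-cotrans : ∀ {x y} → x < y → ∀ z → x < z ⊎ z < y
  <-cotrans x<y z with #-cotrans (<⇒# x<y) z
  ... | inj₁ x#z with #⇒<⊎> x#z
  ...   | inj₁ x<z = inj₁ x<z
  ...   | inj₂ z<x = inj₂ (<-trans z<x x<y)
  <-cotrans x<y z | inj₂ z#y with #⇒<⊎> z#y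
  ...   | inj₁ z<y = inj₂ z<y
  ...   | inj₂ y<z = inj₁ (<-trans x<y y<z)

  <⇒≤ : ∀ {x y} → x < y → x ≤ y
  <⇒≤ = <-asym

  ≤-reflexive : ∀ {x y} → x ≈ y → x ≤ y
  ≤-reflexive x≈y = <-irrefl (≈-sym x≈y)

  ≤-trans : ∀ {x y z} → x ≤ y → y ≤ z → x ≤ z
  ≤-trans {y = y} x≤y y≤z z<x = [ y≤z , x≤y ]′ (<-cotrans z<x y)

  ≤-respʳ-≈ : ∀ {x y z} → y ≈ z → x ≤ y → x ≤ z
  ≤-respʳ-≈ y≈z x≤y = ≤-trans x≤y (≤-reflexive y≈z)

  ≤-respˡ-≈ : ∀ {x y z} → y ≈ z → y ≤ x → z ≤ x
  ≤-respˡ-≈ y≈z y≤x = ≤-trans (≤-reflexive (≈-sym y≈z)) y≤x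

  +-monoˡ-≤ : ∀ {x y} z → x ≤ y → x + z ≤ y + z
  +-monoˡ-≤ {x} {y} z x≤y y+z<x+z = x≤y
    (<-respˡ-≈ (cancel y) (<-respʳ-≈ (cancel x) (+-monoˡ-< (- z) y+z<x+z)))
    where
    cancel : ∀ w → w + z - z ≈ w
    cancel w = solve 2 (λ w z → w :+ z :- z := w) ≈-refl w z

  +-mono-≤ : ∀ {x y u w} → x ≤ y → u ≤ w → x + u ≤ y + w
  +-mono-≤ {x} {y} {u} {w} x≤y u≤w = ≤-trans (+-monoˡ-≤ u x≤y)
    (≤-respˡ-≈ (+-comm u y) (≤-respʳ-≈ (+-comm w y) (+-monoˡ-≤ y u≤w)))

  0≤y-x : ∀ {x y} → x ≤ y → 0# ≤ y - x
  0≤y-x {x} x≤y = ≤-respˡ-≈ (-‿inverseʳ x) (+-monoˡ-≤ (- x) x≤y)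

  0≤y-x⇒x≤y : ∀ {x y} → 0# ≤ y - x → x ≤ y
  0≤y-x⇒x≤y {x} {y} 0≤y-x = ≤-respˡ-≈ (+-identityˡ x)
    (≤-respʳ-≈ (solve 2 (λ x y → y :- x :+ x := y) ≈-refl x y) (+-monoˡ-≤ x 0≤y-x))

  neg-antimono-≤ : ∀ {x y} → x ≤ y → - y ≤ - x
  neg-antimono-≤ {x} {y} x≤y = 0≤y-x⇒x≤y
    (≤-respʳ-≈ (solve 2 (λ x y → y :- x := :- x :- :- y) ≈-refl x y) (0≤y-x x≤y))

  0≤2x⇒0≤x : ∀ {x} → 0# ≤ x + x → 0# ≤ x
  0≤2x⇒0≤x {x} 0≤2x x<0 = 0≤2x (<-trans (+-monoˡ-< x x<0) (<-respˡ-≈ (≈-sym (+-identityˡ x)) x<0))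

  -- If `z` inverts `x * y`, then `y * z` inverts `x`.
  *#0⇒#0 : ∀ {x y} → x * y # 0# → x # 0#
  *#0⇒#0 {x} {y} xy#0 = invertible⇒# (y * z , ≈-trans (*-comm _ _) x*yz≈1 , x*yz≈1)
    where
    z : Carrier
    z = inverse xy#0
    x*yz≈1 : (x - 0#) * (y * z) ≈ 1#
    x*yz≈1 = ≈-trans (solve 3 (λ x y z → (x :- con ℤ.0ℤ) :* (y :* z) := z :* (x :* y :- con ℤ.0ℤ)) ≈-refl x y z)
      (proj₁ (proj₂ (#⇒invertible xy#0)))

  <0⇒0<- : ∀ {x} → x < 0# → 0# < - x
  <0⇒0<- {x} x<0 = <-respˡ-≈ (-‿inverseʳ x) (<-respʳ-≈ (+-identityˡ _) (+-monoˡ-< (- x) x<0))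

  -- As `≤` is a negation, `x * y < 0#` may be assumed. Then both factors are apart from zero, hence
  -- have a sign, although signs are not decidable in general.
  *-nonNeg : ∀ {x y} → 0# ≤ x → 0# ≤ y → 0# ≤ x * y
  *-nonNeg {x} {y} 0≤x 0≤y xy<0 =
    [ 0≤x , (λ 0<x → [ 0≤y , (λ 0<y → <-asym xy<0 (*-pos 0<x 0<y)) ]′ (#⇒<⊎> y#0)) ]′ (#⇒<⊎> x#0)
    where
    x#0 : x # 0#
    x#0 = *#0⇒#0 (<⇒# xy<0)
    y#0 : y # 0#
    y#0 = *#0⇒#0 (#-congˡ (*-comm x y) (<⇒# xy<0))

  square-nonNeg : ∀ x → 0# ≤ x * x
  square-nonNeg x xx<0 =
    [ (λ x<0 → <-asym xx<0 (<-respʳ-≈ (solve 1 (λ x → (:- x) :* (:- x) := x :* x) ≈-refl x)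
                 (*-pos (<0⇒0<- x<0) (<0⇒0<- x<0))))
    , (λ 0<x → <-asym xx<0 (*-pos 0<x 0<x))
    ]′ (#⇒<⊎> (*#0⇒#0 (<⇒# xx<0)))

  *-monoʳ-≤ : ∀ {x y z} → 0# ≤ z → x ≤ y → z * x ≤ z * y
  *-monoʳ-≤ {x} {y} {z} 0≤z x≤y = 0≤y-x⇒x≤y
    (≤-respʳ-≈ (solve 3 (λ x y z → z :* (y :- x) := z :* y :- z :* x) ≈-refl x y z) (*-nonNeg 0≤z (0≤y-x x≤y)))

  fromℕ-cong : ∀ {m n} → m ≡ n → fromℕ m ≈ fromℕ n
  fromℕ-cong refl = ≈-refl

  fromℕ-+ : ∀ m n → fromℕ (m ℕ.+ n) ≈ fromℕ m + fromℕ n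
  fromℕ-+ = ×-homo-+ 1#

  fromℕ-* : ∀ m n → fromℕ (m ℕ.* n) ≈ fromℕ m * fromℕ n
  fromℕ-* = ×1-homo-*

  fromℕ-^ : ∀ m n → fromℕ (m ℕ.^ n) ≈ fromℕ m ^ n
  fromℕ-^ m zero    = +-identityʳ 1#
  fromℕ-^ m (suc n) = ≈-trans (fromℕ-* m (m ℕ.^ n)) (*-congˡ (fromℕ-^ m n))

  fromℕ-nonNeg : ∀ n → 0# ≤ fromℕ n
  fromℕ-nonNeg zero    = <-irrefl ≈-refl
  fromℕ-nonNeg (suc n) = <⇒≤ (0<fromℕ n)

  fromℕ-mono-≤ : ∀ {m n} → m ℕ.≤ n → fromℕ m ≤ fromℕ n
  fromℕ-mono-≤ {n = n} ℕ.z≤n = fromℕ-nonNeg n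
  fromℕ-mono-≤ (ℕ.s≤s m≤n)   = +-mono-≤ (<-irrefl ≈-refl) (fromℕ-mono-≤ m≤n)

  infix 4 _within_

  -- Stands for `∣ x ∣ ≤ B` and unfolds to the pair of inequalities in `O[n^_]`.
  _within_ : Carrier → Carrier → Set ℓ₃
  x within B = - B ≤ x × x ≤ B

  within-respˡ : ∀ {x y B} → x ≈ y → x within B → y within B
  within-respˡ x≈y (l , u) = ≤-respʳ-≈ x≈y l , ≤-respˡ-≈ x≈y u

  within-respʳ : ∀ {x B C} → B ≈ C → x within B → x within C
  within-respʳ B≈C (l , u) = ≤-respˡ-≈ (-‿cong B≈C) l , ≤-respʳ-≈ B≈C u

  within-+ : ∀ {x y B C} → x within B → y within C → x + y within B + C
  within-+ {B = B} {C} (l , u) (l′ , u′) =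
    ≤-respˡ-≈ (solve 2 (λ B C → :- B :+ :- C := :- (B :+ C)) ≈-refl B C) (+-mono-≤ l l′) , +-mono-≤ u u′

  -- 2 (A B − a x) = (A − a) (B + x) + (A + a) (B − x), and likewise with − x for x.
  within-* : ∀ {a x A B} → a within A → x within B → a * x within A * B
  within-* {a} {x} {A} {B} (-A≤a , a≤A) (-B≤x , x≤B) =
    0≤y-x⇒x≤y (0≤2x⇒0≤x (≤-respʳ-≈
      (solve 4 (λ a x A B → (A :- a) :* (B :- x) :+ (a :- :- A) :* (x :- :- B) :=
                            (a :* x :- :- (A :* B)) :+ (a :* x :- :- (A :* B))) ≈-refl a x A B)
      (≤-respˡ-≈ (+-identityʳ 0#) (+-mono-≤
        (*-nonNeg (0≤y-x a≤A) (0≤y-x x≤B)) (*-nonNeg (0≤y-x -A≤a) (0≤y-x -B≤x)))))) ,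
    0≤y-x⇒x≤y (0≤2x⇒0≤x (≤-respʳ-≈
      (solve 4 (λ a x A B → (A :- a) :* (x :- :- B) :+ (a :- :- A) :* (B :- x) :=
                            (A :* B :- a :* x) :+ (A :* B :- a :* x)) ≈-refl a x A B)
      (≤-respˡ-≈ (+-identityʳ 0#) (+-mono-≤
        (*-nonNeg (0≤y-x a≤A) (0≤y-x -B≤x)) (*-nonNeg (0≤y-x -A≤a) (0≤y-x x≤B))))))

  -- The absolute value need not exist constructively; 1 + x² dominates it because
  -- 2 (1 + x² ± x) = (1 + x²) + (1 ± x)².
  within-1+x² : ∀ x → x within 1# + x * x
  within-1+x² x =
    0≤y-x⇒x≤y (0≤2x⇒0≤x (≤-respʳ-≈
      (solve 2 (λ o x → (o :+ x :* x) :+ (o :+ (x :+ x) :+ x :* x) :=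
                        (x :- :- (o :+ x :* x)) :+ (x :- :- (o :+ x :* x))) ≈-refl 1# x)
      (sum-nonNeg (≤-respʳ-≈ (expand x) (square-nonNeg (1# + x)))))) ,
    0≤y-x⇒x≤y (0≤2x⇒0≤x (≤-respʳ-≈
      (solve 2 (λ o x → (o :+ x :* x) :+ (o :+ (:- x :+ :- x) :+ (:- x) :* (:- x)) :=
                        (o :+ x :* x :- x) :+ (o :+ x :* x :- x)) ≈-refl 1# x)
      (sum-nonNeg (≤-respʳ-≈ (expand (- x)) (square-nonNeg (1# + - x))))))
    where
    expand : ∀ y → (1# + y) * (1# + y) ≈ 1# + (y + y) + y * y
    expand y = begin
      (1# + y) * (1# + y)                 ≈⟨ distribʳ _ _ _ ⟩
      1# * (1# + y) + y * (1# + y)        ≈⟨ +-cong (*-identityˡ _) (≈-trans (distribˡ _ _ _) (+-congʳ (*-identityʳ y))) ⟩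
      (1# + y) + (y + y * y)              ≈⟨ solve 3 (λ o y z → (o :+ y) :+ (y :+ z) := o :+ (y :+ y) :+ z) ≈-refl 1# y (y * y) ⟩
      1# + (y + y) + y * y                ∎
    sum-nonNeg : ∀ {z} → 0# ≤ z → 0# ≤ 1# + x * x + z
    sum-nonNeg 0≤z = ≤-respˡ-≈ (+-identityʳ 0#) (+-mono-≤
      (≤-respˡ-≈ (+-identityʳ 0#) (+-mono-≤ (<⇒≤ 0<1) (square-nonNeg x))) 0≤z)

  module _ {v : ℕ} (d : ℕ) where

    private
      O : (∀ n → v ℕ.≤ n → Carrier) → Set _
      O = O[n^ d ] {v}

    O-cong : ∀ {f g} → (∀ n v≤n → f n v≤n ≈ g n v≤n) → O f → O g
    O-cong f≈g (K , N , bound) = K , N , λ n v≤n N≤n → within-respˡ (f≈g n v≤n) (bound n v≤n N≤n)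

    O-+ : ∀ {f g} → O f → O g → O (λ n v≤n → f n v≤n + g n v≤n)
    O-+ (K , N , bound) (L , M , bound′) = K + L , N ℕ.⊔ M , λ n v≤n N⊔M≤n →
      within-respʳ (≈-sym (distribʳ _ K L))
        (within-+ (bound n v≤n (ℕ.m⊔n≤o⇒m≤o N M N⊔M≤n)) (bound′ n v≤n (ℕ.m⊔n≤o⇒n≤o N M N⊔M≤n)))

    O-*ˡ : ∀ a {f} → O f → O (λ n v≤n → a * f n v≤n)
    O-*ˡ a (K , N , bound) = (1# + a * a) * K , N , λ n v≤n N≤n →
      within-respʳ (≈-sym (*-assoc _ K _)) (within-* (within-1+x² a) (bound n v≤n N≤n))

    -- The threshold `1` suits bounds obtained by cancelling powers of `n`. For a natural number the
    -- lower half of the O-bound is automatic.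
    O-fromℕ : ∀ K {f : ∀ n → v ℕ.≤ n → ℕ} → (∀ n v≤n → 1 ℕ.≤ n → f n v≤n ℕ.≤ K ℕ.* n ℕ.^ d) → O (λ n v≤n → fromℕ (f n v≤n))
    O-fromℕ K {f} bound = fromℕ K , 1 , λ n v≤n 1≤n →
      let f≤Knᵈ = ≤-respʳ-≈ (≈-trans (fromℕ-* K (n ℕ.^ d)) (*-congˡ (fromℕ-^ n d))) (fromℕ-mono-≤ (bound n v≤n 1≤n))
      in ≤-trans (≤-respʳ-≈ (≈-trans (≈-sym (+-identityˡ _)) (-‿inverseʳ 0#)) (neg-antimono-≤ (≤-trans (fromℕ-nonNeg (f n v≤n)) f≤Knᵈ)))
                 (fromℕ-nonNeg (f n v≤n)) ,
         f≤Knᵈ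

    O-0 : ∀ {f} → (∀ n v≤n → f n v≤n ≈ 0#) → O f
    O-0 f≈0 = O-cong (λ n v≤n → ≈-sym (f≈0 n v≤n)) (O-fromℕ 0 {λ _ _ → 0} λ _ _ _ → ℕ.z≤n)

    open import Algebra.Properties.CommutativeMonoid.Sum +-commutativeMonoid using (sum)

    O-sum : ∀ m {f : Fin m → ∀ n → v ℕ.≤ n → Carrier} → (∀ k → O (f k)) → O (λ n v≤n → sum λ k → f k n v≤n)
    O-sum zero    _  = O-0 λ _ _ → ≈-refl
    O-sum (suc m) Of = O-+ (Of zero) (O-sum m (Of ∘ suc))

-- Covariances of indicator sums

∣p∪q∣+∣p∩q∣≡∣p∣+∣q∣ : ∀ (p q : Subset n) → ∣ p ∪ q ∣ ℕ.+ ∣ p ∩ q ∣ ≡ ∣ p ∣ ℕ.+ ∣ q ∣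
∣p∪q∣+∣p∩q∣≡∣p∣+∣q∣ []            []            = refl
∣p∪q∣+∣p∩q∣≡∣p∣+∣q∣ (outside ∷ p) (outside ∷ q) = ∣p∪q∣+∣p∩q∣≡∣p∣+∣q∣ p q
∣p∪q∣+∣p∩q∣≡∣p∣+∣q∣ (inside ∷ p)  (outside ∷ q) = cong suc (∣p∪q∣+∣p∩q∣≡∣p∣+∣q∣ p q)
∣p∪q∣+∣p∩q∣≡∣p∣+∣q∣ (outside ∷ p) (inside ∷ q)  =
  trans (cong suc (∣p∪q∣+∣p∩q∣≡∣p∣+∣q∣ p q)) (sym (ℕ.+-suc ∣ p ∣ ∣ q ∣))
∣p∪q∣+∣p∩q∣≡∣p∣+∣q∣ (inside ∷ p)  (inside ∷ q)  = cong suc (trans (ℕ.+-suc ∣ p ∪ q ∣ ∣ p ∩ q ∣)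
  (trans (cong suc (∣p∪q∣+∣p∩q∣≡∣p∣+∣q∣ p q)) (sym (ℕ.+-suc ∣ p ∣ ∣ q ∣))))

∣p∪q∣≡∣p∣+∣q∣∸∣p∩q∣ : ∀ (p q : Subset n) → ∣ p ∪ q ∣ ≡ ∣ p ∣ ℕ.+ ∣ q ∣ ∸ ∣ p ∩ q ∣
∣p∪q∣≡∣p∣+∣q∣∸∣p∩q∣ p q =
  trans (sym (ℕ.m+n∸n≡m ∣ p ∪ q ∣ ∣ p ∩ q ∣)) (cong (_∸ ∣ p ∩ q ∣) (∣p∪q∣+∣p∩q∣≡∣p∣+∣q∣ p q))

module RandomGraphProperties {c ℓ₁ ℓ₂ ℓ₃} (F : OrderedField c ℓ₁ ℓ₂ ℓ₃) where
  open OrderedField F hiding (zero)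
  open RandomGraph F
  open OrderedFieldProperties F
  open IntegerCoefficients commutativeRing using (module Solver)
  open Solver using (solve; con; _:+_; _:*_; _:-_; :-_; _:=_)
  open CommutativeRing commutativeRing using (commutativeSemiring)
  open ListSum commutativeSemiring
  open import Algebra.Properties.Semiring.Mult semiring using (×-assoc-*)
  open import Algebra.Properties.Semiring.Exp semiring using (^-congʳ; ^-homo-*)
  open import Algebra.Properties.CommutativeMonoid.Sum +-commutativeMonoid using (sum)
  open import Relation.Binary.Reasoning.Setoid setoid

  ×ℕ≈* : ∀ n x → n ×ℕ x ≈ fromℕ n * x
  ×ℕ≈* n x = ≈-sym (≈-trans (×-assoc-* n 1# x) (×-cong′ n (*-identityˡ x)))
    where
    ×-cong′ : ∀ n {x y} → x ≈ y → n ×ℕ x ≈ n ×ℕ y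
    ×-cong′ zero    x≈y = ≈-refl
    ×-cong′ (suc n) x≈y = +-cong x≈y (×-cong′ n x≈y)

  ∑-const′ : ∀ (xs : List A) x → ∑ xs (λ _ → x) ≈ fromℕ (length xs) * x
  ∑-const′ xs x = ≈-trans (∑-const xs x) (×ℕ≈* (length xs) x)

  ∑-neg : ∀ (xs : List A) f → ∑ xs (λ x → - f x) ≈ - ∑ xs f
  ∑-neg []       f = solve 0 (con ℤ.0ℤ := :- con ℤ.0ℤ) ≈-refl
  ∑-neg (x ∷ xs) f = ≈-trans (+-congˡ (∑-neg xs f))
    (solve 2 (λ x y → :- x :+ :- y := :- (x :+ y)) ≈-refl (f x) (∑ xs f))

  ∑-- : ∀ (xs : List A) f g → ∑ xs (λ x → f x - g x) ≈ ∑ xs f - ∑ xs g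
  ∑-- xs f g = ≈-trans (∑-+ xs f (λ x → - g x)) (+-congˡ (∑-neg xs g))

  sum≈∑ : ∀ m (f : Fin m → Carrier) → sum f ≈ ∑ (allFin m) f
  sum≈∑ zero    f = ≈-refl
  sum≈∑ (suc m) f = +-congˡ (≈-trans (sum≈∑ m (f ∘ suc))
    (≈-trans (≈-sym (∑-map suc (allFin m) f)) (reflexive (cong (λ xs → ∑ xs f) (map-tabulate id Fin.suc)))))

  fromℕ∣_∣ : ∀ (S : Subset n) → fromℕ ∣ S ∣ ≈ ∑ (allFin n) λ x → 𝟙 (x ∈? S)
  fromℕ∣ S ∣ = ≈-trans (fromℕ-cong (sym (length-elements S))) (length-filter (_∈? S) (allFin _))

  𝟙-* : ∀ {p q r} {P : Set p} {Q : Set q} {R : Set r} (P? : Dec P) (Q? : Dec Q) (R? : Dec R) →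
    (P → Q → R) → (R → P) → (R → Q) → 𝟙 P? * 𝟙 Q? ≈ 𝟙 R?
  𝟙-* (yes p) (yes q) (yes r) _  _  _  = *-identityˡ 1#
  𝟙-* (yes p) (yes q) (no ¬r) pq _  _  = contradiction (pq p q) ¬r
  𝟙-* (no ¬p) _       (yes r) _  rp _  = contradiction (rp r) ¬p
  𝟙-* _       (no ¬q) (yes r) _  _  rq = contradiction (rq r) ¬q
  𝟙-* (no _)  _       (no _)  _  _  _  = zeroˡ _
  𝟙-* (yes _) (no _)  (no _)  _  _  _  = zeroʳ 1#

  -- Exactly one `k < m` equals `h x`, so each term may be spread over all `k` with an indicator;
  -- exchanging the sums then collects equal values.
  ∑-by-value : ∀ (xs : List A) (h : A → ℕ) {m} → (∀ {x} → x ∈ᴸ xs → h x ℕ.< m) → ∀ g →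
    ∑ xs (g ∘ h) ≈ sum {m} λ k → fromℕ (length (filter (λ x → h x ℕ.≟ toℕ k) xs)) * g (toℕ k)
  ∑-by-value xs h {m} h<m g = ≈-sym (begin
    sum {m} (λ k → fromℕ (length (filter (λ x → h x ℕ.≟ toℕ k) xs)) * g (toℕ k))
      ≈⟨ sum≈∑ m _ ⟩
    ∑ (allFin m) (λ k → fromℕ (length (filter (λ x → h x ℕ.≟ toℕ k) xs)) * g (toℕ k))
      ≈⟨ ∑-cong (allFin m) (λ k → ≈-trans (*-congʳ (length-filter (λ x → h x ℕ.≟ toℕ k) xs)) (≈-sym (∑-*ʳ xs _ _))) ⟩
    ∑ (allFin m) (λ k → ∑ xs λ x → 𝟙 (h x ℕ.≟ toℕ k) * g (toℕ k))
      ≈⟨ ∑-swap (allFin m) xs (λ k x → 𝟙 (h x ℕ.≟ toℕ k) * g (toℕ k)) ⟩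
    ∑ xs (λ x → ∑ (allFin m) λ k → 𝟙 (h x ℕ.≟ toℕ k) * g (toℕ k))
      ≈⟨ ∑-cong-∈ xs (λ x∈ → select (h<m x∈)) ⟩
    ∑ xs (g ∘ h) ∎)
    where
    select : ∀ {j} → j ℕ.< m → ∑ (allFin m) (λ k → 𝟙 (j ℕ.≟ toℕ k) * g (toℕ k)) ≈ g j
    select {j} j<m = begin
      ∑ (allFin m) (λ k → 𝟙 (j ℕ.≟ toℕ k) * g (toℕ k))   ≈⟨ ∑-filter j? (allFin m) (g ∘ toℕ) ⟨
      ∑ (filter j? (allFin m)) (g ∘ toℕ)                 ≈⟨ ∑-cong-∈ (filter j? (allFin m)) (λ k∈ → reflexive (cong g (sym (j≡ k∈)))) ⟩
      ∑ (filter j? (allFin m)) (λ _ → g j)               ≈⟨ ∑-const (filter j? (allFin m)) (g j) ⟩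
      length (filter j? (allFin m)) ×ℕ g j               ≡⟨ cong (_×ℕ g j) one ⟩
      1 ×ℕ g j                                           ≈⟨ +-identityʳ (g j) ⟩
      g j                                                ∎
      where
      j? : ∀ k → Dec (j ≡ toℕ k)
      j? k = j ℕ.≟ toℕ k
      j≡ : ∀ {k} → k ∈ᴸ filter j? (allFin m) → j ≡ toℕ k
      j≡ k∈ = proj₂ (∈-filter⁻ j? {xs = allFin m} k∈)
      one : length (filter j? (allFin m)) ≡ 1
      one = length-singleton (Unique.filter⁺ j? (Unique.allFin⁺ m))
        (∈-filter⁺ j? (∈-allFin (Fin.fromℕ< j<m)) (sym (Fin.toℕ-fromℕ< j<m)))
        (λ k∈ → Fin.toℕ-injective (trans (sym (j≡ k∈)) (sym (Fin.toℕ-fromℕ< j<m))))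

  -- Both `T H` and `Tₑ` are of this form up to `≈`, so a single covariance formula yields all the
  -- second moments.
  present : (xs : List A) → (A → EdgeSet n) → RandomVariable n
  present xs S G = ∑ xs λ x → 𝟙 (S x ⊆? edges G)

  Tₑ≈present : ∀ (G : Graph n) → Tₑ G ≈ present (allFin _) ⁅_⁆ G
  Tₑ≈present {n} G = ≈-trans fromℕ∣ edges G ∣ (∑-cong (allFin _) λ e → reflexive
    (𝟙-cong (e ∈? edges G) (⁅ e ⁆ ⊆? edges G)
      (λ e∈ x∈ → subst (_∈ edges G) (sym (x∈⁅y⁆⇒x≡y e x∈)) e∈)
      (λ ⁅e⁆⊆ → ⁅e⁆⊆ (x∈⁅x⁆ e))))


  -- Expectation and covariance in the independent-edge model

  module _ (p : Carrier) where

    weight : Subset n → Carrier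
    weight B = p ^ ∣ B ∣ * (1# - p) ^ ∣ ∁ B ∣

    -- Splitting off one element gives the factor p if it is required and (1 - p) + p = 1 otherwise.
    ∑-weight-⊇ : ∀ n (S : Subset n) → ∑ (subsets n) (λ B → weight B * 𝟙 (S ⊆? B)) ≈ p ^ ∣ S ∣
    ∑-weight-⊇ zero []      = ≈-trans (+-identityʳ _) (≈-trans (*-identityʳ _) (*-identityʳ 1#))
    ∑-weight-⊇ (suc n) (s ∷ S) = begin
      ∑ (subsets (suc n)) (λ B → weight B * 𝟙 (s ∷ S ⊆? B))
        ≈⟨ ∑-++ (map (outside ∷_) (subsets n)) (map (inside ∷_) (subsets n)) _ ⟩
      ∑ (map (outside ∷_) (subsets n)) (λ B → weight B * 𝟙 (s ∷ S ⊆? B)) +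
      ∑ (map (inside ∷_) (subsets n)) (λ B → weight B * 𝟙 (s ∷ S ⊆? B))
        ≈⟨ +-cong (∑-map (outside ∷_) (subsets n) _) (∑-map (inside ∷_) (subsets n) _) ⟩
      ∑ (subsets n) (λ B → weight (outside ∷ B) * 𝟙 (s ∷ S ⊆? outside ∷ B)) +
      ∑ (subsets n) (λ B → weight (inside ∷ B) * 𝟙 (s ∷ S ⊆? inside ∷ B))
        ≈⟨ split s ⟩
      p ^ ∣ s ∷ S ∣ ∎
      where
      Σ-in : ∀ {s} → (∀ B → 𝟙 (s ∷ S ⊆? inside ∷ B) ≡ 𝟙 (S ⊆? B)) →
        ∑ (subsets n) (λ B → weight (inside ∷ B) * 𝟙 (s ∷ S ⊆? inside ∷ B)) ≈ p * p ^ ∣ S ∣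
      Σ-in eq = ≈-trans (∑-cong (subsets n) λ B → ≈-trans
          (*-cong (*-assoc p _ _) (reflexive (eq B))) (*-assoc p _ _))
        (≈-trans (∑-*ˡ (subsets n) p _) (*-congˡ (∑-weight-⊇ n S)))

      split : ∀ s →
        ∑ (subsets n) (λ B → weight (outside ∷ B) * 𝟙 (s ∷ S ⊆? outside ∷ B)) +
        ∑ (subsets n) (λ B → weight (inside ∷ B) * 𝟙 (s ∷ S ⊆? inside ∷ B)) ≈ p ^ ∣ s ∷ S ∣
      split inside = ≈-trans (+-cong
          (≈-trans (∑-cong (subsets n) λ _ → zeroʳ _) (∑-zero (subsets n))) (Σ-in {inside} λ _ → refl))
        (+-identityˡ _)
      split outside = begin
        ∑ (subsets n) (λ B → weight (outside ∷ B) * 𝟙 (S ⊆? B)) + _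
          ≈⟨ +-cong
               (≈-trans (∑-cong (subsets n) λ B → solve 4 (λ x q y z → x :* (q :* y) :* z := q :* (x :* y :* z)) ≈-refl
                 (p ^ ∣ B ∣) (1# - p) ((1# - p) ^ ∣ ∁ B ∣) (𝟙 (S ⊆? B)))
                 (≈-trans (∑-*ˡ (subsets n) (1# - p) _) (*-congˡ (∑-weight-⊇ n S))))
               (Σ-in {outside} λ _ → refl) ⟩
        (1# - p) * p ^ ∣ S ∣ + p * p ^ ∣ S ∣
          ≈⟨ solve 3 (λ o p x → (o :- p) :* x :+ p :* x := o :* x) ≈-refl 1# p (p ^ ∣ S ∣) ⟩
        1# * p ^ ∣ S ∣
          ≈⟨ *-identityˡ _ ⟩
        p ^ ∣ S ∣ ∎

    module _ (n : ℕ) where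

      private
        E : RandomVariable n → Carrier
        E = 𝔼 n p

      𝔼-cong : ∀ {X Y} → (∀ G → X G ≈ Y G) → E X ≈ E Y
      𝔼-cong X≈Y = ∑-cong (graphs n) λ G → *-congˡ (X≈Y G)

      𝔼-+ : ∀ X Y → E (λ G → X G + Y G) ≈ E X + E Y
      𝔼-+ X Y = ≈-trans (∑-cong (graphs n) λ G → distribˡ (prob p G) (X G) (Y G)) (∑-+ (graphs n) _ _)

      𝔼-*ˡ : ∀ a X → E (λ G → a * X G) ≈ a * E X
      𝔼-*ˡ a X = ≈-trans
        (∑-cong (graphs n) λ G → solve 3 (λ w a x → w :* (a :* x) := a :* (w :* x)) ≈-refl (prob p G) a (X G))
        (∑-*ˡ (graphs n) a _)

      𝔼-∑ : ∀ (xs : List A) (X : A → RandomVariable n) → E (λ G → ∑ xs λ x → X x G) ≈ ∑ xs λ x → E (X x)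
      𝔼-∑ xs X = ≈-trans (∑-cong (graphs n) λ G → ≈-sym (∑-*ˡ xs (prob p G) λ x → X x G))
        (∑-swap (graphs n) xs λ G x → prob p G * X x G)

      𝔼-⊇ : ∀ (S : EdgeSet n) → E (λ G → 𝟙 (S ⊆? edges G)) ≈ p ^ ∣ S ∣
      𝔼-⊇ S = ≈-trans (∑-map (graph {n}) (subsets (length (pairs n))) λ G → prob p G * 𝟙 (S ⊆? edges G)) (∑-weight-⊇ _ S)

      -- The total probability is the case of no required edge.
      𝔼-1 : E (λ _ → 1#) ≈ 1#
      𝔼-1 = ≈-trans (𝔼-cong λ G → reflexive (𝟙-cong (yes tt) (⊥ ⊆? edges G) (λ _ → ⊥⊆) (λ _ → tt)))
        (≈-trans (𝔼-⊇ ⊥) (^-congʳ p (∣⊥∣≡0 (length (pairs n)))))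

      Cov≈ : ∀ X Y → Cov n p X Y ≈ E (λ G → X G * Y G) - E X * E Y
      Cov≈ X Y = begin
        E (λ G → (X G - x) * (Y G - y))
          -- The constant `x * y` is given a factor `1#`, so that linearity reduces its expectation
          -- to `𝔼-1`.
          ≈⟨ 𝔼-cong (λ G → ≈-trans
               (solve 4 (λ X Y x y → (X :- x) :* (Y :- y) := X :* Y :+ (((:- y) :* X :+ (:- x) :* Y) :+ x :* y))
                 ≈-refl (X G) (Y G) x y) (+-congˡ (+-congˡ (≈-sym (*-identityʳ _))))) ⟩
        E (λ G → X G * Y G + ((- y * X G + - x * Y G) + x * y * 1#))
          ≈⟨ ≈-trans (𝔼-+ _ _) (+-congˡ (≈-trans (𝔼-+ _ _) (+-congʳ (𝔼-+ _ _)))) ⟩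
        E (λ G → X G * Y G) + ((E (λ G → - y * X G) + E (λ G → - x * Y G)) + E (λ _ → x * y * 1#))
          ≈⟨ +-congˡ (+-cong (+-cong (𝔼-*ˡ _ X) (𝔼-*ˡ _ Y)) (≈-trans (𝔼-*ˡ _ _) (≈-trans (*-congˡ 𝔼-1) (*-identityʳ _)))) ⟩
        E (λ G → X G * Y G) + ((- y * x + - x * y) + x * y)
          ≈⟨ solve 3 (λ e x y → e :+ (((:- y) :* x :+ (:- x) :* y) :+ x :* y) := e :- x :* y) ≈-refl (E (λ G → X G * Y G)) x y ⟩
        E (λ G → X G * Y G) - x * y ∎
        where
        x y : Carrier
        x = E X
        y = E Y

      Cov-cong : ∀ {X X′ Y Y′} → (∀ G → X G ≈ X′ G) → (∀ G → Y G ≈ Y′ G) → Cov n p X Y ≈ Cov n p X′ Y′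
      Cov-cong X≈ Y≈ = 𝔼-cong λ G →
        *-cong (+-cong (X≈ G) (-‿cong (𝔼-cong X≈))) (+-cong (Y≈ G) (-‿cong (𝔼-cong Y≈)))

      Var≈Cov : ∀ X → Var n p X ≈ Cov n p X X
      Var≈Cov X = 𝔼-cong λ G → *-congˡ (*-identityʳ _)

      𝔼-present : ∀ (xs : List A) S → E (present xs S) ≈ ∑ xs λ x → p ^ ∣ S x ∣
      𝔼-present xs S = ≈-trans (𝔼-∑ xs _) (∑-cong xs λ x → 𝔼-⊇ (S x))

      Cov-present : ∀ (xs : List A) S (ys : List B) T → Cov n p (present xs S) (present ys T) ≈
        ∑ xs λ x → ∑ ys λ y → p ^ (∣ S x ∣ ℕ.+ ∣ T y ∣ ∸ ∣ S x ∩ T y ∣) - p ^ (∣ S x ∣ ℕ.+ ∣ T y ∣)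
      Cov-present xs S ys T = begin
        Cov n p (present xs S) (present ys T)
          ≈⟨ Cov≈ _ _ ⟩
        E (λ G → present xs S G * present ys T G) - E (present xs S) * E (present ys T)
          ≈⟨ +-cong
               (≈-trans (𝔼-cong λ G → ≈-trans (∑-*-∑ xs ys _ _) (∑-cong xs λ x → ∑-cong ys λ y → both x y G))
                 (≈-trans (𝔼-∑ xs _) (∑-cong xs λ x → ≈-trans (𝔼-∑ ys _) (∑-cong ys λ y → 𝔼-⊇ (S x ∪ T y)))))
               (-‿cong (≈-trans (*-cong (𝔼-present xs S) (𝔼-present ys T)) (∑-*-∑ xs ys _ _))) ⟩
        ∑ xs (λ x → ∑ ys λ y → p ^ ∣ S x ∪ T y ∣) - ∑ xs (λ x → ∑ ys λ y → p ^ ∣ S x ∣ * p ^ ∣ T y ∣)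
          ≈⟨ ≈-trans (∑-cong xs λ x → ∑-- ys _ _) (∑-- xs _ _) ⟨
        ∑ xs (λ x → ∑ ys λ y → p ^ ∣ S x ∪ T y ∣ - p ^ ∣ S x ∣ * p ^ ∣ T y ∣)
          -- The exponent of the union is rewritten through sizes and overlap, so that for sets of
          -- equal size only the overlap varies.
          ≈⟨ ∑-cong xs (λ x → ∑-cong ys λ y → +-cong
               (^-congʳ p (∣p∪q∣≡∣p∣+∣q∣∸∣p∩q∣ (S x) (T y))) (-‿cong (≈-sym (^-homo-* p ∣ S x ∣ ∣ T y ∣)))) ⟩
        ∑ xs (λ x → ∑ ys λ y → p ^ (∣ S x ∣ ℕ.+ ∣ T y ∣ ∸ ∣ S x ∩ T y ∣) - p ^ (∣ S x ∣ ℕ.+ ∣ T y ∣)) ∎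
        where
        both : ∀ x y G → 𝟙 (S x ⊆? edges G) * 𝟙 (T y ⊆? edges G) ≈ 𝟙 (S x ∪ T y ⊆? edges G)
        both x y G = 𝟙-* (S x ⊆? edges G) (T y ⊆? edges G) (S x ∪ T y ⊆? edges G)
          (λ Sx⊆ Ty⊆ e∈ → [ (λ e∈ → Sx⊆ e∈) , (λ e∈ → Ty⊆ e∈) ]′ (x∈p∪q⁻ (S x) (T y) e∈))
          (λ ∪⊆ e∈ → ∪⊆ (p⊆p∪q {p = S x} (T y) e∈))
          (λ ∪⊆ e∈ → ∪⊆ (q⊆p∪q (S x) (T y) e∈))

      -- An edge outside `S x` has covariance zero with the indicator of `S x`, so every `x`
      -- contributes the same amount for each of its `s` edges.
      Cov-present-Tₑ : ∀ (xs : List A) S {s} → (∀ {x} → x ∈ᴸ xs → ∣ S x ∣ ≡ s) →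
        Cov n p (present xs S) Tₑ ≈ fromℕ (length xs) * fromℕ s * (p ^ s - p ^ suc s)
      Cov-present-Tₑ xs S {s} ∣S∣≡s = begin
        Cov n p (present xs S) Tₑ
          ≈⟨ Cov-cong (λ _ → ≈-refl) Tₑ≈present ⟩
        Cov n p (present xs S) (present (allFin _) ⁅_⁆)
          ≈⟨ Cov-present xs S (allFin _) ⁅_⁆ ⟩
        ∑ xs (λ x → ∑ (allFin _) λ e → p ^ (∣ S x ∣ ℕ.+ ∣ ⁅ e ⁆ ∣ ∸ ∣ S x ∩ ⁅ e ⁆ ∣) - p ^ (∣ S x ∣ ℕ.+ ∣ ⁅ e ⁆ ∣))
          ≈⟨ ∑-cong-∈ xs (λ {x} x∈ → ≈-trans
               (∑-cong (allFin _) λ e → term (S x) e (∣S∣≡s x∈))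
               (≈-trans (∑-*ʳ (allFin _) (p ^ s - p ^ suc s) λ e → 𝟙 (e ∈? S x))
                 (*-congʳ (≈-trans (≈-sym fromℕ∣ S x ∣) (fromℕ-cong (∣S∣≡s x∈)))))) ⟩
        ∑ xs (λ x → fromℕ s * (p ^ s - p ^ suc s))
          ≈⟨ ≈-trans (∑-const′ xs _) (≈-sym (*-assoc _ _ _)) ⟩
        fromℕ (length xs) * fromℕ s * (p ^ s - p ^ suc s) ∎
        where
        term : ∀ (U : EdgeSet n) e → ∣ U ∣ ≡ s →
          p ^ (∣ U ∣ ℕ.+ ∣ ⁅ e ⁆ ∣ ∸ ∣ U ∩ ⁅ e ⁆ ∣) - p ^ (∣ U ∣ ℕ.+ ∣ ⁅ e ⁆ ∣) ≈ 𝟙 (e ∈? U) * (p ^ s - p ^ suc s)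
        term U e ∣U∣≡s rewrite ∣U∣≡s | ∣⁅x⁆∣≡1 e | ℕ.+-comm s 1 = by-cases (e ∈? U)
          where
          by-cases : (d : Dec (e ∈ U)) → p ^ (suc s ∸ ∣ U ∩ ⁅ e ⁆ ∣) - p ^ suc s ≈ 𝟙 d * (p ^ s - p ^ suc s)
          by-cases (yes e∈U) = ≈-trans
            (+-congʳ (^-congʳ p (cong (suc s ∸_) (trans (cong ∣_∣ U∩e≡e) (∣⁅x⁆∣≡1 e)))))
            (≈-sym (*-identityˡ _))
            where
            U∩e≡e : U ∩ ⁅ e ⁆ ≡ ⁅ e ⁆
            U∩e≡e = ⊆-antisym (p∩q⊆q U ⁅ e ⁆)
              (λ x∈ → x∈p∩q⁺ (subst (_∈ U) (sym (x∈⁅y⁆⇒x≡y e x∈)) e∈U , x∈))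
          by-cases (no e∉U) = ≈-trans
            (+-congʳ (^-congʳ p (cong (suc s ∸_) (trans (cong ∣_∣ U∩e≡⊥) (∣⊥∣≡0 (length (pairs n)))))))
            (≈-trans (-‿inverseʳ _) (≈-sym (zeroˡ _)))
            where
            U∩e≡⊥ : U ∩ ⁅ e ⁆ ≡ ⊥
            U∩e≡⊥ = Empty-unique λ (x , x∈) →
              let x∈U , x∈e = x∈p∩q⁻ U ⁅ e ⁆ x∈ in e∉U (subst (_∈ U) (x∈⁅y⁆⇒x≡y e x∈e) x∈U)

      Var-Tₑ : Var n p Tₑ ≈ fromℕ (length (pairs n)) * (p - p ^ 2)
      Var-Tₑ = begin
        Var n p Tₑ
          ≈⟨ ≈-trans (Var≈Cov Tₑ) (Cov-cong Tₑ≈present λ _ → ≈-refl) ⟩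
        Cov n p (present (allFin _) ⁅_⁆) Tₑ
          ≈⟨ Cov-present-Tₑ (allFin _) ⁅_⁆ {1} (λ {e} _ → ∣⁅x⁆∣≡1 e) ⟩
        fromℕ (length (allFin (length (pairs n)))) * fromℕ 1 * (p ^ 1 - p ^ 2)
          ≈⟨ *-cong (≈-trans (*-cong (fromℕ-cong (length-tabulate {n = length (pairs n)} id)) (+-identityʳ 1#)) (*-identityʳ _))
                    (+-congʳ (*-identityʳ p)) ⟩
        fromℕ (length (pairs n)) * (p - p ^ 2) ∎

-- Moments of the number of copies

nP≡nP′ : k ℕ.≤ n → n P k ≡ n P′ k
nP≡nP′ {k} {n} k≤n with k ℕ.≤ᵇ n | ℕ.≤⇒≤ᵇ k≤n
... | true | _ = refl

-- The coefficient `v (v - 1) / 2` as the sum `0 + 1 + ⋯ + (v - 1)`, which follows the recursion of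
-- `_P′_` and involves no division.
triangle : ℕ → ℕ
triangle zero    = 0
triangle (suc v) = triangle v ℕ.+ v

triangle-*-2 : ∀ v → triangle v ℕ.* 2 ≡ v ℕ.* (v ∸ 1)
triangle-*-2 zero          = refl
triangle-*-2 (suc zero)    = refl
triangle-*-2 (suc (suc v)) = begin
  (triangle (suc v) ℕ.+ suc v) ℕ.* 2    ≡⟨ ℕ.*-distribʳ-+ 2 (triangle (suc v)) (suc v) ⟩
  triangle (suc v) ℕ.* 2 ℕ.+ suc v ℕ.* 2 ≡⟨ cong (ℕ._+ suc v ℕ.* 2) (triangle-*-2 (suc v)) ⟩
  suc v ℕ.* v ℕ.+ suc v ℕ.* 2           ≡⟨ solve 1 (λ v → (con 1 :+ v) :* v :+ (con 1 :+ v) :* con 2 := (con 2 :+ v) :* (con 1 :+ v)) refl v ⟩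
  suc (suc v) ℕ.* suc v                 ∎
  where
  open ≡-Reasoning
  open +-*-Solver

-- The expansion n (n − 1) ⋯ (n + 1 − v) = nᵛ − v (v − 1) / 2 nᵛ⁻¹ + O(nᵛ⁻²), multiplied by a power
-- of n so that no exponent is truncated.
nP′v-lower : ∀ n v → n ℕ.* n ℕ.^ v ℕ.≤ n ℕ.* (n P′ v) ℕ.+ triangle v ℕ.* n ℕ.^ v
nP′v-lower n zero    = ℕ.m≤m+n _ _
nP′v-lower n (suc v) = begin
  n ℕ.* (n ℕ.* nᵛ)
    ≤⟨ ℕ.*-monoʳ-≤ n (nP′v-lower n v) ⟩
  n ℕ.* (n ℕ.* (n P′ v) ℕ.+ t ℕ.* nᵛ)
    ≤⟨ ℕ.*-monoʳ-≤ n (ℕ.+-monoˡ-≤ (t ℕ.* nᵛ) (ℕ.*-monoˡ-≤ (n P′ v) (ℕ.≤-trans (ℕ.m≤n+m∸n n v) (ℕ.≤-reflexive (ℕ.+-comm v (n ∸ v)))))) ⟩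
  n ℕ.* ((n ∸ v ℕ.+ v) ℕ.* (n P′ v) ℕ.+ t ℕ.* nᵛ)
    ≡⟨ solve 6 (λ n d v a t x → n :* ((d :+ v) :* a :+ t :* x) := n :* (d :* a) :+ (t :* (n :* x) :+ n :* (v :* a))) refl n (n ∸ v) v (n P′ v) t nᵛ ⟩
  n ℕ.* (n P′ suc v) ℕ.+ (t ℕ.* (n ℕ.* nᵛ) ℕ.+ n ℕ.* (v ℕ.* (n P′ v)))
    ≤⟨ ℕ.+-monoʳ-≤ (n ℕ.* (n P′ suc v)) (ℕ.+-monoʳ-≤ (t ℕ.* (n ℕ.* nᵛ)) (ℕ.*-monoʳ-≤ n (ℕ.*-monoʳ-≤ v (nP′v≤nᵛ n v)))) ⟩
  n ℕ.* (n P′ suc v) ℕ.+ (t ℕ.* (n ℕ.* nᵛ) ℕ.+ n ℕ.* (v ℕ.* nᵛ))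
    ≡⟨ solve 5 (λ p t v n x → p :+ (t :* (n :* x) :+ n :* (v :* x)) := p :+ (t :+ v) :* (n :* x)) refl (n ℕ.* (n P′ suc v)) t v n nᵛ ⟩
  n ℕ.* (n P′ suc v) ℕ.+ triangle (suc v) ℕ.* n ℕ.^ suc v ∎
  where
  open ℕ.≤-Reasoning
  open +-*-Solver
  t nᵛ : ℕ
  t = triangle v
  nᵛ = n ℕ.^ v
  nP′v≤nᵛ : ∀ n v → n P′ v ℕ.≤ n ℕ.^ v
  nP′v≤nᵛ n zero    = ℕ.≤-refl
  nP′v≤nᵛ n (suc v) = ℕ.*-mono-≤ (ℕ.m∸n≤m n v) (nP′v≤nᵛ n v)

-- The new factor `n - v` subtracts `v` times the old product, so the upper bound for `suc v` rests
-- on the lower bound for `v`. Its error term contributes `v` times `triangle v` to the constant.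
-- The subtracted amount is added on both sides and cancelled at the end.
nP′v-upper : ∀ v → ∃ λ K → ∀ n → v ℕ.≤ n →
  n ℕ.* n ℕ.* (n P′ v) ℕ.+ triangle v ℕ.* n ℕ.* n ℕ.^ v ℕ.≤ n ℕ.* n ℕ.* n ℕ.^ v ℕ.+ K ℕ.* n ℕ.^ v
nP′v-upper zero    = 0 , λ n _ → ℕ.≤-refl
nP′v-upper (suc v) = let K , bound = nP′v-upper v in K ℕ.+ v ℕ.* triangle v , λ n v<n → step n K v<n (bound n (ℕ.<⇒≤ v<n))
  where
  open +-*-Solver
  t = triangle v
  step : ∀ n K → v ℕ.< n →
    n ℕ.* n ℕ.* (n P′ v) ℕ.+ t ℕ.* n ℕ.* n ℕ.^ v ℕ.≤ n ℕ.* n ℕ.* n ℕ.^ v ℕ.+ K ℕ.* n ℕ.^ v →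
    n ℕ.* n ℕ.* (n P′ suc v) ℕ.+ triangle (suc v) ℕ.* n ℕ.* n ℕ.^ suc v ℕ.≤ n ℕ.* n ℕ.* n ℕ.^ suc v ℕ.+ (K ℕ.+ v ℕ.* t) ℕ.* n ℕ.^ suc v
  step n K v<n bound = ℕ.+-cancelʳ-≤ (n ℕ.* n ℕ.* (v ℕ.* α)) _ _ (begin
    n ℕ.* n ℕ.* ((n ∸ v) ℕ.* α) ℕ.+ (t ℕ.+ v) ℕ.* n ℕ.* (n ℕ.* x) ℕ.+ n ℕ.* n ℕ.* (v ℕ.* α)
      ≡⟨ solve 6 (λ n d v a t x → n :* n :* (d :* a) :+ (t :+ v) :* n :* (n :* x) :+ n :* n :* (v :* a) :=
                                  n :* n :* ((d :+ v) :* a) :+ (t :+ v) :* n :* (n :* x)) refl n (n ∸ v) v α t x ⟩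
    n ℕ.* n ℕ.* ((n ∸ v ℕ.+ v) ℕ.* α) ℕ.+ (t ℕ.+ v) ℕ.* n ℕ.* (n ℕ.* x)
      ≡⟨ cong (λ z → n ℕ.* n ℕ.* (z ℕ.* α) ℕ.+ (t ℕ.+ v) ℕ.* n ℕ.* (n ℕ.* x)) (ℕ.m∸n+n≡m (ℕ.<⇒≤ v<n)) ⟩
    n ℕ.* n ℕ.* (n ℕ.* α) ℕ.+ (t ℕ.+ v) ℕ.* n ℕ.* (n ℕ.* x)
      ≡⟨ solve 5 (λ n v a t x → n :* n :* (n :* a) :+ (t :+ v) :* n :* (n :* x) :=
                                n :* (n :* n :* a :+ t :* n :* x) :+ v :* n :* (n :* x)) refl n v α t x ⟩
    n ℕ.* (n ℕ.* n ℕ.* α ℕ.+ t ℕ.* n ℕ.* x) ℕ.+ v ℕ.* n ℕ.* (n ℕ.* x)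
      ≤⟨ ℕ.+-mono-≤ (ℕ.*-monoʳ-≤ n bound) (ℕ.*-monoʳ-≤ (v ℕ.* n) (nP′v-lower n v)) ⟩
    n ℕ.* (n ℕ.* n ℕ.* x ℕ.+ K ℕ.* x) ℕ.+ v ℕ.* n ℕ.* (n ℕ.* α ℕ.+ t ℕ.* x)
      ≡⟨ solve 6 (λ n v a t x K → n :* (n :* n :* x :+ K :* x) :+ v :* n :* (n :* a :+ t :* x) :=
                                  n :* n :* (n :* x) :+ (K :+ v :* t) :* (n :* x) :+ n :* n :* (v :* a)) refl n v α t x K ⟩
    n ℕ.* n ℕ.* (n ℕ.* x) ℕ.+ (K ℕ.+ v ℕ.* t) ℕ.* (n ℕ.* x) ℕ.+ n ℕ.* n ℕ.* (v ℕ.* α) ∎)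
    where
    open ℕ.≤-Reasoning
    α x : ℕ
    α = n P′ v
    x = n ℕ.^ v

nᵛ≤nP′v+tnᵛ⁻¹ : ∀ {v n} → 2 ℕ.≤ v → 1 ℕ.≤ n → n ℕ.^ v ℕ.≤ n P′ v ℕ.+ triangle v ℕ.* n ℕ.^ (v ∸ 1)
nᵛ≤nP′v+tnᵛ⁻¹ {suc zero} (ℕ.s≤s ())
nᵛ≤nP′v+tnᵛ⁻¹ {v@(suc (suc w))} {n@(suc _)} _ _ = ℕ.*-cancelˡ-≤ n (ℕ.≤-trans (nP′v-lower n v)
  (ℕ.≤-reflexive (solve 4 (λ n a t x → n :* a :+ t :* (n :* x) := n :* (a :+ t :* x)) refl n (n P′ v) (triangle v) (n ℕ.^ suc w))))
  where open +-*-Solver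

nP′v+tnᵛ⁻¹≤nᵛ+Knᵛ⁻² : ∀ {v} → 2 ℕ.≤ v → ∃ λ K → ∀ n → v ℕ.≤ n → 1 ℕ.≤ n →
  n P′ v ℕ.+ triangle v ℕ.* n ℕ.^ (v ∸ 1) ℕ.≤ n ℕ.^ v ℕ.+ K ℕ.* n ℕ.^ (v ∸ 2)
nP′v+tnᵛ⁻¹≤nᵛ+Knᵛ⁻² {suc zero} (ℕ.s≤s ())
nP′v+tnᵛ⁻¹≤nᵛ+Knᵛ⁻² {v@(suc (suc w))} _ = let K , bound = nP′v-upper v in
  K , λ n v≤n 1≤n → cancel-n² K n 1≤n (bound n v≤n)
  where
  open +-*-Solver
  cancel-n² : ∀ K n → 1 ℕ.≤ n →
    n ℕ.* n ℕ.* (n P′ v) ℕ.+ triangle v ℕ.* n ℕ.* n ℕ.^ v ℕ.≤ n ℕ.* n ℕ.* n ℕ.^ v ℕ.+ K ℕ.* n ℕ.^ v →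
    n P′ v ℕ.+ triangle v ℕ.* n ℕ.^ suc w ℕ.≤ n ℕ.^ v ℕ.+ K ℕ.* n ℕ.^ w
  cancel-n² K n@(suc _) _ bound = ℕ.*-cancelˡ-≤ (n ℕ.* n) (subst₂ ℕ._≤_
    (solve 4 (λ n a t x → n :* n :* a :+ t :* n :* (n :* x) := n :* n :* (a :+ t :* x)) refl n (n P′ v) (triangle v) (n ℕ.^ suc w))
    (solve 3 (λ n x K → n :* n :* (n :* (n :* x)) :+ K :* (n :* (n :* x)) := n :* n :* (n :* (n :* x) :+ K :* x)) refl n (n ℕ.^ w) K)
    bound)

numPairs-≤ : ∀ (H : Graph v) {k m} → m ℕ.* suc m ℕ.< 2 ℕ.* k → 2 ℕ.+ m ℕ.≤ 2 ℕ.* v → ∀ n → 1 ℕ.≤ n →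
  numPairs H n k ℕ.≤ suc v ℕ.^ v ℕ.* n ℕ.^ (2 ℕ.* v ∸ (2 ℕ.+ m))
numPairs-≤ {v} H {k} {m} m[m+1]<2k m+2≤2v n@(suc _) _ =
  ℕ.*-cancelʳ-≤ _ _ (n ℕ.^ (2 ℕ.+ m)) {{ℕ.m^n≢0 n (2 ℕ.+ m)}} (begin
    numPairs H n k ℕ.* n ℕ.^ (2 ℕ.+ m)                        ≤⟨ numPairs-bound H {k} {m} m[m+1]<2k n ⟩
    K ℕ.* n ℕ.^ (2 ℕ.* v)                                     ≡⟨ cong (λ d → K ℕ.* n ℕ.^ d) (ℕ.m∸n+n≡m m+2≤2v) ⟨
    K ℕ.* n ℕ.^ (2 ℕ.* v ∸ (2 ℕ.+ m) ℕ.+ (2 ℕ.+ m))           ≡⟨ cong (K ℕ.*_) (ℕ.^-distribˡ-+-* n (2 ℕ.* v ∸ (2 ℕ.+ m)) (2 ℕ.+ m)) ⟩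
    K ℕ.* (n ℕ.^ (2 ℕ.* v ∸ (2 ℕ.+ m)) ℕ.* n ℕ.^ (2 ℕ.+ m))   ≡⟨ ℕ.*-assoc K _ _ ⟨
    K ℕ.* n ℕ.^ (2 ℕ.* v ∸ (2 ℕ.+ m)) ℕ.* n ℕ.^ (2 ℕ.+ m)     ∎)
  where
  open ℕ.≤-Reasoning
  K : ℕ
  K = suc v ℕ.^ v

-- Exact formulas and asymptotics for the number of copies

module SubgraphCounts {c ℓ₁ ℓ₂ ℓ₃} (F : OrderedField c ℓ₁ ℓ₂ ℓ₃) {v} (H : Graph v) where
  open OrderedField F hiding (zero)
  open RandomGraph F
  open OrderedFieldProperties F
  open RandomGraphProperties F
  open IntegerCoefficients commutativeRing using (module Solver)
  open Solver using (solve; con; _:+_; _:*_; _:-_; _:^_; :-_; _:=_)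
  open CommutativeRing commutativeRing using (commutativeSemiring)
  open ListSum commutativeSemiring
  open import Algebra.Properties.Semiring.Exp semiring using (^-congʳ; ^-congˡ; ^-homo-*)
  open import Algebra.Properties.CommutativeMonoid.Sum +-commutativeMonoid using (sum)
  open import Relation.Binary.Reasoning.Setoid setoid

  private
    ℓ : ℕ
    ℓ = numEdges H

    copyEdges : Subgraph n → EdgeSet n
    copyEdges S = edges (graphOn S)

    copies′ : ∀ n → List (Subgraph n)
    copies′ n = copies {H = H} n

    c′ : ℕ → Carrier
    c′ n = fromℕ (numCopies H (complete n))

  x*inverse≈1 : ∀ {x} (x#0 : x # 0#) → x * inverse x#0 ≈ 1#
  x*inverse≈1 {x} x#0 = ≈-trans (*-congʳ (solve 1 (λ x → x := x :- con ℤ.0ℤ) ≈-refl x))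
    (proj₂ (proj₂ (#⇒invertible x#0)))

  fromℕ-∸ : ∀ {m n} → n ℕ.≤ m → fromℕ (m ∸ n) ≈ fromℕ m - fromℕ n
  fromℕ-∸ {m} {n} n≤m = begin
    fromℕ (m ∸ n)                      ≈⟨ solve 2 (λ x y → x := x :+ y :- y) ≈-refl (fromℕ (m ∸ n)) (fromℕ n) ⟩
    fromℕ (m ∸ n) + fromℕ n - fromℕ n  ≈⟨ +-congʳ (fromℕ-+ (m ∸ n) n) ⟨
    fromℕ (m ∸ n ℕ.+ n) - fromℕ n      ≈⟨ +-congʳ (fromℕ-cong (ℕ.m∸n+n≡m n≤m)) ⟩
    fromℕ m - fromℕ n                  ∎

  ∣Aut∣⁻¹ : Carrier
  ∣Aut∣⁻¹ = inverse (fromℕ#0 ∣Aut H ∣ {{∣Aut∣-nonZero H}})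

  numCopies≈c : ∀ {n} → v ℕ.≤ n → c′ n ≈ c[ H ] n
  numCopies≈c {n} v≤n = begin
    c′ n                                         ≈⟨ *-identityʳ _ ⟨
    c′ n * 1#                                    ≈⟨ *-congˡ (x*inverse≈1 _) ⟨
    c′ n * (fromℕ ∣Aut H ∣ * ∣Aut∣⁻¹)             ≈⟨ *-assoc _ _ _ ⟨
    c′ n * fromℕ ∣Aut H ∣ * ∣Aut∣⁻¹               ≈⟨ *-congʳ (fromℕ-* (numCopies H (complete n)) ∣Aut H ∣) ⟨
    fromℕ (numCopies H (complete n) ℕ.* ∣Aut H ∣) * ∣Aut∣⁻¹
      ≈⟨ *-congʳ (fromℕ-cong (trans (numCopies-*-automorphisms H n) (sym (nP≡nP′ v≤n)))) ⟩
    fromℕ (n P v) * ∣Aut∣⁻¹                       ∎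

  size-of-copy : ∀ {n} {S : Subgraph n} → S ∈ᴸ copies′ n → ∣ copyEdges S ∣ ≡ ℓ
  size-of-copy S∈ = let S⊆ , _ , iso = ∈-copies⁻ {H = H} S∈ in numEdges-isomorphic S⊆ iso

  -- A copy in `G` is a copy in the complete graph whose edges all lie in `G`: the conditions on
  -- ends and on the isomorphism do not mention `G`.
  T≈present : ∀ {n} (G : Graph n) → T H G ≈ present (copies′ n) copyEdges G
  T≈present {n} G = begin
    T H G
      ≈⟨ length-filter (isCopyIn? H G) (subgraphs n) ⟩
    ∑ (subgraphs n) (λ S → 𝟙 (isCopyIn? H G S))
      ≈⟨ ∑-cong (subgraphs n) (λ S → 𝟙-* (isCopyIn? H (complete n) S) (copyEdges S ⊆? edges G) (isCopyIn? H G S)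
           (λ ((_ , ends) , iso) S⊆G → ((λ e∈ → S⊆G e∈) , ends) , iso)
           (λ ((_ , ends) , iso) → ((λ _ → ∈⊤) , ends) , iso)
           (λ ((S⊆G , _) , _) → S⊆G)) ⟨
    ∑ (subgraphs n) (λ S → 𝟙 (isCopyIn? H (complete n) S) * 𝟙 (copyEdges S ⊆? edges G))
      ≈⟨ ∑-filter (isCopyIn? H (complete n)) (subgraphs n) _ ⟨
    present (copies′ n) copyEdges G ∎

  -- The range is left open: the exact formulas take `m = suc ℓ`, the residual asymptotics the
  -- longer range `4 ℕ.+ ℓ`.
  ∑-over-pairs : ∀ n {m} → ℓ ℕ.< m → ∀ g →
    ∑ (copies′ n) (λ S → ∑ (copies′ n) λ S′ → g (numSharedEdges S S′)) ≈ sum {m} λ k → C[ H ] n (toℕ k) * g (toℕ k)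
  ∑-over-pairs n ℓ<m g = ≈-trans (≈-sym (∑-cartesianProductWith _,_ (copies′ n) (copies′ n) _))
    (∑-by-value (cartesianProduct (copies′ n) (copies′ n)) (uncurry numSharedEdges) shared<m g)
    where
    shared<m : ∀ {SS′} → SS′ ∈ᴸ cartesianProduct (copies′ n) (copies′ n) → uncurry numSharedEdges SS′ ℕ.< _
    shared<m {S , S′} SS′∈ = ℕ.≤-<-trans (∣p∩q∣≤∣p∣ (copyEdges S) (copyEdges S′))
      (subst (ℕ._< _) (sym (size-of-copy (proj₁ (∈-cartesianProduct⁻ (copies′ n) (copies′ n) SS′∈)))) ℓ<m)

  -- By edge transitivity every edge lies in the same number M of copies, so with N = |pairs n|
  -- the sum is N M² and c ℓ = N M.
  shared-edges-total : ∀ {n} → Edge n → fromℕ (length (pairs n)) *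
    ∑ (copies′ n) (λ S → ∑ (copies′ n) λ S′ → fromℕ (numSharedEdges S S′)) ≈ (c′ n * fromℕ ℓ) * (c′ n * fromℕ ℓ)
  shared-edges-total {n} e₀ = begin
    N * ∑ cs (λ S → ∑ cs λ S′ → fromℕ (numSharedEdges S S′))
      ≈⟨ *-congˡ total ⟩
    N * (N * (M * M))
      ≈⟨ solve 2 (λ N M → N :* (N :* (M :* M)) := (N :* M) :* (N :* M)) ≈-refl N M ⟩
    (N * M) * (N * M)
      ≈⟨ *-cong incidences incidences ⟨
    (c′ n * fromℕ ℓ) * (c′ n * fromℕ ℓ) ∎
    where
    cs : List (Subgraph n)
    cs = copies′ n
    es : List (Edge n)
    es = allFin (length (pairs n))
    N M : Carrier
    N = fromℕ (length (pairs n))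
    M = fromℕ (length (filter (λ S → e₀ ∈? copyEdges S) cs))

    through : ∀ e → ∑ cs (λ S → 𝟙 (e ∈? copyEdges S)) ≈ M
    through e = ≈-trans (≈-sym (length-filter (λ S → e ∈? copyEdges S) cs))
      (fromℕ-cong (copies-through-const {H = H} {n = n} e e₀))

    ∑-es : ∀ x → ∑ es (λ _ → x) ≈ N * x
    ∑-es x = ≈-trans (∑-const′ es x) (*-congʳ (fromℕ-cong (length-tabulate {n = length (pairs n)} id)))

    incidences : c′ n * fromℕ ℓ ≈ N * M
    incidences = begin
      c′ n * fromℕ ℓ                                  ≈⟨ ∑-const′ cs (fromℕ ℓ) ⟨
      ∑ cs (λ _ → fromℕ ℓ)                            ≈⟨ ∑-cong-∈ cs (λ {S} S∈ → ≈-trans (fromℕ-cong (sym (size-of-copy S∈))) fromℕ∣ copyEdges S ∣) ⟩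
      ∑ cs (λ S → ∑ es λ e → 𝟙 (e ∈? copyEdges S))    ≈⟨ ∑-swap cs es (λ S e → 𝟙 (e ∈? copyEdges S)) ⟩
      ∑ es (λ e → ∑ cs λ S → 𝟙 (e ∈? copyEdges S))    ≈⟨ ∑-cong es through ⟩
      ∑ es (λ _ → M)                                  ≈⟨ ∑-es M ⟩
      N * M                                           ∎

    total : ∑ cs (λ S → ∑ cs λ S′ → fromℕ (numSharedEdges S S′)) ≈ N * (M * M)
    total = begin
      ∑ cs (λ S → ∑ cs λ S′ → fromℕ (numSharedEdges S S′))
        ≈⟨ ∑-cong cs (λ S → ∑-cong cs λ S′ → ≈-trans fromℕ∣ copyEdges S ∩ copyEdges S′ ∣
             (∑-cong es λ e → ≈-sym (𝟙-* (e ∈? copyEdges S) (e ∈? copyEdges S′) (e ∈? copyEdges S ∩ copyEdges S′)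
               (λ e∈ e∈′ → x∈p∩q⁺ (e∈ , e∈′)) (proj₁ ∘ x∈p∩q⁻ _ _) (proj₂ ∘ x∈p∩q⁻ (copyEdges S) _)))) ⟩
      ∑ cs (λ S → ∑ cs λ S′ → ∑ es λ e → 𝟙 (e ∈? copyEdges S) * 𝟙 (e ∈? copyEdges S′))
        ≈⟨ ∑-cong cs (λ S → ∑-swap cs es λ S′ e → 𝟙 (e ∈? copyEdges S) * 𝟙 (e ∈? copyEdges S′)) ⟩
      ∑ cs (λ S → ∑ es λ e → ∑ cs λ S′ → 𝟙 (e ∈? copyEdges S) * 𝟙 (e ∈? copyEdges S′))
        ≈⟨ ∑-swap cs es (λ S e → ∑ cs λ S′ → 𝟙 (e ∈? copyEdges S) * 𝟙 (e ∈? copyEdges S′)) ⟩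
      ∑ es (λ e → ∑ cs λ S → ∑ cs λ S′ → 𝟙 (e ∈? copyEdges S) * 𝟙 (e ∈? copyEdges S′))
        ≈⟨ ∑-cong es (λ e → ≈-trans (≈-sym (∑-*-∑ cs cs _ _)) (*-cong (through e) (through e))) ⟩
      ∑ es (λ _ → M * M)
        ≈⟨ ∑-es (M * M) ⟩
      N * (M * M) ∎

  module _ (p : Carrier) where

    𝔼-T : ∀ {n} → v ℕ.≤ n → 𝔼 n p (T H) ≈ c[ H ] n * p ^ ℓ
    𝔼-T {n} v≤n = begin
      𝔼 n p (T H)                                       ≈⟨ 𝔼-cong p n (T≈present) ⟩
      𝔼 n p (present (copies′ n) copyEdges)           ≈⟨ 𝔼-present p n (copies′ n) copyEdges ⟩
      ∑ (copies′ n) (λ S → p ^ ∣ copyEdges S ∣)         ≈⟨ ∑-cong-∈ (copies′ n) (λ S∈ → ^-congʳ p (size-of-copy S∈)) ⟩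
      ∑ (copies′ n) (λ _ → p ^ ℓ)                       ≈⟨ ∑-const′ (copies′ n) (p ^ ℓ) ⟩
      c′ n * p ^ ℓ                                      ≈⟨ *-congʳ (numCopies≈c v≤n) ⟩
      c[ H ] n * p ^ ℓ                                  ∎

    varTerm resTerm : ℕ → Carrier
    varTerm k = p ^ (2 ℕ.* ℓ ∸ k) - p ^ (2 ℕ.* ℓ)
    resTerm k = p ^ (2 ℕ.* ℓ ∸ k) - p ^ (2 ℕ.* ℓ) - fromℕ k * (p ^ (2 ℕ.* ℓ ∸ 1) - p ^ (2 ℕ.* ℓ))

    Var-T : ∀ n → Var n p (T H) ≈ ∑ (copies′ n) λ S → ∑ (copies′ n) λ S′ → varTerm (numSharedEdges S S′)
    Var-T n = begin
      Var n p (T H)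
        ≈⟨ ≈-trans (Var≈Cov p n (T H)) (Cov-cong p n (T≈present) (T≈present)) ⟩
      Cov n p (present (copies′ n) copyEdges) (present (copies′ n) copyEdges)
        ≈⟨ Cov-present p n (copies′ n) copyEdges (copies′ n) copyEdges ⟩
      ∑ (copies′ n) (λ S → ∑ (copies′ n) λ S′ →
        p ^ (∣ copyEdges S ∣ ℕ.+ ∣ copyEdges S′ ∣ ∸ numSharedEdges S S′) - p ^ (∣ copyEdges S ∣ ℕ.+ ∣ copyEdges S′ ∣))
        ≈⟨ ∑-cong-∈ (copies′ n) (λ {S} S∈ → ∑-cong-∈ (copies′ n) λ {S′} S′∈ →
             reflexive (cong (λ z → p ^ (z ∸ numSharedEdges S S′) - p ^ z) (sizes {S} {S′} S∈ S′∈))) ⟩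
      ∑ (copies′ n) (λ S → ∑ (copies′ n) λ S′ → varTerm (numSharedEdges S S′)) ∎
      where
      sizes : ∀ {S S′ : Subgraph n} → S ∈ᴸ copies′ n → S′ ∈ᴸ copies′ n → ∣ copyEdges S ∣ ℕ.+ ∣ copyEdges S′ ∣ ≡ 2 ℕ.* ℓ
      sizes S∈ S′∈ = cong₂ ℕ._+_ (size-of-copy S∈)
        (trans (size-of-copy S′∈) (sym (ℕ.+-identityʳ ℓ)))

    Cov-T-Tₑ : ∀ n → Cov n p (T H) Tₑ ≈ c′ n * fromℕ ℓ * (p ^ ℓ - p ^ suc ℓ)
    Cov-T-Tₑ n = ≈-trans (Cov-cong p n {Y = Tₑ} (T≈present) λ _ → ≈-refl) (Cov-present-Tₑ p n (copies′ n) copyEdges size-of-copy)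

    -- Both sides are `p ^ (2 l) (1 - p) ^ 2`; this form exhibits the factor `p - p ^ 2` of the
    -- variance of `Tₑ`.
    powers-identity : ∀ l → 1 ℕ.< l →
      (p ^ l - p ^ suc l) * (p ^ l - p ^ suc l) ≈ (p - p ^ 2) * (p ^ (2 ℕ.* l ∸ 1) - p ^ (2 ℕ.* l))
    powers-identity (suc l) _ = ≈-trans
      (solve 2 (λ p y → (p :* y :- p :* (p :* y)) :* (p :* y :- p :* (p :* y)) :=
                        (p :- p :^ 2) :* (y :* (p :* y) :- p :* (y :* (p :* y)))) ≈-refl p (p ^ l))
      (*-congˡ (+-cong (≈-sym p^) (-‿cong (*-congˡ (≈-sym p^)))))
      where
      p^ : p ^ (l ℕ.+ (suc l ℕ.+ 0)) ≈ p ^ l * (p * p ^ l)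
      p^ = ≈-trans (^-congʳ p (cong (l ℕ.+_) (ℕ.+-identityʳ (suc l)))) (^-homo-* p l (suc l))

    -- The squared covariance is `V * (D * δ)`, where `D` totals the overlaps of all pairs. Division
    -- by `V` leaves a sum over pairs that is linear in the overlap, and this can be subtracted term
    -- by term.
    ResVar-T : ∀ {n} → 1 ℕ.< ℓ → Edge n → (Var#0 : Var n p Tₑ # 0#) →
      ResVar n p Var#0 (T H) ≈ ∑ (copies′ n) λ S → ∑ (copies′ n) λ S′ → resTerm (numSharedEdges S S′)
    ResVar-T {n} 1<ℓ e₀ Var#0 = begin
      Var n p (T H) - Cov n p (T H) Tₑ ^ 2 * inverse Var#0
        ≈⟨ +-cong (Var-T n) (-‿cong explained) ⟩
      ∑ cs (λ S → ∑ cs λ S′ → varTerm (numSharedEdges S S′)) - D * δ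
        ≈⟨ +-congˡ (-‿cong (≈-trans (∑-cong cs λ S → ∑-*ʳ cs δ _) (∑-*ʳ cs δ _))) ⟨
      ∑ cs (λ S → ∑ cs λ S′ → varTerm (numSharedEdges S S′)) - ∑ cs (λ S → ∑ cs λ S′ → fromℕ (numSharedEdges S S′) * δ)
        ≈⟨ ≈-trans (∑-cong cs λ S → ∑-- cs _ _) (∑-- cs _ _) ⟨
      ∑ cs (λ S → ∑ cs λ S′ → resTerm (numSharedEdges S S′)) ∎
      where
      cs : List (Subgraph n)
      cs = copies′ n
      N D δ δ′ cℓ V : Carrier
      N = fromℕ (length (pairs n))
      D = ∑ cs (λ S → ∑ cs λ S′ → fromℕ (numSharedEdges S S′))
      δ = p ^ (2 ℕ.* ℓ ∸ 1) - p ^ (2 ℕ.* ℓ)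
      δ′ = p ^ ℓ - p ^ suc ℓ
      cℓ = c′ n * fromℕ ℓ
      V = Var n p Tₑ

      Cov² : Cov n p (T H) Tₑ ^ 2 ≈ V * (D * δ)
      Cov² = begin
        Cov n p (T H) Tₑ ^ 2              ≈⟨ ^-congˡ 2 (Cov-T-Tₑ n) ⟩
        (cℓ * δ′) ^ 2                     ≈⟨ solve 2 (λ x y → (x :* y) :^ 2 := (x :* x) :* (y :* y)) ≈-refl cℓ δ′ ⟩
        (cℓ * cℓ) * (δ′ * δ′)             ≈⟨ *-cong (≈-sym (shared-edges-total {n} e₀)) (powers-identity ℓ 1<ℓ) ⟩
        (N * D) * ((p - p ^ 2) * δ)       ≈⟨ solve 4 (λ N D q d → (N :* D) :* (q :* d) := (N :* q) :* (D :* d)) ≈-refl N D (p - p ^ 2) δ ⟩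
        (N * (p - p ^ 2)) * (D * δ)       ≈⟨ *-congʳ (Var-Tₑ p n) ⟨
        V * (D * δ)                       ∎

      explained : Cov n p (T H) Tₑ ^ 2 * inverse Var#0 ≈ D * δ
      explained = begin
        Cov n p (T H) Tₑ ^ 2 * inverse Var#0   ≈⟨ *-congʳ Cov² ⟩
        V * (D * δ) * inverse Var#0            ≈⟨ solve 3 (λ V x i → V :* x :* i := (V :* i) :* x) ≈-refl V (D * δ) (inverse Var#0) ⟩
        (V * inverse Var#0) * (D * δ)          ≈⟨ *-congʳ (x*inverse≈1 Var#0) ⟩
        1# * (D * δ)                           ≈⟨ *-identityˡ _ ⟩
        D * δ                                  ∎

    Var-Tₑ#0 : 0# < p → p < 1# → ∀ {n} → Edge n → Var n p Tₑ # 0#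
    Var-Tₑ#0 0<p p<1 {n} e₀ = #-congˡ (≈-sym (Var-Tₑ p n)) (#-sym (<⇒# (*-pos (0<N e₀)
      (<-respʳ-≈ p[1-p]≈p-p² (*-pos 0<p (<-respˡ-≈ (-‿inverseʳ p) (+-monoˡ-< (- p) p<1)))))))
      where
      0<N : ∀ {N} → Fin N → 0# < fromℕ N
      0<N {suc N} _ = 0<fromℕ N
      p[1-p]≈p-p² : p * (1# - p) ≈ p - p ^ 2
      p[1-p]≈p-p² = ≈-trans (solve 2 (λ p o → p :* (o :- p) := p :* o :- p :^ 2) ≈-refl p 1#) (+-congʳ (*-identityʳ p))

    varTerm₀ : varTerm 0 ≈ 0#
    varTerm₀ = -‿inverseʳ _

    resTerm₀ : resTerm 0 ≈ 0#
    resTerm₀ = solve 2 (λ x y → x :- x :- con ℤ.0ℤ :* y := con ℤ.0ℤ) ≈-refl (p ^ (2 ℕ.* ℓ)) _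

    resTerm₁ : resTerm 1 ≈ 0#
    resTerm₁ = solve 2 (λ x y → x :- y :- con ℤ.1ℤ :* (x :- y) := con ℤ.0ℤ) ≈-refl (p ^ (2 ℕ.* ℓ ∸ 1)) (p ^ (2 ℕ.* ℓ))

    -- Once `p ^ (2 ℓ - j)` is split off from every power, `resTerm j` is that power times a
    -- polynomial in `p`, which the ring solver can handle.
    p^2ℓ : ∀ {j} → j ℕ.≤ 2 ℕ.* ℓ → p ^ (2 ℕ.* ℓ) ≈ p ^ j * p ^ (2 ℕ.* ℓ ∸ j)
    p^2ℓ {j} j≤2ℓ = ≈-trans (^-congʳ p (sym (ℕ.m+[n∸m]≡n j≤2ℓ))) (^-homo-* p j (2 ℕ.* ℓ ∸ j))

    p^2ℓ-1 : ∀ {j} → suc j ℕ.≤ 2 ℕ.* ℓ → p ^ (2 ℕ.* ℓ ∸ 1) ≈ p ^ j * p ^ (2 ℕ.* ℓ ∸ suc j)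
    p^2ℓ-1 {j} j<2ℓ = ≈-trans (^-congʳ p (sym (cong (_∸ 1) (ℕ.m+[n∸m]≡n j<2ℓ)))) (^-homo-* p j (2 ℕ.* ℓ ∸ suc j))

    resTerm₂ : 2 ℕ.≤ 2 ℕ.* ℓ → resTerm 2 ≈ p ^ (2 ℕ.* ℓ ∸ 2) * (1# - p) ^ 2
    resTerm₂ 2≤2ℓ = begin
      resTerm 2
        ≈⟨ +-cong (+-congˡ (-‿cong (p^2ℓ 2≤2ℓ))) (-‿cong (*-congˡ (+-cong (p^2ℓ-1 2≤2ℓ) (-‿cong (p^2ℓ 2≤2ℓ))))) ⟩
      x - p ^ 2 * x - fromℕ 2 * (p ^ 1 * x - p ^ 2 * x)
        ≈⟨ solve 2 (λ p x → x :- p :^ 2 :* x :- con (ℤ.+ 2) :* (p :^ 1 :* x :- p :^ 2 :* x) := x :* (con ℤ.1ℤ :- p) :^ 2) ≈-refl p x ⟩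
      x * (fromℕ 1 - p) ^ 2
        ≈⟨ *-congˡ (^-congˡ 2 (+-congʳ (+-identityʳ 1#))) ⟩
      x * (1# - p) ^ 2 ∎
      where
      x : Carrier
      x = p ^ (2 ℕ.* ℓ ∸ 2)

    resTerm₃ : 3 ℕ.≤ 2 ℕ.* ℓ → resTerm 3 ≈ p ^ (2 ℕ.* ℓ ∸ 3) * (1# - fromℕ 3 * p ^ 2 + fromℕ 2 * p ^ 3)
    resTerm₃ 3≤2ℓ = begin
      resTerm 3
        ≈⟨ +-cong (+-congˡ (-‿cong (p^2ℓ 3≤2ℓ))) (-‿cong (*-congˡ (+-cong (p^2ℓ-1 3≤2ℓ) (-‿cong (p^2ℓ 3≤2ℓ))))) ⟩
      x - p ^ 3 * x - fromℕ 3 * (p ^ 2 * x - p ^ 3 * x)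
        ≈⟨ solve 2 (λ p x → x :- p :^ 3 :* x :- con (ℤ.+ 3) :* (p :^ 2 :* x :- p :^ 3 :* x) :=
                            x :* (con ℤ.1ℤ :- con (ℤ.+ 3) :* p :^ 2 :+ con (ℤ.+ 2) :* p :^ 3)) ≈-refl p x ⟩
      x * (fromℕ 1 - fromℕ 3 * p ^ 2 + fromℕ 2 * p ^ 3)
        ≈⟨ *-congˡ (+-congʳ (+-congʳ (+-identityʳ 1#))) ⟩
      x * (1# - fromℕ 3 * p ^ 2 + fromℕ 2 * p ^ 3) ∎
      where
      x : Carrier
      x = p ^ (2 ℕ.* ℓ ∸ 3)

  O-numPairs : ∀ {k m} → m ℕ.* suc m ℕ.< 2 ℕ.* k → 2 ℕ.+ m ℕ.≤ 2 ℕ.* v → ∀ x →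
    O[n^ 2 ℕ.* v ∸ (2 ℕ.+ m) ] {v} (λ n _ → C[ H ] n k * x)
  O-numPairs {k} {m} m[m+1]<2k m+2≤2v x = O-cong d (λ n _ → *-comm x (C[ H ] n k))
    (O-*ˡ d x (O-fromℕ d (suc v ℕ.^ v) {λ n _ → numPairs H n k} λ n _ → numPairs-≤ H {k} {m} m[m+1]<2k m+2≤2v n))
    where
    d : ℕ
    d = 2 ℕ.* v ∸ (2 ℕ.+ m)

  -- The condition on `j` passes to all larger overlaps, and the number `N` of terms does not depend
  -- on `n`.
  O-∑-numPairs : ∀ {m} j → m ℕ.* suc m ℕ.< 2 ℕ.* j → 2 ℕ.+ m ℕ.≤ 2 ℕ.* v → ∀ N (x : ℕ → Carrier) →
    O[n^ 2 ℕ.* v ∸ (2 ℕ.+ m) ] {v} (λ n _ → sum {N} λ k → C[ H ] n (j ℕ.+ toℕ k) * x (j ℕ.+ toℕ k))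
  O-∑-numPairs {m} j m[m+1]<2j m+2≤2v N x = O-sum (2 ℕ.* v ∸ (2 ℕ.+ m)) N λ k → O-numPairs {j ℕ.+ toℕ k} {m}
    (ℕ.≤-trans m[m+1]<2j (ℕ.*-monoʳ-≤ 2 (ℕ.m≤m+n j (toℕ k)))) m+2≤2v (x (j ℕ.+ toℕ k))

  -- The lower bound for the falling factorial makes the error a multiple of the natural number
  -- `remainder n`, and the upper bound gives the order of that number.
  𝔼-T-asymptotics : ∀ p → 2 ℕ.≤ v → O[n^ v ∸ 2 ] {v} (λ n _ → 𝔼 n p (T H) -
    (1# ÷∣Aut H ∣) * (fromℕ n ^ v - (fromℕ (v ℕ.* (v ∸ 1)) ÷ℕ 2) * fromℕ n ^ (v ∸ 1)) * p ^ ℓ)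
  𝔼-T-asymptotics p 2≤v =
    let K , bound = nP′v+tnᵛ⁻¹≤nᵛ+Knᵛ⁻² 2≤v in
    O-cong (v ∸ 2) (λ n v≤n → ≈-sym (difference n v≤n)) (O-*ˡ (v ∸ 2) (∣Aut∣⁻¹ * p ^ ℓ)
      (O-fromℕ (v ∸ 2) K {λ n _ → remainder n} λ n v≤n 1≤n → ℕ.m≤n+o⇒m∸n≤o _ (n ℕ.^ v) (bound n v≤n 1≤n)))
    where
    remainder : ℕ → ℕ
    remainder n = n P′ v ℕ.+ triangle v ℕ.* n ℕ.^ (v ∸ 1) ∸ n ℕ.^ v

    ½v[v-1]≈triangle : fromℕ (v ℕ.* (v ∸ 1)) ÷ℕ 2 ≈ fromℕ (triangle v)
    ½v[v-1]≈triangle = ≈-trans (*-congʳ (≈-trans (fromℕ-cong (sym (triangle-*-2 v))) (fromℕ-* (triangle v) 2)))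
      (≈-trans (*-assoc _ _ _) (≈-trans (*-congˡ (x*inverse≈1 (fromℕ#0 2))) (*-identityʳ _)))

    difference : ∀ n → v ℕ.≤ n → 𝔼 n p (T H) -
      (1# ÷∣Aut H ∣) * (fromℕ n ^ v - (fromℕ (v ℕ.* (v ∸ 1)) ÷ℕ 2) * fromℕ n ^ (v ∸ 1)) * p ^ ℓ ≈
      ∣Aut∣⁻¹ * p ^ ℓ * fromℕ (remainder n)
    difference n v≤n = begin
      𝔼 n p (T H) - (1# * ∣Aut∣⁻¹) * (fromℕ n ^ v - (fromℕ (v ℕ.* (v ∸ 1)) ÷ℕ 2) * fromℕ n ^ (v ∸ 1)) * p ^ ℓ
        ≈⟨ +-cong (𝔼-T p v≤n) (-‿cong (*-congʳ (*-cong (*-identityˡ ∣Aut∣⁻¹)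
             (+-congˡ (-‿cong (*-congʳ ½v[v-1]≈triangle)))))) ⟩
      fromℕ (n P v) * ∣Aut∣⁻¹ * p ^ ℓ - ∣Aut∣⁻¹ * (fromℕ n ^ v - fromℕ (triangle v) * fromℕ n ^ (v ∸ 1)) * p ^ ℓ
        ≈⟨ solve 5 (λ a i y q s → a :* i :* y :- i :* (q :- s) :* y := i :* y :* (a :+ s :- q)) ≈-refl
             (fromℕ (n P v)) ∣Aut∣⁻¹ (p ^ ℓ) (fromℕ n ^ v) (fromℕ (triangle v) * fromℕ n ^ (v ∸ 1)) ⟩
      ∣Aut∣⁻¹ * p ^ ℓ * (fromℕ (n P v) + fromℕ (triangle v) * fromℕ n ^ (v ∸ 1) - fromℕ n ^ v)
        ≈⟨ *-congˡ (+-cong (+-cong (fromℕ-cong (sym (nP≡nP′ v≤n)))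
             (≈-trans (fromℕ-* (triangle v) (n ℕ.^ (v ∸ 1))) (*-congˡ (fromℕ-^ n (v ∸ 1))))) (-‿cong (fromℕ-^ n v))) ⟨
      ∣Aut∣⁻¹ * p ^ ℓ * (fromℕ (n P′ v) + fromℕ (triangle v ℕ.* n ℕ.^ (v ∸ 1)) - fromℕ (n ℕ.^ v))
        ≈⟨ *-congˡ (≈-trans (fromℕ-∸ (nᵛ≤nP′v+tnᵛ⁻¹ 2≤v (ℕ.≤-trans (ℕ.<⇒≤ 2≤v) v≤n)))
             (+-congʳ (fromℕ-+ (n P′ v) (triangle v ℕ.* n ℕ.^ (v ∸ 1))))) ⟨
      ∣Aut∣⁻¹ * p ^ ℓ * fromℕ (remainder n) ∎

  module _ (p : Carrier) (1<ℓ : 1 ℕ.< ℓ) where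

    private
      2≤v : 2 ℕ.≤ v
      2≤v = 2≤order H 1<ℓ

      4≤2v : 4 ℕ.≤ 2 ℕ.* v
      4≤2v = ℕ.*-monoʳ-≤ 2 2≤v

      4≤2ℓ : 4 ℕ.≤ 2 ℕ.* ℓ
      4≤2ℓ = ℕ.*-monoʳ-≤ 2 1<ℓ

    some-edge : ∀ {n} → v ℕ.≤ n → Edge n
    some-edge v≤n = first-edge (ℕ.≤-trans 2≤v v≤n)
      where
      first-edge : ∀ {n} → 2 ℕ.≤ n → Edge n
      first-edge {suc (suc n)} (ℕ.s≤s (ℕ.s≤s _)) = proj₁ (edge-between {suc (suc n)} {zero} {suc zero} λ ())

    Var-T-by-overlap : ∀ n → Var n p (T H) ≈ sum {suc ℓ} λ k → C[ H ] n (toℕ k) * varTerm p (toℕ k)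
    Var-T-by-overlap n = ≈-trans (Var-T p n) (∑-over-pairs n ℕ.≤-refl (varTerm p))

    C*0≈0 : ∀ n k {x} → x ≈ 0# → C[ H ] n k * x ≈ 0#
    C*0≈0 n k x≈0 = ≈-trans (*-congˡ x≈0) (zeroʳ _)

    Var-T-asymptotics : O[n^ 2 ℕ.* v ∸ 2 ] {v} (λ n _ → Var n p (T H))
    Var-T-asymptotics = O-cong (2 ℕ.* v ∸ 2)
      (λ n _ → ≈-sym (≈-trans (Var-T-by-overlap n) (≈-trans (+-congʳ (C*0≈0 n 0 (varTerm₀ p))) (+-identityˡ _))))
      -- Here `m = 0`: overlaps of at least one edge confine two vertices.
      (O-∑-numPairs {0} 1 (ℕ.s≤s ℕ.z≤n) (ℕ.≤-trans (ℕ.m≤m+n 2 2) 4≤2v) ℓ (varTerm p))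

    module _ (Var#0 : ∀ n → v ℕ.≤ n → Var n p Tₑ # 0#) where

      ResVar-T-by-overlap : ∀ {m} → ℓ ℕ.< m → ∀ n (v≤n : v ℕ.≤ n) →
        ResVar n p (Var#0 n v≤n) (T H) ≈ sum {m} λ k → C[ H ] n (toℕ k) * resTerm p (toℕ k)
      ResVar-T-by-overlap ℓ<m n v≤n = ≈-trans (ResVar-T p {n} 1<ℓ (some-edge v≤n) (Var#0 n v≤n))
        (∑-over-pairs n ℓ<m (resTerm p))

      -- C_k vanishes for k > ℓ, so the sum may be extended to always contain the terms k ≤ 3.
      tail : ∀ j → ℕ → Carrier
      tail j n = sum {4 ℕ.+ ℓ ∸ j} λ k → C[ H ] n (j ℕ.+ toℕ k) * resTerm p (j ℕ.+ toℕ k)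

      ResVar-T-tail : ∀ n (v≤n : v ℕ.≤ n) → ResVar n p (Var#0 n v≤n) (T H) ≈ tail 2 n
      ResVar-T-tail n v≤n = begin
        ResVar n p (Var#0 n v≤n) (T H)
          ≈⟨ ResVar-T-by-overlap {4 ℕ.+ ℓ} (ℕ.m≤n+m (suc ℓ) 3) n v≤n ⟩
        -- The range `4 ℕ.+ ℓ` makes the first terms split off by computation, whatever `ℓ` is.
        C[ H ] n 0 * resTerm p 0 + (C[ H ] n 1 * resTerm p 1 + tail 2 n)
          ≈⟨ ≈-trans (+-cong (C*0≈0 n 0 (resTerm₀ p)) (+-congʳ (C*0≈0 n 1 (resTerm₁ p))))
               (≈-trans (+-identityˡ _) (+-identityˡ _)) ⟩
        tail 2 n ∎

      ResVar-T-asymptotics₃ : O[n^ 2 ℕ.* v ∸ 3 ] {v} (λ n v≤n → ResVar n p (Var#0 n v≤n) (T H))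
      ResVar-T-asymptotics₃ = O-cong (2 ℕ.* v ∸ 3) (λ n v≤n → ≈-sym (ResVar-T-tail n v≤n))
        -- Here `m = 1`, and `1 * 2 < 2 * 2`.
        (O-∑-numPairs {1} 2 (ℕ.m≤m+n 3 1) (ℕ.≤-trans (ℕ.m≤m+n 3 1) 4≤2v) (2 ℕ.+ ℓ) (resTerm p))

      ResVar-T-asymptotics₄ : O[n^ 2 ℕ.* v ∸ 4 ] {v} (λ n v≤n → ResVar n p (Var#0 n v≤n) (T H) -
        ( C[ H ] n 2 * p ^ (2 ℕ.* ℓ ∸ 2) * (1# - p) ^ 2
        + C[ H ] n 3 * p ^ (2 ℕ.* ℓ ∸ 3) * (1# - fromℕ 3 * p ^ 2 + fromℕ 2 * p ^ 3)))
      ResVar-T-asymptotics₄ = O-cong (2 ℕ.* v ∸ 4) (λ n v≤n → ≈-sym (difference n v≤n))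
        -- Here `m = 2`, and `2 * 3 < 2 * 4`. An overlap of three edges would fail this test, since
        -- a triangle has only three vertices; so `C_3` remains in the main term.
        (O-∑-numPairs {2} 4 (ℕ.m≤m+n 7 1) 4≤2v ℓ (resTerm p))
        where
        difference : ∀ n (v≤n : v ℕ.≤ n) → ResVar n p (Var#0 n v≤n) (T H) -
          ( C[ H ] n 2 * p ^ (2 ℕ.* ℓ ∸ 2) * (1# - p) ^ 2
          + C[ H ] n 3 * p ^ (2 ℕ.* ℓ ∸ 3) * (1# - fromℕ 3 * p ^ 2 + fromℕ 2 * p ^ 3)) ≈ tail 4 n
        difference n v≤n = begin
          ResVar n p (Var#0 n v≤n) (T H) - (t₂ + t₃)
            ≈⟨ +-congʳ (≈-trans (ResVar-T-tail n v≤n) (+-cong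
                 (≈-trans (*-congˡ (resTerm₂ p (ℕ.≤-trans (ℕ.m≤m+n 2 2) 4≤2ℓ))) (≈-sym (*-assoc _ _ _)))
                 (+-congʳ (≈-trans (*-congˡ (resTerm₃ p (ℕ.≤-trans (ℕ.m≤m+n 3 1) 4≤2ℓ))) (≈-sym (*-assoc _ _ _)))))) ⟩
          t₂ + (t₃ + tail 4 n) - (t₂ + t₃)
            ≈⟨ solve 3 (λ x y z → x :+ (y :+ z) :- (x :+ y) := z) ≈-refl t₂ t₃ (tail 4 n) ⟩
          tail 4 n ∎
          where
          t₂ t₃ : Carrier
          t₂ = C[ H ] n 2 * p ^ (2 ℕ.* ℓ ∸ 2) * (1# - p) ^ 2
          t₃ = C[ H ] n 3 * p ^ (2 ℕ.* ℓ ∸ 3) * (1# - fromℕ 3 * p ^ 2 + fromℕ 2 * p ^ 3)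

theorem2p1 : ∀ {c ℓ₁ ℓ₂ ℓ₃} (F : OrderedField c ℓ₁ ℓ₂ ℓ₃) →
    let open OrderedField F
        open RandomGraph F in
    ∀ {v} (H : Graph v) →
    let ℓ = numEdges H in
    1 ℕ.< ℓ → EveryVertexOnEdge H →
    ∀ p → 0# < p → p < 1# →
      ( (∀ n → v ℕ.≤ n → 𝔼 n p (T H) ≈ c[ H ] n * p ^ ℓ)
      × O[n^ v ∸ 2 ] {v} (λ n _ → 𝔼 n p (T H) -
          (1# ÷∣Aut H ∣) *
          (fromℕ n ^ v - (fromℕ (v ℕ.* (v ∸ 1)) ÷ℕ 2) * fromℕ n ^ (v ∸ 1)) * p ^ ℓ))
    × ( (∀ n → v ℕ.≤ n → Var n p (T H) ≈
          ∑[ k ≤ ℓ ] (C[ H ] n (toℕ k) * (p ^ (2 ℕ.* ℓ ∸ toℕ k) - p ^ (2 ℕ.* ℓ))))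
      × O[n^ 2 ℕ.* v ∸ 2 ] {v} (λ n _ → Var n p (T H)))
    × ( Σ[ Var#0 ∈ (∀ n → v ℕ.≤ n → Var n p Tₑ # 0#) ]
          (∀ n (v≤n : v ℕ.≤ n) → ResVar n p (Var#0 n v≤n) (T H) ≈
            ∑[ k ≤ ℓ ] (C[ H ] n (toℕ k) *
              (p ^ (2 ℕ.* ℓ ∸ toℕ k) - p ^ (2 ℕ.* ℓ)
                - fromℕ (toℕ k) * (p ^ (2 ℕ.* ℓ ∸ 1) - p ^ (2 ℕ.* ℓ)))))
        × O[n^ 2 ℕ.* v ∸ 4 ] {v} (λ n v≤n → ResVar n p (Var#0 n v≤n) (T H) -
            ( C[ H ] n 2 * p ^ (2 ℕ.* ℓ ∸ 2) * (1# - p) ^ 2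
            + C[ H ] n 3 * p ^ (2 ℕ.* ℓ ∸ 3) *
                (1# - fromℕ 3 * p ^ 2 + fromℕ 2 * p ^ 3)))
        × O[n^ 2 ℕ.* v ∸ 3 ] {v} (λ n v≤n → ResVar n p (Var#0 n v≤n) (T H)))
theorem2p1 F H 1<ℓ _ p 0<p p<1 =
    ((λ n → 𝔼-T p) , 𝔼-T-asymptotics p (2≤order H 1<ℓ))
  , ((λ n _ → Var-T-by-overlap p 1<ℓ n) , Var-T-asymptotics p 1<ℓ)
  , Var#0
  -- The least admissible range, `suc ℓ` terms, is the sum over `k ≤ ℓ`.
  , ResVar-T-by-overlap p 1<ℓ Var#0 ℕ.≤-refl
  , ResVar-T-asymptotics₄ p 1<ℓ Var#0
  , ResVar-T-asymptotics₃ p 1<ℓ Var#0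
  where
  open SubgraphCounts F H
  Var#0 : ∀ n → _ ℕ.≤ n → OrderedField._#_ F (RandomGraph.Var F n p (RandomGraph.Tₑ F)) (OrderedField.0# F)
  Var#0 n v≤n = Var-Tₑ#0 p 0<p p<1 {n} (some-edge p 1<ℓ v≤n)
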